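{- Let $(G,x)$ be a half-integral cycle cut instance of the TSP, with $G=(V,E)$ and edge costs $c$. Let $r\in V$ be any root, and let $\mu$ be the max entropy distribution over 1-trees with marginals $x$ and root $r$. For $T\sim\mu$, let $M$ be a minimum-cost perfect matching (in the complete graph $G$ with costs $c$) on the set of odd-degree vertices of $T$. Then $$\mathbb{E}_{T\sim\mu}\left[c(T)+c(M)\right]\le \frac{10}{7}\,c(x),\qquad\text{where } c(x)=\sum_{e\in E}c_e x_e .$$ In other words, the max entropy algorithm (sample $T\sim\mu$, then add $M$) is a $\frac{10}{7}$-approximation for $(G,x)$.
   Context: **TSP instance.** $G=(V,E)$ is a finite complete graph with symmetric edge costs $c_e=c_{ij}$ for $e=\{i,j\}$ satisfying the triangle inequality $c_{ij}\le c_{ik}+c_{kj}$. For an edge (multi)set $F$, $c(F)=\sum_{e\in F}c_e$ (with multiplicity). $\delta(S)$ is the set of edges with exactly one endpoint in $S$; $\delta(v)=\delta(\{v\})$; $x(F)=\sum_{e\in F}x_e$. **Subtour LP feasibility.** $x\in\mathbb{R}^E$ is feasible if $x(\delta(v))=2$ for all $v\in V$, $x(\delta(S))\ge 2$ for all $\emptyset\ne S\subsetneq V$, and $0\le x_e\le 1$ for all $e$. **Half-integral cycle cut instance.** $(G,x)$ is half-integral if $G$ is a TSP instance, $x$ is feasible for the Subtour LP, and $x_e\in\{0,\frac12,1\}$ for all $e$. A set $S\subseteq V$ is tight if $x(\delta(S))=2$. $(G,x)$ is a cycle cut instance if every tight set $S$ with $|S|\ge 2$ can be partitioned as $S=A\cup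 B$ with both $A$ and $B$ tight. **Splitting edges.** Discard edges with $x_e=0$ and replace each edge with $x_e=1$ by two parallel copies of value $\frac12$ (each copy having the cost of the original edge). This gives a 4-regular multigraph on $V$ with value $\frac12$ on every edge; every tight set $S$ then has exactly four edges in $\delta(S)$. **Hierarchy.** Fix a root $r\in V$. Starting from the tight set $V\setminus\{r\}$, recursively partition each tight set with at least two elements into two tight sets. This yields a binary tree $\mathcal{T}$ of tight sets whose root is $V\setminus\{r\}$ and whose leaves are the singletons $\{v\}$, $v\ne r$. If $S\in\mathcal{T}$ has children $A,B$, then $\delta(A)\cap\delta(B)$ consists of exactly two edges (called cycle partners), exactly two edges of $\delta(S)$ lie in $\delta(A)$, and the other two lie in $\delta(B)$. **Max entropy distribution over 1-trees (on a half-integral cycle cut instance).** A 1-tree is a spanning tree plus one additional edge. On a half-integral cycle cut instance the max entropy distribution over 1-trees with marginals $x$ and root $r$ is the following random edge set $T$ of the split multigraph. For every non-leaf $S\in\mathcal{T}$ with children $A,B$, choose exactly one of the two edges of $\delta(A)\cap\delta(B)$ uniformly at random. In addition, if $A,B$ are the children of $V\setminus\{r\}$, with $\{e,f\}=\delta(r)\cap\delta(A)$ and $\{g,h\}=\delta(r)\cap\delta(B)$, choose exactly one of $e,f$ and exactly one of $g,h$ uniformly at random. All of these choices are mutually independent. -}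

module Defs where

open import Algebra.Bundles using (CommutativeRing)
open import Algebra.Core using (Op₁; Op₂)
open import Algebra.Structures using (IsCommutativeRing)
import Algebra.Properties.CommutativeMonoid.Sum as Sum
import Algebra.Properties.Semiring.Mult as Mult
open import Data.Bool.Base using (if_then_else_; not; _xor_)
open import Data.Fin.Base using (Fin)
import Data.Fin.Properties as Fin
open import Data.Fin.Subset
  using (Subset; _∈_; _∉_; ⊤; ⊥; ⁅_⁆; ∁; _∩_; _∪_; ∣_∣; Nonempty)
open import Data.Fin.Subset.Properties using (_∈?_)
open import Data.List.Base as List
  using (List; []; _∷_; allFin; cartesianProduct; concatMap; filter; length)
open import Data.Nat.Base as ℕ using (ℕ)
open import Data.Nat.Divisibility using (_∣?_)
open import Data.Product.Base using (_×_; _,_; uncurry; ∃-syntax)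
open import Data.Sum.Base using (_⊎_)
import Data.Vec.Base as Vec
open import Level using (_⊔_; suc)
open import Relation.Binary.Core using (Rel)
open import Relation.Binary.Structures using (IsDecTotalOrder)
open import Relation.Binary.PropositionalEquality.Core using (_≡_; _≢_)
open import Relation.Nullary.Decidable.Core using (does)
open import Relation.Nullary.Negation.Core using (¬_)

-- Costs and LP values live in an arbitrary linearly ordered field; the
-- (classical) real numbers are one.  The inverse is total, with an unspecified
-- value at 0#.
record OrderedField a ℓ₁ ℓ₂ : Set (suc (a ⊔ ℓ₁ ⊔ ℓ₂)) where
  infix  9 _⁻¹
  infix  8 -_
  infixl 7 _*_
  infixl 6 _+_
  infix  4 _≈_ _≉_ _≤_
  field
    Carrier           : Set a
    _≈_               : Rel Carrier ℓ₁
    _≤_               : Rel Carrier ℓ₂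
    _+_               : Op₂ Carrier
    _*_               : Op₂ Carrier
    -_                : Op₁ Carrier
    0#                : Carrier
    1#                : Carrier
    _⁻¹               : Op₁ Carrier
    isCommutativeRing : IsCommutativeRing _≈_ _+_ _*_ -_ 0# 1#
    isDecTotalOrder   : IsDecTotalOrder _≈_ _≤_

  _≉_ : Rel Carrier ℓ₁
  x ≉ y = ¬ (x ≈ y)

  field
    0≉1        : 0# ≉ 1#
    *-inverseʳ : ∀ x → x ≉ 0# → x * x ⁻¹ ≈ 1#
    +-monoʳ-≤  : ∀ x {y z} → y ≤ z → x + y ≤ x + z
    *-nonNeg   : ∀ {x y} → 0# ≤ x → 0# ≤ y → 0# ≤ x * y

  commutativeRing : CommutativeRing a ℓ₁
  commutativeRing = record { isCommutativeRing = isCommutativeRing }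

  open CommutativeRing commutativeRing public
    using (semiring; +-commutativeMonoid)
  open IsDecTotalOrder isDecTotalOrder public using (_≟_; _≤?_)

  fromℕ : ℕ → Carrier
  fromℕ k = k · 1#
    where open Mult semiring using () renaming (_×_ to _·_)

  ½ : Carrier
  ½ = fromℕ 2 ⁻¹

-- A multigraph on Fin n is the list of endpoint pairs of its edges; an edge is a
-- position in the list, so parallel edges remain distinct.
Multigraph : ℕ → Set
Multigraph n = List (Fin n × Fin n)

module _ {n : ℕ} (G : Multigraph n) where

  Edge : Set
  Edge = Fin (length G)

  EdgeSet : Set
  EdgeSet = Subset (length G)

  ends : Edge → Fin n × Fin n
  ends = List.lookup G

  δ : Subset n → EdgeSet
  δ S = Vec.tabulate λ e →
    uncurry (λ i j → Vec.lookup S i xor Vec.lookup S j) (ends e)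

  degree : EdgeSet → Fin n → ℕ
  degree F v = ∣ F ∩ δ ⁅ v ⁆ ∣

  oddVertices : EdgeSet → Subset n
  oddVertices F = Vec.tabulate λ v → not (does (2 ∣? degree F v))

  -- The condition on the vertices outside O says that every edge of M has both
  -- endpoints in O.
  record IsPerfectMatchingOn (O : Subset n) (M : EdgeSet) : Set where
    field
      covered : ∀ v → v ∈ O → degree M v ≡ 1
      avoided : ∀ v → v ∉ O → degree M v ≡ 0

-- The complete graph: each unordered pair {i , j} is listed once, with i < j.
complete : ∀ n → Multigraph n
complete n = filter (uncurry Fin._<?_) (cartesianProduct (allFin n) (allFin n))

record _PartitionsInto_and_ {n} (S A B : Subset n) : Set where
  field
    nonemptyˡ : Nonempty A
    nonemptyʳ : Nonempty B
    disjoint  : A ∩ B ≡ ⊥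
    covering  : A ∪ B ≡ S

module TSP {a ℓ₁ ℓ₂} (K : OrderedField a ℓ₁ ℓ₂) where

  open OrderedField K
  open Sum +-commutativeMonoid using (sum)

  -- A vector indexed by the edges of the complete graph, as a matrix.  Values on
  -- the diagonal are never used.
  EdgeVector : ℕ → Set a
  EdgeVector n = Fin n → Fin n → Carrier

  Symmetric : ∀ {n} → EdgeVector n → Set ℓ₁
  Symmetric w = ∀ i j → w i j ≈ w j i

  total : ∀ {n} (G : Multigraph n) → EdgeVector n → EdgeSet G → Carrier
  total G w F = sum λ e →
    if Vec.lookup F e then uncurry w (ends G e) else 0#

  lpCost : ∀ {n} → EdgeVector n → EdgeVector n → Carrier
  lpCost {n} c x = total (complete n) (λ i j → c i j * x i j) ⊤

  record IsTSPInstance {n} (c : EdgeVector n) : Set (ℓ₁ ⊔ ℓ₂) where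
    field
      symmetric : Symmetric c
      triangle  : ∀ i j k → i ≢ j → i ≢ k → k ≢ j → c i j ≤ c i k + c k j

  cutValue : ∀ {n} → EdgeVector n → Subset n → Carrier
  cutValue {n} x S = total (complete n) x (δ (complete n) S)

  record IsSubtourFeasible {n} (x : EdgeVector n) : Set (ℓ₁ ⊔ ℓ₂) where
    field
      symmetric : Symmetric x
      degree≈2  : ∀ v → cutValue x ⁅ v ⁆ ≈ fromℕ 2
      cut≥2     : ∀ S → Nonempty S → S ≢ ⊤ → fromℕ 2 ≤ cutValue x S
      nonNeg    : ∀ i j → i ≢ j → 0# ≤ x i j
      ≤1        : ∀ i j → i ≢ j → x i j ≤ 1#

  Tight : ∀ {n} → EdgeVector n → Subset n → Set ℓ₁
  Tight x S = cutValue x S ≈ fromℕ 2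

  record IsHalfIntegralCycleCut {n} (c x : EdgeVector n) : Set (ℓ₁ ⊔ ℓ₂) where
    field
      isTSPInstance : IsTSPInstance c
      isFeasible    : IsSubtourFeasible x
      halfIntegral  : ∀ i j → i ≢ j → x i j ≈ 0# ⊎ x i j ≈ ½ ⊎ x i j ≈ 1#
      cycleCut      : ∀ S → Tight x S → 2 ℕ.≤ ∣ S ∣ →
                      ∃[ A ] ∃[ B ] S PartitionsInto A and B × Tight x A × Tight x B

  copies : Carrier → ℕ
  copies y = if does (y ≟ 1#) then 2 else if does (y ≟ ½) then 1 else 0

  split : ∀ {n} → EdgeVector n → Multigraph n
  split {n} x =
    concatMap (λ (i , j) → List.replicate (copies (x i j)) (i , j)) (complete n)

  record Split {n} (x : EdgeVector n) (S : Subset n) : Set ℓ₁ where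
    field
      A B       : Subset n
      partition : S PartitionsInto A and B
      tightˡ    : Tight x A
      tightʳ    : Tight x B

  data Tree {n} (x : EdgeVector n) (S : Subset n) : Set ℓ₁ where
    leaf : ∀ v → S ≡ ⁅ v ⁆ → Tree x S
    node : (s : Split x S) → Tree x (Split.A s) → Tree x (Split.B s) → Tree x S

  -- The root V ∖ {r} is required to be a non-leaf: n ≥ 3 for every feasible x.
  record Hierarchy {n} (x : EdgeVector n) (r : Fin n) : Set ℓ₁ where
    field
      top   : Split x (∁ ⁅ r ⁆)
      left  : Tree x (Split.A top)
      right : Tree x (Split.B top)

    tree : Tree x (∁ ⁅ r ⁆)
    tree = node top left right

  -- Finitely supported distributions: lists of outcomes with probabilities.
  Dist : ∀ {b} → Set b → Set (a ⊔ b)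
  Dist X = List (Carrier × X)

  return : ∀ {b} {X : Set b} → X → Dist X
  return y = (1# , y) ∷ []

  infixl 1 _>>=_
  _>>=_ : ∀ {b d} {X : Set b} {Y : Set d} → Dist X → (X → Dist Y) → Dist Y
  μ >>= f = concatMap (λ (p , y) → List.map (λ (q , z) → p * q , z) (f y)) μ

  uniform : ∀ {m} → Subset m → Dist (Fin m)
  uniform {m} F =
    List.map (λ e → fromℕ ∣ F ∣ ⁻¹ , e) (filter (_∈? F) (allFin m))

  𝔼 : ∀ {b} {X : Set b} → Dist X → (X → Carrier) → Carrier
  𝔼 μ f = List.foldr (λ (p , y) s → p * f y + s) 0# μ

  -- Nothing drawn is used to choose a later distribution, so the draws are
  -- mutually independent.
  treeEdges : ∀ {n} (x : EdgeVector n) {S} → Tree x S → Dist (EdgeSet (split x))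
  treeEdges x (leaf _ _)   = return ⊥
  treeEdges x (node s l r) = do
    e  ← uniform (δ (split x) (Split.A s) ∩ δ (split x) (Split.B s))
    Tˡ ← treeEdges x l
    Tʳ ← treeEdges x r
    return (⁅ e ⁆ ∪ (Tˡ ∪ Tʳ))

  -- The explicit form of the max entropy distribution on cycle cut instances.
  maxEntropy : ∀ {n} (x : EdgeVector n) (r : Fin n) →
               Hierarchy x r → Dist (EdgeSet (split x))
  maxEntropy x r h = do
    T ← treeEdges x tree
    e ← uniform (δ (split x) ⁅ r ⁆ ∩ δ (split x) (Split.A top))
    g ← uniform (δ (split x) ⁅ r ⁆ ∩ δ (split x) (Split.B top))
    return (⁅ e ⁆ ∪ (⁅ g ⁆ ∪ T))
    where open Hierarchy h

  record IsMinCostPerfectMatching {n} (c : EdgeVector n) (O : Subset n)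
      (M : EdgeSet (complete n)) : Set ℓ₂ where
    field
      isPerfectMatching : IsPerfectMatchingOn (complete n) O M
      minimal           : ∀ M′ → IsPerfectMatchingOn (complete n) O M′ →
                          total (complete n) c M ≤ total (complete n) c M′

{-# OPTIONS --safe #-}

-- Instead of analysing a minimum matching, one constructs a random even set H of
-- edges of the split graph such that, for the sampled 1-tree T, every edge lies in
-- the join T ⊕ H with probability 3/14.  The set H is drawn down the hierarchy, with
-- the following invariant for its restriction to the four edges of δ(S): up to
-- complementation it is constant with probability 1/7, and each of the three
-- pairings of the four edges occurs with probability 2/7.  Let {a , b} be the edges
-- between the children of S, and e the one in T.  If H is balanced on the two
-- edges of δ(S) at each child, then H ∩ {a , b} is ∅ or {a , b}, chosen to differ
-- from the outer edges when these are constant and uniformly otherwise; if it is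
-- unbalanced, then H ∩ {a , b} = {e}, so that the join avoids both.  This reproduces
-- the invariant at the children.  The cost is at most (1/2 + 3/14) · 2 c(x).
--
-- Only averages over H matter: it is enough that for each pattern on δ(S) the cost
-- inside S has an upper bound, and that these bounds, weighted 1, 2, 2, 2, sum to
-- at most 5 times the cost of all edges inside S.

module Submission where

open import Defs
open import Algebra.Bundles using (CommutativeMonoid; CommutativeRing)
import Algebra.Properties.CommutativeMonoid.Sum as Sum
import Algebra.Properties.Semiring.Mult as Mult
import Algebra.Properties.Ring as RingProperties
import Algebra.Solver.CommutativeMonoid as CMSolver
open import Data.Bool.Base using (Bool; true; false; if_then_else_; not; _∧_; _xor_)
import Data.Bool.Properties as Bool
open import Data.Fin.Base as Fin using (Fin; zero; suc)
import Data.Fin.Properties as Fin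
open import Data.Fin.Subset
  using (Subset; _∈_; _∉_; _⊆_; ⊤; ⊥; ⁅_⁆; ∁; _∩_; _∪_; ∣_∣; Nonempty)
open import Data.Fin.Subset.Properties
open import Data.List.Base as List
  using (List; []; _∷_; allFin; cartesianProduct; concatMap; filter; length)
import Data.List.Properties as List
open import Data.List.Membership.Propositional.Properties
  using (∈-allFin; ∈-cartesianProduct⁺; ∈-filter⁺; ∈-lookup)
open import Data.List.Relation.Unary.All as All using (All; []; _∷_)
open import Data.List.Relation.Unary.All.Properties using (all-filter; ++⁺; replicate⁺)
open import Data.List.Relation.Unary.AllPairs using ([]; _∷_)
open import Data.List.Relation.Unary.Any using (index)
open import Data.List.Relation.Unary.Any.Properties using (lookup-index)
open import Data.List.Relation.Unary.Unique.Propositional using (Unique)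
open import Data.List.Relation.Unary.Unique.Propositional.Properties
  using (allFin⁺; cartesianProduct⁺; filter⁺)
open import Data.Nat.Base as ℕ using (ℕ)
open import Data.Nat.Divisibility using (_∣?_)
import Data.Nat.Properties as ℕ
open import Data.Product.Base using (_×_; _,_; proj₁; proj₂; uncurry; ∃-syntax)
open import Data.Sum.Base using (_⊎_; inj₁; inj₂)
open import Data.Vec.Base as Vec using (Vec; []; _∷_; here; there)
import Data.Vec.Properties as Vec
open import Function.Base using (_∘_)
open import Level using (_⊔_)
open import Relation.Binary.Definitions using (tri<; tri≈; tri>)
open import Relation.Binary.Bundles using (Poset)
import Relation.Binary.Reasoning.PartialOrder
open import Relation.Binary.Structures using (IsDecTotalOrder)
open import Relation.Binary.PropositionalEquality
  using (_≡_; _≢_; refl; sym; trans; cong; cong₂; subst; module ≡-Reasoning)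
open import Relation.Nullary.Decidable.Core using (yes; no; does)
open import Relation.Nullary.Negation.Core using (contradiction)

-- Symmetric differences and counting

-- The weights are the fixed point of the rule. Let l be the probability of a constant pattern and m
-- that of each pairing. A child sees a constant pattern only if its parent sees the pairing that
-- separates the outer edges of the two children, and the uniform choice then agrees with the outer
-- edges of this child; so l = m/2, and l + 3m = 1 gives 1/7 and 2/7. The balanced cases have
-- probability l + m = 3/7, and in them the join contains exactly one of a and b, either one with
-- probability 1/2: hence 3/14. In the unbalanced cases the uniform e divides the mass evenly
-- between the two pairings in which the outer edges of the child differ.
--
-- The obstacle is that H has to be correlated with T, or the join could not avoid both a and b. The
-- recursion survives because what a child sees depends only on draws made outside it, and the tree
-- inside the child is independent of those. Hence no joint distribution is formed: all that happens
-- outside S is frozen into an edge set `η` and a constant `k`, and a bound is proved for every even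
-- pattern of `η` on δ(S).

infixr 6 _⊕_
_⊕_ : ∀ {n} → Subset n → Subset n → Subset n
_⊕_ = Vec.zipWith _xor_

module _ {n : ℕ} where

  ⊕-assoc : ∀ (p q r : Subset n) → (p ⊕ q) ⊕ r ≡ p ⊕ (q ⊕ r)
  ⊕-assoc = Vec.zipWith-assoc Bool.xor-assoc

  ⊕-comm : ∀ (p q : Subset n) → p ⊕ q ≡ q ⊕ p
  ⊕-comm = Vec.zipWith-comm Bool.xor-comm

  ⊕-identityˡ : ∀ (p : Subset n) → ⊥ ⊕ p ≡ p
  ⊕-identityˡ = Vec.zipWith-identityˡ Bool.xor-identityˡ

  ⊕-identityʳ : ∀ (p : Subset n) → p ⊕ ⊥ ≡ p
  ⊕-identityʳ = Vec.zipWith-identityʳ Bool.xor-identityʳ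

⊕-self : ∀ {n} (p : Subset n) → p ⊕ p ≡ ⊥
⊕-self []      = refl
⊕-self (b ∷ p) = cong₂ _∷_ (Bool.xor-same b) (⊕-self p)

⊕-cancelˡ : ∀ {n} (p q : Subset n) → p ⊕ (p ⊕ q) ≡ q
⊕-cancelˡ p q = trans (sym (⊕-assoc p p q))
  (trans (cong (_⊕ q) (⊕-self p)) (⊕-identityˡ q))

∩-distribʳ-⊕ : ∀ {n} (r p q : Subset n) → (p ⊕ q) ∩ r ≡ (p ∩ r) ⊕ (q ∩ r)
∩-distribʳ-⊕ = Vec.zipWith-distribʳ Bool.∧-distribʳ-xor

⊕-commutativeMonoid : ℕ → CommutativeMonoid _ _
⊕-commutativeMonoid n = record
  { Carrier = Subset n
  ; isCommutativeMonoid = record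
    { isMonoid = record
      { isSemigroup = record
        { isMagma = record
          { isEquivalence = Relation.Binary.PropositionalEquality.isEquivalence
          ; ∙-cong = cong₂ _⊕_ }
        ; assoc = ⊕-assoc }
      ; identity = ⊕-identityˡ , ⊕-identityʳ }
    ; comm = ⊕-comm }
  }

lookup-⊕ : ∀ {n} (p q : Subset n) i →
           Vec.lookup (p ⊕ q) i ≡ Vec.lookup p i xor Vec.lookup q i
lookup-⊕ p q i = Vec.lookup-zipWith _xor_ i p q

lookup-∩ : ∀ {n} (p q : Subset n) i →
           Vec.lookup (p ∩ q) i ≡ Vec.lookup p i ∧ Vec.lookup q i
lookup-∩ p q i = Vec.lookup-zipWith _∧_ i p q

lookup-⊥ : ∀ {n} (i : Fin n) → Vec.lookup ⊥ i ≡ false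
lookup-⊥ i = Vec.lookup-replicate i false

subset-ext : ∀ {n} {p q : Subset n} →
             (∀ i → Vec.lookup p i ≡ Vec.lookup q i) → p ≡ q
subset-ext {p = p} {q} eq = trans (sym (Vec.tabulate∘lookup p))
  (trans (Vec.tabulate-cong eq) (Vec.tabulate∘lookup q))

∈⇒lookup : ∀ {n} {i : Fin n} {p} → i ∈ p → Vec.lookup p i ≡ true
∈⇒lookup = Vec.[]=⇒lookup

lookup⇒∈ : ∀ {n} {i : Fin n} p → Vec.lookup p i ≡ true → i ∈ p
lookup⇒∈ {i = i} p = Vec.lookup⇒[]= i p

∉⇒lookup : ∀ {n} {i : Fin n} p → i ∉ p → Vec.lookup p i ≡ false
∉⇒lookup {i = i} p i∉p with Vec.lookup p i in eq
... | true  = contradiction (lookup⇒∈ p eq) i∉p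
... | false = refl

lookup⇒∉ : ∀ {n} {i : Fin n} {p} → Vec.lookup p i ≡ false → i ∉ p
lookup⇒∉ eq i∈p with () ← trans (sym (∈⇒lookup i∈p)) eq

disjoint⇒∪≡⊕ : ∀ {n} (p q : Subset n) → p ∩ q ≡ ⊥ → p ∪ q ≡ p ⊕ q
disjoint⇒∪≡⊕ []          []          _  = refl
disjoint⇒∪≡⊕ (true ∷ _)  (true ∷ _)  ()
disjoint⇒∪≡⊕ (true ∷ p)  (false ∷ q) eq = cong (true ∷_) (disjoint⇒∪≡⊕ p q (Vec.∷-injectiveʳ eq))
disjoint⇒∪≡⊕ (false ∷ p) (b ∷ q)     eq = cong (b ∷_) (disjoint⇒∪≡⊕ p q (Vec.∷-injectiveʳ eq))

disjoint-⊆ : ∀ {n} {p p′ q q′ : Subset n} →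
             p ⊆ p′ → q ⊆ q′ → p′ ∩ q′ ≡ ⊥ → p ∩ q ≡ ⊥
disjoint-⊆ {p = p} {p′} {q} {q′} p⊆p′ q⊆q′ eq = Empty-unique λ (i , i∈) →
  let i∈p , i∈q = x∈p∩q⁻ p q i∈ in
  ∉⊥ (subst (i ∈_) eq (x∈p∩q⁺ (p⊆p′ i∈p , q⊆q′ i∈q)))

⊕-⊆ : ∀ {n} {p q r : Subset n} → p ⊆ r → q ⊆ r → p ⊕ q ⊆ r
⊕-⊆ {p = p} {q} p⊆r q⊆r {i} i∈ with Vec.lookup p i in eq
... | true  = p⊆r (lookup⇒∈ p eq)
... | false = q⊆r (lookup⇒∈ q (trans (cong (_xor Vec.lookup q i) (sym eq))
                (trans (sym (lookup-⊕ p q i)) (∈⇒lookup i∈))))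

∪-⊆ : ∀ {n} {p q r : Subset n} → p ⊆ r → q ⊆ r → p ∪ q ⊆ r
∪-⊆ {p = p} {q} p⊆r q⊆r i∈ with x∈p∪q⁻ p q i∈
... | inj₁ i∈p = p⊆r i∈p
... | inj₂ i∈q = q⊆r i∈q

xor-interchange : ∀ a b c d → (a xor b) xor (c xor d) ≡ (a xor c) xor (b xor d)
xor-interchange = solve 4 (λ a b c d → (a ⊞ b) ⊞ (c ⊞ d) ⊜ (a ⊞ c) ⊞ (b ⊞ d)) refl
  where
  open CMSolver (CommutativeRing.+-commutativeMonoid Bool.xor-∧-commutativeRing)
    using (solve; _⊜_) renaming (_⊕_ to _⊞_)

-- The parity of the cardinality, computed as a sum of bits so that it is additive for `⊕` by
-- recursion; `parity-∣∣` returns to counting.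
odd : ∀ {n} → Subset n → Bool
odd []      = false
odd (b ∷ p) = b xor odd p

odd-⊕ : ∀ {n} (p q : Subset n) → odd (p ⊕ q) ≡ odd p xor odd q
odd-⊕ []      []      = refl
odd-⊕ (a ∷ p) (b ∷ q) = trans (cong ((a xor b) xor_) (odd-⊕ p q))
  (xor-interchange a b (odd p) (odd q))

odd-⊥ : ∀ n → odd (⊥ {n}) ≡ false
odd-⊥ ℕ.zero    = refl
odd-⊥ (ℕ.suc n) = odd-⊥ n

parity : ℕ → Bool
parity ℕ.zero    = false
parity (ℕ.suc k) = not (parity k)

parity-∣∣ : ∀ {n} (p : Subset n) → parity ∣ p ∣ ≡ odd p
parity-∣∣ []          = refl
parity-∣∣ (true ∷ p)  = cong not (parity-∣∣ p)
parity-∣∣ (false ∷ p) = parity-∣∣ p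

2∣?≡not-parity : ∀ k → does (2 ∣? k) ≡ not (parity k)
2∣?≡not-parity 0                   = refl
2∣?≡not-parity 1                   = refl
-- The recursion goes by two because `does (2 ∣? (2 + k))` computes to `does (2 ∣? k)`.
2∣?≡not-parity (ℕ.suc (ℕ.suc k)) =
  trans (2∣?≡not-parity k) (cong not (sym (Bool.not-involutive (parity k))))

-- Inclusion-exclusion, in additive form to avoid truncated subtraction.
∣∣-⊕ : ∀ {n} (p q : Subset n) → ∣ p ⊕ q ∣ ℕ.+ (∣ p ∩ q ∣ ℕ.+ ∣ p ∩ q ∣) ≡ ∣ p ∣ ℕ.+ ∣ q ∣
∣∣-⊕ []          []          = refl
∣∣-⊕ (true ∷ p)  (true ∷ q)  = begin
  ∣ p ⊕ q ∣ ℕ.+ ℕ.suc (∣ p ∩ q ∣ ℕ.+ ℕ.suc ∣ p ∩ q ∣)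
    ≡⟨ cong (λ k → ∣ p ⊕ q ∣ ℕ.+ ℕ.suc k) (ℕ.+-suc ∣ p ∩ q ∣ ∣ p ∩ q ∣) ⟩
  ∣ p ⊕ q ∣ ℕ.+ ℕ.suc (ℕ.suc (∣ p ∩ q ∣ ℕ.+ ∣ p ∩ q ∣))
    ≡⟨ ℕ.+-suc ∣ p ⊕ q ∣ _ ⟩
  ℕ.suc (∣ p ⊕ q ∣ ℕ.+ ℕ.suc (∣ p ∩ q ∣ ℕ.+ ∣ p ∩ q ∣))
    ≡⟨ cong ℕ.suc (ℕ.+-suc ∣ p ⊕ q ∣ _) ⟩
  ℕ.suc (ℕ.suc (∣ p ⊕ q ∣ ℕ.+ (∣ p ∩ q ∣ ℕ.+ ∣ p ∩ q ∣)))
    ≡⟨ cong (ℕ.suc ∘ ℕ.suc) (∣∣-⊕ p q) ⟩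
  ℕ.suc (ℕ.suc (∣ p ∣ ℕ.+ ∣ q ∣))
    ≡⟨ cong ℕ.suc (ℕ.+-suc ∣ p ∣ ∣ q ∣) ⟨
  ℕ.suc (∣ p ∣ ℕ.+ ℕ.suc ∣ q ∣)
    ∎
  where open ≡-Reasoning
∣∣-⊕ (true ∷ p)  (false ∷ q) = cong ℕ.suc (∣∣-⊕ p q)
∣∣-⊕ (false ∷ p) (true ∷ q)  =
  trans (cong ℕ.suc (∣∣-⊕ p q)) (sym (ℕ.+-suc ∣ p ∣ ∣ q ∣))
∣∣-⊕ (false ∷ p) (false ∷ q) = ∣∣-⊕ p q

-- The part of `p ∩ r` off `q` is written through `p ⊕ q`: when `p` and `q` are the cuts of two
-- siblings, this is the cut of their parent, so what is known about the parent's four edges applies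
-- to it.
∣∣-split : ∀ {n} (p q r : Subset n) →
           ∣ p ∩ r ∣ ≡ ∣ (p ⊕ q) ∩ (p ∩ r) ∣ ℕ.+ ∣ (p ∩ q) ∩ r ∣
∣∣-split []          []          []          = refl
∣∣-split (false ∷ p) (true ∷ q)  (_ ∷ r)     = ∣∣-split p q r
∣∣-split (false ∷ p) (false ∷ q) (_ ∷ r)     = ∣∣-split p q r
∣∣-split (true ∷ p)  (true ∷ q)  (false ∷ r) = ∣∣-split p q r
∣∣-split (true ∷ p)  (false ∷ q) (false ∷ r) = ∣∣-split p q r
∣∣-split (true ∷ p)  (false ∷ q) (true ∷ r)  = cong ℕ.suc (∣∣-split p q r)
∣∣-split (true ∷ p)  (true ∷ q)  (true ∷ r)  =
  trans (cong ℕ.suc (∣∣-split p q r)) (sym (ℕ.+-suc _ _))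

elements : ∀ {n} → Subset n → List (Fin n)
elements []          = []
elements (true ∷ p)  = zero ∷ List.map suc (elements p)
elements (false ∷ p) = List.map suc (elements p)

filter-∈?-map-suc : ∀ {n} b (p : Subset n) xs →
  filter (_∈? (b ∷ p)) (List.map suc xs) ≡ List.map suc (filter (_∈? p) xs)
filter-∈?-map-suc b p []       = refl
filter-∈?-map-suc b p (x ∷ xs) with does (x ∈? p)
... | true  = cong (suc x ∷_) (filter-∈?-map-suc b p xs)
... | false = filter-∈?-map-suc b p xs

-- The left side is the support of `uniform p` as defined; the right side computes by recursion on
-- the subset.
filter-∈?≡elements : ∀ {n} (p : Subset n) → filter (_∈? p) (allFin n) ≡ elements p
filter-∈?≡elements []              = refl
filter-∈?≡elements {ℕ.suc n} (b ∷ p) = trans (cong (filter (_∈? (b ∷ p))) allFin-suc) (lemma b)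
  where
  allFin-suc : allFin (ℕ.suc n) ≡ zero ∷ List.map suc (allFin n)
  allFin-suc = cong (zero ∷_) (sym (List.map-tabulate (λ i → i) suc))

  rest : ∀ b → filter (_∈? (b ∷ p)) (List.map suc (allFin n)) ≡ List.map suc (elements p)
  rest b = trans (filter-∈?-map-suc b p (allFin n)) (cong (List.map suc) (filter-∈?≡elements p))

  lemma : ∀ b → filter (_∈? (b ∷ p)) (zero ∷ List.map suc (allFin n)) ≡ elements (b ∷ p)
  lemma true  = cong (zero ∷_) (rest true)
  lemma false = rest false

length-elements : ∀ {n} (p : Subset n) → length (elements p) ≡ ∣ p ∣
length-elements []          = refl
length-elements (true ∷ p)  = cong ℕ.suc (trans (List.length-map suc (elements p)) (length-elements p))
length-elements (false ∷ p) = trans (List.length-map suc (elements p)) (length-elements p)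

⟦_⟧ : Bool → ℕ
⟦ true ⟧  = 1
⟦ false ⟧ = 0

_#_ : ∀ {n} → Subset n → Fin n → ℕ
p # i = ⟦ Vec.lookup p i ⟧

#-elements : ∀ {n} → Subset n → List (Fin n) → ℕ
#-elements p xs = List.foldr (λ i k → (p # i) ℕ.+ k) 0 xs

#-elements-suc : ∀ {n} b (p : Subset n) xs → #-elements (b ∷ p) (List.map suc xs) ≡ #-elements p xs
#-elements-suc b p xs = List.foldr-map _ suc 0 xs

∣∩∣≡#-elements : ∀ {n} (p q : Subset n) → ∣ p ∩ q ∣ ≡ #-elements q (elements p)
∣∩∣≡#-elements []          []      = refl
∣∩∣≡#-elements (false ∷ p) (b ∷ q) =
  trans (∣∩∣≡#-elements p q) (sym (#-elements-suc b q (elements p)))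
∣∩∣≡#-elements (true ∷ p)  (b ∷ q) = begin
  ∣ b ∷ (p ∩ q) ∣                          ≡⟨ ∣∷∣ b (p ∩ q) ⟩
  ⟦ b ⟧ ℕ.+ ∣ p ∩ q ∣                      ≡⟨ cong (⟦ b ⟧ ℕ.+_) (∣∩∣≡#-elements p q) ⟩
  ⟦ b ⟧ ℕ.+ #-elements q (elements p)      ≡⟨ cong (⟦ b ⟧ ℕ.+_) (#-elements-suc b q (elements p)) ⟨
  #-elements (b ∷ q) (elements (true ∷ p)) ∎
  where
  open ≡-Reasoning
  ∣∷∣ : ∀ {n} b (p : Subset n) → ∣ b ∷ p ∣ ≡ ⟦ b ⟧ ℕ.+ ∣ p ∣
  ∣∷∣ true  p = refl
  ∣∷∣ false p = refl

⊕-elements : ∀ {n} → List (Fin n) → Subset n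
⊕-elements = List.foldr (λ i p → ⁅ i ⁆ ⊕ p) ⊥

⊕-elements-suc : ∀ {n} (xs : List (Fin n)) → ⊕-elements (List.map suc xs) ≡ false ∷ ⊕-elements xs
⊕-elements-suc []       = refl
⊕-elements-suc (x ∷ xs) = cong (⁅ suc x ⁆ ⊕_) (⊕-elements-suc xs)

⊕-elements∘elements : ∀ {n} (p : Subset n) → ⊕-elements (elements p) ≡ p
⊕-elements∘elements []          = refl
⊕-elements∘elements (true ∷ p)  = trans (cong (⁅ zero ⁆ ⊕_) (⊕-elements-suc (elements p)))
  (cong (true ∷_) (trans (⊕-identityˡ _) (⊕-elements∘elements p)))
⊕-elements∘elements (false ∷ p) = trans (⊕-elements-suc (elements p))
  (cong (false ∷_) (⊕-elements∘elements p))

-- The list itself is recorded, rather than an equation between sets, because an expectation over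
-- `uniform D` evaluates along this list.
record IsPair {n} (D : Subset n) (a b : Fin n) : Set where
  field
    enumerated : elements D ≡ a ∷ b ∷ []

  count : ∀ X → ∣ D ∩ X ∣ ≡ (X # a) ℕ.+ (X # b)
  count X = trans (∣∩∣≡#-elements D X) (trans (cong (#-elements X) enumerated)
    (cong ((X # a) ℕ.+_) (ℕ.+-identityʳ _)))

  ≡⁅⁆⊕⁅⁆ : D ≡ ⁅ a ⁆ ⊕ ⁅ b ⁆
  ≡⁅⁆⊕⁅⁆ = trans (sym (⊕-elements∘elements D)) (trans (cong ⊕-elements enumerated)
    (cong (⁅ a ⁆ ⊕_) (⊕-identityʳ _)))

pair : ∀ {n} (D : Subset n) → ∣ D ∣ ≡ 2 → ∃[ a ] ∃[ b ] IsPair D a b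
pair D ∣D∣≡2 with elements D in eq | trans (length-elements D) ∣D∣≡2
... | a ∷ b ∷ [] | refl = a , b , record { enumerated = eq }

-- `D` is described by its intersections with all test sets. This is symmetric in the four edges, so
-- reordering them is mere arithmetic, and testing on singletons forces them to be distinct.
record IsQuadruple {n} (D : Subset n) (p q r s : Fin n) : Set where
  constructor quadruple
  field
    count : ∀ X → ∣ D ∩ X ∣ ≡ (X # p) ℕ.+ ((X # q) ℕ.+ ((X # r) ℕ.+ (X # s)))

-- Cuts and partitions in multigraphs

-- The count is tested on `D` itself: four bits sum to 4 only if all are set.
quadruple-member : ∀ {n} {D : Subset n} {p q r s} → IsQuadruple D p q r s → ∣ D ∣ ≡ 4 →
  Vec.lookup D p ≡ true × Vec.lookup D q ≡ true × Vec.lookup D r ≡ true × Vec.lookup D s ≡ true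
quadruple-member {D = D} {p} {q} {r} {s} quad ∣D∣≡4
  with Vec.lookup D p | Vec.lookup D q | Vec.lookup D r | Vec.lookup D s
     | trans (sym (IsQuadruple.count quad D)) (trans (cong ∣_∣ (∩-idem D)) ∣D∣≡4)
... | true  | true  | true  | true  | _ = refl , refl , refl , refl
... | true  | true  | true  | false | ()
... | true  | true  | false | true  | ()
... | true  | true  | false | false | ()
... | true  | false | true  | true  | ()
... | true  | false | true  | false | ()
... | true  | false | false | true  | ()
... | true  | false | false | false | ()
... | false | true  | true  | true  | ()
... | false | true  | true  | false | ()
... | false | true  | false | true  | ()
... | false | true  | false | false | ()
... | false | false | true  | true  | ()
... | false | false | true  | false | ()
... | false | false | false | true  | ()
... | false | false | false | false | ()

pair-member : ∀ {n} {D : Subset n} {a b} → IsPair D a b → Vec.lookup D a ≡ true × Vec.lookup D b ≡ true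
pair-member {D = D} {a} {b} isPair
  with Vec.lookup D a | Vec.lookup D b
     | trans (sym (IsPair.count isPair D)) (trans (cong ∣_∣ (∩-idem D)) ∣D∣≡2)
  where
  ∣D∣≡2 : ∣ D ∣ ≡ 2
  ∣D∣≡2 = trans (sym (length-elements D)) (cong length (IsPair.enumerated isPair))
... | true  | true  | _ = refl , refl
... | true  | false | ()
... | false | true  | ()
... | false | false | ()

pair-≢ : ∀ {n} {D : Subset n} {a b} → IsPair D a b → a ≢ b
pair-≢ {D = D} {a} isPair refl with ∣p∩q∣≤∣q∣ D ⁅ a ⁆
... | ≤1 rewrite IsPair.count isPair ⁅ a ⁆ | ∈⇒lookup (x∈⁅x⁆ a) | ∣⁅x⁆∣≡1 a with ℕ.s≤s () ← ≤1

module _ {n} (P Q : Subset n)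
  (∣P∣≡4 : ∣ P ∣ ≡ 4) (∣Q∣≡4 : ∣ Q ∣ ≡ 4) (∣P⊕Q∣≡4 : ∣ P ⊕ Q ∣ ≡ 4) where

  -- `P` and `Q` stand for the cuts of two siblings and `P ⊕ Q` for that of their parent. The common
  -- edges, the cycle partners, number k with 4 + 2k = 8.
  ∣P∩Q∣≡2 : ∣ P ∩ Q ∣ ≡ 2
  ∣P∩Q∣≡2 = double ∣ P ∩ Q ∣ (ℕ.+-cancelˡ-≡ 4 _ _ (begin
    4 ℕ.+ (∣ P ∩ Q ∣ ℕ.+ ∣ P ∩ Q ∣)         ≡⟨ cong (ℕ._+ (∣ P ∩ Q ∣ ℕ.+ ∣ P ∩ Q ∣)) ∣P⊕Q∣≡4 ⟨
    ∣ P ⊕ Q ∣ ℕ.+ (∣ P ∩ Q ∣ ℕ.+ ∣ P ∩ Q ∣) ≡⟨ ∣∣-⊕ P Q ⟩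
    ∣ P ∣ ℕ.+ ∣ Q ∣                         ≡⟨ cong₂ ℕ._+_ ∣P∣≡4 ∣Q∣≡4 ⟩
    8                                       ∎))
    where
    open ≡-Reasoning
    double : ∀ k → k ℕ.+ k ≡ 4 → k ≡ 2
    double 0 ()
    double 1 ()
    double 2 _ = refl
    double (ℕ.suc (ℕ.suc (ℕ.suc k))) eq
      with () ← trans (sym (ℕ.+-comm k _)) (ℕ.suc-injective (ℕ.suc-injective (ℕ.suc-injective eq)))

  ∣[P⊕Q]∩P∣≡2 : ∣ (P ⊕ Q) ∩ P ∣ ≡ 2
  ∣[P⊕Q]∩P∣≡2 = ℕ.+-cancelʳ-≡ 2 _ _ (begin
    ∣ (P ⊕ Q) ∩ P ∣ ℕ.+ 2
      ≡⟨ cong₂ (λ p k → ∣ (P ⊕ Q) ∩ p ∣ ℕ.+ k) (∩-idem P) ∣P∩Q∣≡2 ⟨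
    ∣ (P ⊕ Q) ∩ (P ∩ P) ∣ ℕ.+ ∣ P ∩ Q ∣
      ≡⟨ cong (λ p → ∣ (P ⊕ Q) ∩ (P ∩ P) ∣ ℕ.+ ∣ p ∣) P∩Q∩P ⟨
    ∣ (P ⊕ Q) ∩ (P ∩ P) ∣ ℕ.+ ∣ (P ∩ Q) ∩ P ∣
      ≡⟨ ∣∣-split P Q P ⟨
    ∣ P ∩ P ∣
      ≡⟨ cong ∣_∣ (∩-idem P) ⟩
    ∣ P ∣
      ≡⟨ ∣P∣≡4 ⟩
    4 ∎)
    where
    open ≡-Reasoning
    P∩Q∩P : (P ∩ Q) ∩ P ≡ P ∩ Q
    P∩Q∩P = trans (∩-comm _ P) (trans (sym (∩-assoc P P Q)) (cong (_∩ Q) (∩-idem P)))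

  module _ {p q r s a b : Fin n} (quad : IsQuadruple (P ⊕ Q) p q r s) (isPair : IsPair (P ∩ Q) a b) where

    -- Splitting `P` along `Q` separates the two outer edges of a child, which belong to the
    -- parent's cut, from the two edges to its sibling.
    P-quadruple : Vec.lookup P p ≡ true → Vec.lookup P q ≡ true →
                  Vec.lookup P r ≡ false → Vec.lookup P s ≡ false → IsQuadruple P p q a b
    P-quadruple Pp Pq Pr Ps = quadruple count
      where
      count : ∀ X → ∣ P ∩ X ∣ ≡ (X # p) ℕ.+ ((X # q) ℕ.+ ((X # a) ℕ.+ (X # b)))
      count X
        rewrite ∣∣-split P Q X | IsQuadruple.count quad (P ∩ X) | IsPair.count isPair X
              | lookup-∩ P X p | lookup-∩ P X q | lookup-∩ P X r | lookup-∩ P X s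
              | Pp | Pq | Pr | Ps
              | ℕ.+-identityʳ (X # q) = ℕ.+-assoc (X # p) _ _

module _ {n : ℕ} (G : Multigraph n) where

  start finish : Edge G → Fin n
  start e  = proj₁ (ends G e)
  finish e = proj₂ (ends G e)

  inner : Subset n → EdgeSet G
  inner S = Vec.tabulate λ e → Vec.lookup S (start e) ∧ Vec.lookup S (finish e)

  lookup-δ : ∀ S e → Vec.lookup (δ G S) e ≡ Vec.lookup S (start e) xor Vec.lookup S (finish e)
  lookup-δ S e = Vec.lookup∘tabulate _ e

  lookup-inner : ∀ S e → Vec.lookup (inner S) e ≡ Vec.lookup S (start e) ∧ Vec.lookup S (finish e)
  lookup-inner S e = Vec.lookup∘tabulate _ e

  odd-degree : EdgeSet G → Fin n → Bool
  odd-degree X v = odd (X ∩ δ G ⁅ v ⁆)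

  odd-degree-⊕ : ∀ X Y v → odd-degree (X ⊕ Y) v ≡ odd-degree X v xor odd-degree Y v
  odd-degree-⊕ X Y v = trans (cong odd (∩-distribʳ-⊕ (δ G ⁅ v ⁆) X Y)) (odd-⊕ (X ∩ δ G ⁅ v ⁆) (Y ∩ δ G ⁅ v ⁆))

  lookup-oddVertices : ∀ X v → Vec.lookup (oddVertices G X) v ≡ odd-degree X v
  lookup-oddVertices X v = trans (Vec.lookup∘tabulate _ v)
    (trans (cong not (2∣?≡not-parity (degree G X v)))
    (trans (Bool.not-involutive _) (parity-∣∣ (X ∩ δ G ⁅ v ⁆))))

  δ-∁ : ∀ S → δ G (∁ S) ≡ δ G S
  δ-∁ S = subset-ext λ e → begin
    Vec.lookup (δ G (∁ S)) e
      ≡⟨ lookup-δ (∁ S) e ⟩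
    Vec.lookup (∁ S) (start e) xor Vec.lookup (∁ S) (finish e)
      ≡⟨ cong₂ _xor_ (Vec.lookup-map (start e) not S) (Vec.lookup-map (finish e) not S) ⟩
    not (Vec.lookup S (start e)) xor not (Vec.lookup S (finish e))
      ≡⟨ not-xor-not (Vec.lookup S (start e)) _ ⟩
    Vec.lookup S (start e) xor Vec.lookup S (finish e)
      ≡⟨ lookup-δ S e ⟨
    Vec.lookup (δ G S) e ∎
    where
    open ≡-Reasoning
    not-xor-not : ∀ a b → not a xor not b ≡ a xor b
    not-xor-not true  _ = refl
    not-xor-not false b = Bool.not-involutive b

  inner-δ-disjoint : ∀ S → inner S ∩ δ G S ≡ ⊥
  inner-δ-disjoint S = subset-ext λ e → begin
    Vec.lookup (inner S ∩ δ G S) e                 ≡⟨ lookup-∩ (inner S) (δ G S) e ⟩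
    Vec.lookup (inner S) e ∧ Vec.lookup (δ G S) e  ≡⟨ cong₂ _∧_ (lookup-inner S e) (lookup-δ S e) ⟩
    (Vec.lookup S (start e) ∧ Vec.lookup S (finish e)) ∧ (Vec.lookup S (start e) xor Vec.lookup S (finish e))
      ≡⟨ lemma (Vec.lookup S (start e)) (Vec.lookup S (finish e)) ⟩
    false                                          ≡⟨ lookup-⊥ e ⟨
    Vec.lookup ⊥ e                                 ∎
    where
    open ≡-Reasoning
    lemma : ∀ a b → (a ∧ b) ∧ (a xor b) ≡ false
    lemma true  true  = refl
    lemma true  false = refl
    lemma false _     = refl

  inner-avoids : ∀ {S X v} → X ⊆ inner S → v ∉ S → X ∩ δ G ⁅ v ⁆ ≡ ⊥
  inner-avoids {S} {X} {v} X⊆ v∉S = Empty-unique λ (e , e∈) →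
    let e∈X , e∈δ = x∈p∩q⁻ X _ e∈
        inS  = trans (sym (lookup-inner S e)) (∈⇒lookup (X⊆ e∈X))
        odd1 = trans (sym (lookup-δ ⁅ v ⁆ e)) (∈⇒lookup e∈δ)
    in impossible e inS odd1
    where
    misses : ∀ {w} → Vec.lookup S w ≡ true → Vec.lookup ⁅ v ⁆ w ≡ false
    misses {w} w∈S = ∉⇒lookup ⁅ v ⁆ λ w∈ →
      v∉S (subst (_∈ S) (x∈⁅y⁆⇒x≡y v w∈) (lookup⇒∈ S w∈S))

    impossible : ∀ e → Vec.lookup S (start e) ∧ Vec.lookup S (finish e) ≡ true →
                 Vec.lookup ⁅ v ⁆ (start e) xor Vec.lookup ⁅ v ⁆ (finish e) ≡ true → _
    impossible e inS odd1
      with Vec.lookup S (start e) in s | Vec.lookup S (finish e) in f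
    ... | true | true rewrite misses s | misses f with () ← odd1

  odd-degree-inner : ∀ {S X v} → X ⊆ inner S → v ∉ S → odd-degree X v ≡ false
  odd-degree-inner X⊆ v∉S = trans (cong odd (inner-avoids X⊆ v∉S)) (odd-⊥ (length G))

  module Partition {S A B : Subset n} (part : S PartitionsInto A and B) where
    open _PartitionsInto_and_ part

    S≡A⊕B : S ≡ A ⊕ B
    S≡A⊕B = trans (sym covering) (disjoint⇒∪≡⊕ A B disjoint)

    A⊆S : A ⊆ S
    A⊆S v∈A = subst (_ ∈_) covering (p⊆p∪q B v∈A)

    B⊆S : B ⊆ S
    B⊆S v∈B = subst (_ ∈_) covering (q⊆p∪q A B v∈B)

    A∌ : ∀ {v} → v ∈ B → v ∉ A
    A∌ v∈B v∈A = ∉⊥ (subst (_ ∈_) disjoint (x∈p∩q⁺ (v∈A , v∈B)))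

    lookup-S : ∀ i → Vec.lookup S i ≡ Vec.lookup A i xor Vec.lookup B i
    lookup-S i = trans (cong (λ Z → Vec.lookup Z i) S≡A⊕B) (lookup-⊕ A B i)

    lookup-disjoint : ∀ i → Vec.lookup A i ∧ Vec.lookup B i ≡ false
    lookup-disjoint i = trans (sym (lookup-∩ A B i))
      (trans (cong (λ Z → Vec.lookup Z i) disjoint) (lookup-⊥ i))

    -- Taking cuts is linear over the field with two elements, and a disjoint union is a sum there.
    δ-partition : δ G S ≡ δ G A ⊕ δ G B
    δ-partition = subset-ext λ e → begin
      Vec.lookup (δ G S) e
        ≡⟨ lookup-δ S e ⟩
      Vec.lookup S (start e) xor Vec.lookup S (finish e)
        ≡⟨ cong₂ _xor_ (lookup-S (start e)) (lookup-S (finish e)) ⟩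
      (Vec.lookup A (start e) xor Vec.lookup B (start e)) xor (Vec.lookup A (finish e) xor Vec.lookup B (finish e))
        ≡⟨ xor-interchange (Vec.lookup A (start e)) _ _ _ ⟩
      (Vec.lookup A (start e) xor Vec.lookup A (finish e)) xor (Vec.lookup B (start e) xor Vec.lookup B (finish e))
        ≡⟨ cong₂ _xor_ (lookup-δ A e) (lookup-δ B e) ⟨
      Vec.lookup (δ G A) e xor Vec.lookup (δ G B) e
        ≡⟨ lookup-⊕ (δ G A) (δ G B) e ⟨
      Vec.lookup (δ G A ⊕ δ G B) e ∎
      where open ≡-Reasoning

    inner-partition : inner S ≡ (δ G A ∩ δ G B) ⊕ (inner A ⊕ inner B)
    inner-partition = subset-ext λ e → begin
      Vec.lookup (inner S) e
        ≡⟨ lookup-inner S e ⟩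
      Vec.lookup S (start e) ∧ Vec.lookup S (finish e)
        ≡⟨ cong₂ _∧_ (lookup-S (start e)) (lookup-S (finish e)) ⟩
      (Vec.lookup A (start e) xor Vec.lookup B (start e)) ∧ (Vec.lookup A (finish e) xor Vec.lookup B (finish e))
        ≡⟨ lemma (Vec.lookup A (start e)) _ _ _ (lookup-disjoint (start e)) (lookup-disjoint (finish e)) ⟩
      ((Vec.lookup A (start e) xor Vec.lookup A (finish e)) ∧ (Vec.lookup B (start e) xor Vec.lookup B (finish e)))
        xor ((Vec.lookup A (start e) ∧ Vec.lookup A (finish e)) xor (Vec.lookup B (start e) ∧ Vec.lookup B (finish e)))
        ≡⟨ cong₂ _xor_ (cong₂ _∧_ (lookup-δ A e) (lookup-δ B e)) (cong₂ _xor_ (lookup-inner A e) (lookup-inner B e)) ⟨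
      (Vec.lookup (δ G A) e ∧ Vec.lookup (δ G B) e) xor (Vec.lookup (inner A) e xor Vec.lookup (inner B) e)
        ≡⟨ cong₂ _xor_ (lookup-∩ (δ G A) (δ G B) e) (lookup-⊕ (inner A) (inner B) e) ⟨
      Vec.lookup (δ G A ∩ δ G B) e xor Vec.lookup (inner A ⊕ inner B) e
        ≡⟨ lookup-⊕ (δ G A ∩ δ G B) (inner A ⊕ inner B) e ⟨
      Vec.lookup ((δ G A ∩ δ G B) ⊕ (inner A ⊕ inner B)) e ∎
      where
      open ≡-Reasoning
      lemma : ∀ a b a′ b′ → a ∧ b ≡ false → a′ ∧ b′ ≡ false →
              (a xor b) ∧ (a′ xor b′) ≡ ((a xor a′) ∧ (b xor b′)) xor ((a ∧ a′) xor (b ∧ b′))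
      lemma true  false true  false _ _ = refl
      lemma true  false false true  _ _ = refl
      lemma true  false false false _ _ = refl
      lemma false true  true  false _ _ = refl
      lemma false true  false true  _ _ = refl
      lemma false true  false false _ _ = refl
      lemma false false true  false _ _ = refl
      lemma false false false true  _ _ = refl
      lemma false false false false _ _ = refl

    inner-A∩inner-B : inner A ∩ inner B ≡ ⊥
    inner-A∩inner-B = subset-ext λ e → begin
      Vec.lookup (inner A ∩ inner B) e ≡⟨ lookup-∩ (inner A) (inner B) e ⟩
      Vec.lookup (inner A) e ∧ Vec.lookup (inner B) e ≡⟨ cong₂ _∧_ (lookup-inner A e) (lookup-inner B e) ⟩
      (Vec.lookup A (start e) ∧ Vec.lookup A (finish e)) ∧ (Vec.lookup B (start e) ∧ Vec.lookup B (finish e))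
        ≡⟨ lemma (Vec.lookup A (start e)) _ _ _ (lookup-disjoint (start e)) ⟩
      false ≡⟨ lookup-⊥ e ⟨
      Vec.lookup ⊥ e ∎
      where
      open ≡-Reasoning
      lemma : ∀ a a′ b b′ → a ∧ b ≡ false → (a ∧ a′) ∧ (b ∧ b′) ≡ false
      lemma false _     _     _ _ = refl
      lemma true  false _     _ _ = refl
      lemma true  true  false _ _ = refl

    crossing-avoids-inners : (δ G A ∩ δ G B) ∩ (inner A ⊕ inner B) ≡ ⊥
    crossing-avoids-inners = subset-ext λ e → begin
      Vec.lookup ((δ G A ∩ δ G B) ∩ (inner A ⊕ inner B)) e
        ≡⟨ lookup-∩ (δ G A ∩ δ G B) (inner A ⊕ inner B) e ⟩
      Vec.lookup (δ G A ∩ δ G B) e ∧ Vec.lookup (inner A ⊕ inner B) e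
        ≡⟨ cong₂ _∧_ (lookup-∩ (δ G A) (δ G B) e) (lookup-⊕ (inner A) (inner B) e) ⟩
      (Vec.lookup (δ G A) e ∧ Vec.lookup (δ G B) e) ∧ (Vec.lookup (inner A) e xor Vec.lookup (inner B) e)
        ≡⟨ lemma (Vec.lookup (δ G A) e) _ _ _ (disj A e) (disj B e) ⟩
      false ≡⟨ lookup-⊥ e ⟨
      Vec.lookup ⊥ e ∎
      where
      open ≡-Reasoning
      disj : ∀ Z e → Vec.lookup (inner Z) e ∧ Vec.lookup (δ G Z) e ≡ false
      disj Z e = trans (sym (lookup-∩ (inner Z) (δ G Z) e))
        (trans (cong (λ Y → Vec.lookup Y e) (inner-δ-disjoint Z)) (lookup-⊥ e))
      lemma : ∀ a b i j → i ∧ a ≡ false → j ∧ b ≡ false → (a ∧ b) ∧ (i xor j) ≡ false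
      lemma false _     _     _     _ _ = refl
      lemma true  false _     _     _ _ = refl
      lemma true  true  false false _ _ = refl

    crossing⊆inner : δ G A ∩ δ G B ⊆ inner S
    crossing⊆inner e∈ = subst (_ ∈_) (sym (trans inner-partition
      (sym (disjoint⇒∪≡⊕ _ (inner A ⊕ inner B) crossing-avoids-inners)))) (p⊆p∪q _ e∈)

    inner-A⊆ : inner A ⊆ inner S
    inner-A⊆ e∈ = subst (_ ∈_) (sym eq) (q⊆p∪q (δ G A ∩ δ G B) _ (p⊆p∪q (inner B) e∈))
      where
      eq : inner S ≡ (δ G A ∩ δ G B) ∪ (inner A ∪ inner B)
      eq = trans inner-partition (trans
        (sym (disjoint⇒∪≡⊕ _ (inner A ⊕ inner B) crossing-avoids-inners))
        (cong ((δ G A ∩ δ G B) ∪_) (sym (disjoint⇒∪≡⊕ (inner A) (inner B) inner-A∩inner-B))))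

  partition-sym : ∀ {S A B : Subset n} → S PartitionsInto A and B → S PartitionsInto B and A
  partition-sym {S} {A} {B} part = record
    { nonemptyˡ = nonemptyʳ
    ; nonemptyʳ = nonemptyˡ
    ; disjoint  = trans (∩-comm B A) disjoint
    ; covering  = trans (∪-comm B A) covering
    }
    where open _PartitionsInto_and_ part

-- Ordered fields

module OrderedFieldProperties {a ℓ₁ ℓ₂} (K : OrderedField a ℓ₁ ℓ₂) where

  open OrderedField K
  open CommutativeRing commutativeRing public
    using ( +-cong; +-congˡ; +-congʳ; +-assoc; +-comm; +-identityˡ; +-identityʳ; -‿inverseˡ; -‿inverseʳ
          ; *-congˡ; *-congʳ; *-assoc; *-comm; *-identityˡ; *-identityʳ; distribˡ; distribʳ
          ; zeroˡ; zeroʳ; ring)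
    renaming (refl to ≈-refl; reflexive to ≈-reflexive; sym to ≈-sym; trans to ≈-trans)
  open IsDecTotalOrder isDecTotalOrder public
    using (≤-respʳ-≈; ≤-respˡ-≈)
    renaming (total to ≤-total; refl to ≤-refl; trans to ≤-trans; antisym to ≤-antisym; reflexive to ≤-reflexive)
  open RingProperties ring using (-‿distribʳ-*; -‿involutive)
  open Mult semiring public using () renaming (_×_ to _·_; ×-congʳ to ·-congʳ)
  open CMSolver +-commutativeMonoid public
    using (solve; _⊜_; id) renaming (_⊕_ to _⊞_)

  poset : Poset a ℓ₁ ℓ₂
  poset = record { isPartialOrder = IsDecTotalOrder.isPartialOrder isDecTotalOrder }

  module ≤-Reasoning = Relation.Binary.Reasoning.PartialOrder poset

  +-mono-≤ : ∀ {w y v z} → w ≤ y → v ≤ z → w + v ≤ y + z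
  +-mono-≤ {w} {y} {v} {z} w≤y v≤z = ≤-trans (+-monoʳ-≤ w v≤z)
    (≤-respˡ-≈ (+-comm z w) (≤-respʳ-≈ (+-comm z y) (+-monoʳ-≤ z w≤y)))

  +-cancelˡ-≤ : ∀ y {z w} → y + z ≤ y + w → z ≤ w
  +-cancelˡ-≤ y {z} {w} le = ≤-respˡ-≈ (cancel z) (≤-respʳ-≈ (cancel w) (+-monoʳ-≤ (- y) le))
    where
    cancel : ∀ z → - y + (y + z) ≈ z
    cancel z = ≈-trans (≈-sym (+-assoc (- y) y z))
      (≈-trans (+-congʳ (-‿inverseˡ y)) (+-identityˡ z))

  +-nonNeg : ∀ {y z} → 0# ≤ y → 0# ≤ z → 0# ≤ y + z
  +-nonNeg 0≤y 0≤z = ≤-respˡ-≈ (+-identityˡ 0#) (+-mono-≤ 0≤y 0≤z)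

  y≤y+z : ∀ y {z} → 0# ≤ z → y ≤ y + z
  y≤y+z y 0≤z = ≤-respˡ-≈ (+-identityʳ y) (+-monoʳ-≤ y 0≤z)

  neg-nonNeg : ∀ {y} → y ≤ 0# → 0# ≤ - y
  neg-nonNeg {y} y≤0 = ≤-respˡ-≈ (-‿inverseˡ y) (≤-respʳ-≈ (+-identityʳ (- y)) (+-monoʳ-≤ (- y) y≤0))

  neg-nonNeg⁻ : ∀ {y} → 0# ≤ - y → y ≤ 0#
  neg-nonNeg⁻ {y} 0≤-y = ≤-respˡ-≈ (+-identityʳ y) (≤-respʳ-≈ (-‿inverseʳ y) (+-monoʳ-≤ y 0≤-y))

  0≤1 : 0# ≤ 1#
  0≤1 with ≤-total 0# 1#
  ... | inj₁ 0≤1 = 0≤1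
  ... | inj₂ 1≤0 = ≤-respʳ-≈
    (≈-trans (≈-sym (-‿distribʳ-* (- 1#) 1#))
      (≈-trans (-‿cong (*-identityʳ (- 1#))) (-‿involutive 1#)))
    (*-nonNeg (neg-nonNeg 1≤0) (neg-nonNeg 1≤0))
    where open CommutativeRing commutativeRing using (-‿cong)

  fromℕ-nonNeg : ∀ k → 0# ≤ fromℕ k
  fromℕ-nonNeg ℕ.zero    = ≤-refl
  fromℕ-nonNeg (ℕ.suc k) = +-nonNeg 0≤1 (fromℕ-nonNeg k)

  fromℕ-suc≉0 : ∀ k → fromℕ (ℕ.suc k) ≉ 0#
  fromℕ-suc≉0 k eq = 0≉1 (≤-antisym 0≤1 (≤-respʳ-≈ eq (y≤y+z 1# (fromℕ-nonNeg k))))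

  -- The field has characteristic zero because it is ordered. This turns the LP value of a tight cut
  -- into a number of edges.
  fromℕ-injective : ∀ {j k} → fromℕ j ≈ fromℕ k → j ≡ k
  fromℕ-injective {ℕ.zero}  {ℕ.zero}  _  = refl
  fromℕ-injective {ℕ.zero}  {ℕ.suc k} eq = contradiction (≈-sym eq) (fromℕ-suc≉0 k)
  fromℕ-injective {ℕ.suc j} {ℕ.zero}  eq = contradiction eq (fromℕ-suc≉0 j)
  fromℕ-injective {ℕ.suc j} {ℕ.suc k} eq = cong ℕ.suc (fromℕ-injective
    (≤-antisym (+-cancelˡ-≤ 1# (≤-reflexive eq)) (+-cancelˡ-≤ 1# (≤-reflexive (≈-sym eq)))))

  fromℕ-* : ∀ k y → fromℕ k * y ≈ k · y
  fromℕ-* ℕ.zero    y = zeroˡ y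
  fromℕ-* (ℕ.suc k) y = ≈-trans (distribʳ y 1# (fromℕ k)) (+-cong (*-identityˡ y) (fromℕ-* k y))

  ⁻¹-nonNeg : ∀ k → 0# ≤ fromℕ (ℕ.suc k) ⁻¹
  ⁻¹-nonNeg k with ≤-total 0# (fromℕ (ℕ.suc k) ⁻¹)
  ... | inj₁ 0≤ = 0≤
  ... | inj₂ ≤0 = contradiction (≤-antisym 0≤1 1≤0) 0≉1
    where
    1≤0 : 1# ≤ 0#
    1≤0 = neg-nonNeg⁻ (≤-respʳ-≈
      (≈-trans (≈-sym (-‿distribʳ-* _ _)) (-‿cong (*-inverseʳ _ (fromℕ-suc≉0 k))))
      (*-nonNeg (fromℕ-nonNeg (ℕ.suc k)) (neg-nonNeg ≤0)))
      where open CommutativeRing commutativeRing using (-‿cong)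

  *-monoʳ-≤ : ∀ {w y z} → 0# ≤ w → y ≤ z → w * y ≤ w * z
  *-monoʳ-≤ {w} {y} {z} 0≤w y≤z = ≤-respʳ-≈ eq (y≤y+z (w * y) (*-nonNeg 0≤w 0≤z-y))
    where
    0≤z-y : 0# ≤ - y + z
    0≤z-y = ≤-respˡ-≈ (-‿inverseˡ y) (+-monoʳ-≤ (- y) y≤z)
    eq : w * y + w * (- y + z) ≈ w * z
    eq = ≈-trans (≈-sym (distribˡ w y (- y + z))) (*-congˡ
      (≈-trans (≈-sym (+-assoc y (- y) z)) (≈-trans (+-congʳ (-‿inverseʳ y)) (+-identityˡ z))))

  ⁻¹-*-cancel : ∀ k y → fromℕ (ℕ.suc k) ⁻¹ * (ℕ.suc k · y) ≈ y
  ⁻¹-*-cancel k y = ≈-trans (*-congˡ (≈-sym (fromℕ-* (ℕ.suc k) y)))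
    (≈-trans (≈-sym (*-assoc _ _ y)) (≈-trans
      (*-congʳ (≈-trans (*-comm _ _) (*-inverseʳ _ (fromℕ-suc≉0 k)))) (*-identityˡ y)))

  ½*-double : ∀ y → ½ * (y + y) ≈ y
  ½*-double y = ≈-trans (*-congˡ (+-congˡ (≈-sym (+-identityʳ y)))) (⁻¹-*-cancel 1 y)

  ½*-+-½* : ∀ y → ½ * y + ½ * y ≈ y
  ½*-+-½* y = ≈-trans (≈-sym (distribˡ ½ y y)) (½*-double y)

  ½*-mono : ∀ {y z} → y ≤ z → ½ * y ≤ ½ * z
  ½*-mono = *-monoʳ-≤ (⁻¹-nonNeg 1)

  half-nonNeg : ∀ {y} → 0# ≤ y + y → 0# ≤ y
  half-nonNeg {y} 0≤ = ≤-respˡ-≈ (zeroʳ ½) (≤-respʳ-≈ (½*-double y) (½*-mono 0≤))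

  divide-≤ : ∀ k {y z} → ℕ.suc k · y ≤ z → y ≤ fromℕ (ℕ.suc k) ⁻¹ * z
  divide-≤ k {y} le = ≤-respˡ-≈ (⁻¹-*-cancel k y) (*-monoʳ-≤ (⁻¹-nonNeg k) le)

-- Costs of edge sets and finite expectations

module TotalProperties {a ℓ₁ ℓ₂} (K : OrderedField a ℓ₁ ℓ₂) where

  open OrderedField K
  open OrderedFieldProperties K
  open TSP K
  open Sum +-commutativeMonoid using (sum; sum-cong-≋; ∑-distrib-+; sum-replicate-zero)

  if-cong : ∀ {b b′} {y : Carrier} → b ≡ b′ → (if b then y else 0#) ≈ (if b′ then y else 0#)
  if-cong refl = ≈-refl

  sum-mono-≤ : ∀ {m} {f g : Fin m → Carrier} → (∀ i → f i ≤ g i) → sum f ≤ sum g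
  sum-mono-≤ {ℕ.zero}  f≤g = ≤-refl
  sum-mono-≤ {ℕ.suc m} f≤g = +-mono-≤ (f≤g zero) (sum-mono-≤ (f≤g ∘ suc))

  sum-zero : ∀ {m} {f : Fin m → Carrier} → (∀ i → f i ≈ 0#) → sum f ≈ 0#
  sum-zero {m} f≈0 = ≈-trans (sum-cong-≋ f≈0) (sum-replicate-zero m)

  sum-⊥ : ∀ {m} (f : Fin m → Carrier) → sum (λ i → if Vec.lookup ⊥ i then f i else 0#) ≈ 0#
  sum-⊥ f = sum-zero {f = λ i → if Vec.lookup ⊥ i then f i else 0#} λ i → if-cong (lookup-⊥ i)

  sum-⁅⁆ : ∀ {m} (j : Fin m) (f : Fin m → Carrier) →
           sum (λ i → if Vec.lookup ⁅ j ⁆ i then f i else 0#) ≈ f j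
  sum-⁅⁆ zero    f = ≈-trans (+-congˡ (sum-⊥ (f ∘ suc))) (+-identityʳ (f zero))
  sum-⁅⁆ (suc j) f = ≈-trans (+-identityˡ _) (sum-⁅⁆ j (f ∘ suc))

  module _ {n} (G : Multigraph n) (w : EdgeVector n) where

    total-⊥ : total G w ⊥ ≈ 0#
    total-⊥ = sum-⊥ λ e → uncurry w (ends G e)

    total-⁅⁆ : ∀ e → total G w ⁅ e ⁆ ≈ uncurry w (ends G e)
    total-⁅⁆ e = sum-⁅⁆ e λ e → uncurry w (ends G e)

    total-disjoint : ∀ X Y → X ∩ Y ≡ ⊥ → total G w (X ⊕ Y) ≈ total G w X + total G w Y
    total-disjoint X Y X∩Y≡⊥ = ≈-trans (sum-cong-≋ λ e →
        ≈-trans (if-cong (lookup-⊕ X Y e)) (lemma (Vec.lookup X e) _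
          (trans (sym (lookup-∩ X Y e)) (trans (cong (λ Z → Vec.lookup Z e) X∩Y≡⊥) (lookup-⊥ e)))))
      (∑-distrib-+ (λ e → if Vec.lookup X e then uncurry w (ends G e) else 0#) _)
      where
      lemma : ∀ b b′ {y} → b ∧ b′ ≡ false →
              (if b xor b′ then y else 0#) ≈ (if b then y else 0#) + (if b′ then y else 0#)
      lemma true  false _ = ≈-sym (+-identityʳ _)
      lemma false b′    _ = ≈-sym (+-identityˡ _)

    module _ (w≥0 : ∀ e → 0# ≤ uncurry w (ends G e)) where

      total-nonNeg : ∀ X → 0# ≤ total G w X
      total-nonNeg X = ≤-respˡ-≈ total-⊥ (sum-mono-≤ λ e →
        ≤-respˡ-≈ (≈-sym (if-cong (lookup-⊥ e))) (lemma (Vec.lookup X e) (w≥0 e)))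
        where
        lemma : ∀ b {y} → 0# ≤ y → 0# ≤ (if b then y else 0#)
        lemma true  0≤y = 0≤y
        lemma false _   = ≤-refl

      -- Common edges cancel on the left and count twice on the right, which is harmless for
      -- nonnegative weights.
      total-⊕ : ∀ X Y → total G w (X ⊕ Y) ≤ total G w X + total G w Y
      total-⊕ X Y = ≤-respʳ-≈ (∑-distrib-+ (λ e → if Vec.lookup X e then uncurry w (ends G e) else 0#) _)
        (sum-mono-≤ λ e → ≤-respˡ-≈ (≈-sym (if-cong (lookup-⊕ X Y e)))
          (lemma (Vec.lookup X e) (Vec.lookup Y e) (w≥0 e)))
        where
        lemma : ∀ b b′ {y} → 0# ≤ y →
                (if b xor b′ then y else 0#) ≤ (if b then y else 0#) + (if b′ then y else 0#)
        lemma true  true  0≤y = +-nonNeg 0≤y 0≤y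
        lemma true  false _   = ≤-reflexive (≈-sym (+-identityʳ _))
        lemma false b′    _   = ≤-reflexive (≈-sym (+-identityˡ _))

      total≤⊤ : ∀ X → total G w X ≤ total G w ⊤
      total≤⊤ X = sum-mono-≤ λ e →
        ≤-respʳ-≈ (≈-sym (if-cong (Vec.lookup-replicate e true))) (lemma (Vec.lookup X e) (w≥0 e))
        where
        lemma : ∀ b {y} → 0# ≤ y → (if b then y else 0#) ≤ y
        lemma true  _   = ≤-refl
        lemma false 0≤y = 0≤y

  module _ {b} {X : Set b} where

    𝔼-cong : ∀ (μ : Dist X) {f g} → (∀ y → f y ≈ g y) → 𝔼 μ f ≈ 𝔼 μ g
    𝔼-cong []            _   = ≈-refl
    𝔼-cong ((p , y) ∷ μ) f≈g = +-cong (*-congˡ (f≈g y)) (𝔼-cong μ f≈g)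

    𝔼-return : ∀ (y : X) f → 𝔼 (return y) f ≈ f y
    𝔼-return y f = ≈-trans (+-identityʳ _) (*-identityˡ (f y))

    𝔼-++ : ∀ (μ ν : Dist X) f → 𝔼 (μ List.++ ν) f ≈ 𝔼 μ f + 𝔼 ν f
    𝔼-++ []            ν f = ≈-sym (+-identityˡ _)
    𝔼-++ ((p , y) ∷ μ) ν f = ≈-trans (+-congˡ (𝔼-++ μ ν f)) (≈-sym (+-assoc _ _ _))

    𝔼-scale : ∀ k (μ : Dist X) f → 𝔼 (List.map (λ (q , z) → k * q , z) μ) f ≈ k * 𝔼 μ f
    𝔼-scale k []            f = ≈-sym (zeroʳ k)
    𝔼-scale k ((q , z) ∷ μ) f =
      ≈-trans (+-cong (*-assoc k q (f z)) (𝔼-scale k μ f)) (≈-sym (distribˡ k _ _))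

    𝔼-+ : ∀ (μ : Dist X) f g → 𝔼 μ (λ y → f y + g y) ≈ 𝔼 μ f + 𝔼 μ g
    𝔼-+ []            f g = ≈-sym (+-identityˡ 0#)
    𝔼-+ ((p , y) ∷ μ) f g = ≈-trans (+-cong (distribˡ p (f y) (g y)) (𝔼-+ μ f g))
      (solve 4 (λ a b c d → (a ⊞ b) ⊞ (c ⊞ d) ⊜ (a ⊞ c) ⊞ (b ⊞ d)) ≈-refl _ _ _ _)

    𝔼-* : ∀ k (μ : Dist X) f → 𝔼 μ (λ y → k * f y) ≈ k * 𝔼 μ f
    𝔼-* k []            f = ≈-sym (zeroʳ k)
    𝔼-* k ((p , y) ∷ μ) f = ≈-trans (+-cong
      (≈-trans (≈-sym (*-assoc p k (f y))) (≈-trans (*-congʳ (*-comm p k)) (*-assoc k p (f y))))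
      (𝔼-* k μ f)) (≈-sym (distribˡ k _ _))

  𝔼->>= : ∀ {b d} {X : Set b} {Y : Set d} (μ : Dist X) (f : X → Dist Y) g →
          𝔼 (μ >>= f) g ≈ 𝔼 μ (λ y → 𝔼 (f y) g)
  𝔼->>= []            f g = ≈-refl
  𝔼->>= ((p , y) ∷ μ) f g = ≈-trans (𝔼-++ (List.map _ (f y)) (μ >>= f) g)
    (+-cong (𝔼-scale p (f y) g) (𝔼->>= μ f g))

  𝔼-uniform-pair : ∀ {m} {D : Subset m} {a b} → IsPair D a b → ∀ f →
                   𝔼 (uniform D) f ≈ ½ * (f a + f b)
  𝔼-uniform-pair {D = D} {a} {b} isPair f
    rewrite filter-∈?≡elements D | trans (sym (length-elements D)) (cong length (IsPair.enumerated isPair))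
          | IsPair.enumerated isPair =
    ≈-trans (+-congˡ (+-identityʳ _)) (≈-sym (distribˡ ½ (f a) (f b)))

-- Shortcutting joins to matchings

lookup-injective : ∀ {a} {A : Set a} {xs : List A} → Unique xs →
                   ∀ {i j} → List.lookup xs i ≡ List.lookup xs j → i ≡ j
lookup-injective (_ ∷ _)   {zero}  {zero}  _  = refl
lookup-injective (x∉ ∷ _)  {zero}  {suc j} eq = contradiction eq (All.lookup x∉ (∈-lookup j))
lookup-injective (x∉ ∷ _)  {suc i} {zero}  eq = contradiction (sym eq) (All.lookup x∉ (∈-lookup i))
lookup-injective (_ ∷ uxs) {suc i} {suc j} eq = cong suc (lookup-injective uxs eq)

⊕⁅⁆-disjoint : ∀ {n} {F : Subset n} {e} → e ∈ F → ⁅ e ⁆ ∩ (⁅ e ⁆ ⊕ F) ≡ ⊥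
⊕⁅⁆-disjoint {F = F} {e} e∈F = Empty-unique λ (f , f∈) →
  let f∈⁅e⁆ , f∈⊕ = x∈p∩q⁻ ⁅ e ⁆ (⁅ e ⁆ ⊕ F) f∈ in
  case-≡ (x∈⁅y⁆⇒x≡y e f∈⁅e⁆) f∈⊕
  where
  case-≡ : ∀ {f} → f ≡ e → f ∉ ⁅ e ⁆ ⊕ F
  case-≡ refl f∈⊕ with trans (sym (lookup-⊕ ⁅ e ⁆ F e)) (∈⇒lookup f∈⊕)
  ... | eq rewrite ∈⇒lookup (x∈⁅x⁆ e) | ∈⇒lookup e∈F with () ← eq

∣⁅⁆⊕∣ : ∀ {n} {F : Subset n} {e} → e ∈ F → ∣ F ∣ ≡ ℕ.suc ∣ ⁅ e ⁆ ⊕ F ∣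
∣⁅⁆⊕∣ {n} {F} {e} e∈F = begin
  ∣ F ∣                                                    ≡⟨ cong ∣_∣ (⊕-cancelˡ ⁅ e ⁆ F) ⟨
  ∣ ⁅ e ⁆ ⊕ R ∣                                            ≡⟨ ℕ.+-identityʳ _ ⟨
  ∣ ⁅ e ⁆ ⊕ R ∣ ℕ.+ 0                                      ≡⟨ cong (λ k → ∣ ⁅ e ⁆ ⊕ R ∣ ℕ.+ (k ℕ.+ k)) ∣∩∣≡0 ⟨
  ∣ ⁅ e ⁆ ⊕ R ∣ ℕ.+ (∣ ⁅ e ⁆ ∩ R ∣ ℕ.+ ∣ ⁅ e ⁆ ∩ R ∣)    ≡⟨ ∣∣-⊕ ⁅ e ⁆ R ⟩
  ∣ ⁅ e ⁆ ∣ ℕ.+ ∣ R ∣                                      ≡⟨ cong (ℕ._+ ∣ R ∣) (∣⁅x⁆∣≡1 e) ⟩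
  ℕ.suc ∣ R ∣                                              ∎
  where
  open ≡-Reasoning
  R : Subset _
  R = ⁅ e ⁆ ⊕ F
  ∣∩∣≡0 : ∣ ⁅ e ⁆ ∩ R ∣ ≡ 0
  ∣∩∣≡0 = trans (cong ∣_∣ (⊕⁅⁆-disjoint e∈F)) (∣⊥∣≡0 n)

∣⁅⁆⊕∣≤ : ∀ {n} (F : Subset n) e → ∣ ⁅ e ⁆ ⊕ F ∣ ℕ.≤ ℕ.suc ∣ F ∣
∣⁅⁆⊕∣≤ F e = ℕ.≤-trans (ℕ.m≤m+n _ _)
  (ℕ.≤-reflexive (trans (∣∣-⊕ ⁅ e ⁆ F) (cong (ℕ._+ ∣ F ∣) (∣⁅x⁆∣≡1 e))))

∈-⁅⁆⊕ : ∀ {n} {F : Subset n} {e f} → f ≢ e → f ∈ F → f ∈ ⁅ e ⁆ ⊕ F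
∈-⁅⁆⊕ {F = F} {e} {f} f≢e f∈F = lookup⇒∈ _ (trans (lookup-⊕ ⁅ e ⁆ F f)
  (cong₂ _xor_ (∉⇒lookup ⁅ e ⁆ (x≢y⇒x∉⁅y⁆ f≢e)) (∈⇒lookup f∈F)))

one-member : ∀ {n} (p : Subset n) → 1 ℕ.≤ ∣ p ∣ → ∃[ i ] i ∈ p
one-member (true ∷ p)  _  = zero , here
one-member (false ∷ p) 1≤ = let i , i∈p = one-member p 1≤ in suc i , there i∈p

two-members : ∀ {n} (p : Subset n) → 2 ℕ.≤ ∣ p ∣ → ∃[ i ] ∃[ j ] (j ≢ i) × i ∈ p × j ∈ p
two-members (true ∷ p)  (ℕ.s≤s 1≤) = let j , j∈p = one-member p 1≤ in
  zero , suc j , (λ ()) , here , there j∈p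
two-members (false ∷ p) 2≤ = let i , j , j≢i , i∈p , j∈p = two-members p 2≤ in
  suc i , suc j , (λ eq → j≢i (Fin.suc-injective eq)) , there i∈p , there j∈p

odd-⁅⁆∩ : ∀ {n} (e : Fin n) p → odd (⁅ e ⁆ ∩ p) ≡ Vec.lookup p e
odd-⁅⁆∩ {ℕ.suc n} zero    (b ∷ p) = trans (cong (b xor_) (trans (cong odd (∩-zeroˡ p)) (odd-⊥ n))) (Bool.xor-identityʳ b)
odd-⁅⁆∩ (suc e) (b ∷ p) = odd-⁅⁆∩ e p

odd∧≤1⇒≡1 : ∀ {k} → k ℕ.≤ 1 → parity k ≡ true → k ≡ 1
odd∧≤1⇒≡1 {1} _ _ = refl
odd∧≤1⇒≡1 {ℕ.suc (ℕ.suc _)} (ℕ.s≤s ()) _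

even∧≤1⇒≡0 : ∀ {k} → k ℕ.≤ 1 → parity k ≡ false → k ≡ 0
even∧≤1⇒≡0 {0} _ _ = refl
even∧≤1⇒≡0 {ℕ.suc (ℕ.suc _)} (ℕ.s≤s ()) _

module _ {n : ℕ} (G : Multigraph n) where

  Joins : Edge G → Fin n → Fin n → Set
  Joins e i j = ends G e ≡ (i , j) ⊎ ends G e ≡ (j , i)

  odd-degree-⁅⁆ : ∀ {e i j} → Joins e i j → ∀ v →
                  odd-degree G ⁅ e ⁆ v ≡ Vec.lookup ⁅ v ⁆ i xor Vec.lookup ⁅ v ⁆ j
  odd-degree-⁅⁆ {e} {i} {j} e-joins v = trans (odd-⁅⁆∩ e (δ G ⁅ v ⁆))
    (trans (lookup-δ G ⁅ v ⁆ e) (lemma e-joins))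
    where
    lemma : Joins e i j → Vec.lookup ⁅ v ⁆ (start G e) xor Vec.lookup ⁅ v ⁆ (finish G e) ≡
            Vec.lookup ⁅ v ⁆ i xor Vec.lookup ⁅ v ⁆ j
    lemma (inj₁ eq) = cong (uncurry λ i j → Vec.lookup ⁅ v ⁆ i xor Vec.lookup ⁅ v ⁆ j) eq
    lemma (inj₂ eq) = trans (cong (uncurry λ i j → Vec.lookup ⁅ v ⁆ i xor Vec.lookup ⁅ v ⁆ j) eq)
      (Bool.xor-comm (Vec.lookup ⁅ v ⁆ j) _)

  other-end : ∀ {e v} → e ∈ δ G ⁅ v ⁆ → ∃[ u ] v ≢ u × Joins e v u
  other-end {e} {v} e∈ with Vec.lookup ⁅ v ⁆ (start G e) in s | Vec.lookup ⁅ v ⁆ (finish G e) in f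
                          | trans (sym (lookup-δ G ⁅ v ⁆ e)) (∈⇒lookup e∈)
  ... | true  | false | _ = finish G e
    , (λ { refl → lookup⇒∉ {p = ⁅ v ⁆} f (x∈⁅x⁆ v) })
    , inj₁ (cong (_, finish G e) (x∈⁅y⁆⇒x≡y v (lookup⇒∈ ⁅ v ⁆ s)))
  ... | false | true  | _ = start G e
    , (λ { refl → lookup⇒∉ {p = ⁅ v ⁆} s (x∈⁅x⁆ v) })
    , inj₂ (cong (start G e ,_) (x∈⁅y⁆⇒x≡y v (lookup⇒∈ ⁅ v ⁆ f)))
  ... | true  | true  | ()
  ... | false | false | ()

module _ (n : ℕ) where

  start<finish : ∀ e → start (complete n) e Fin.< finish (complete n) e
  start<finish e = All.lookup (all-filter (uncurry Fin._<?_) (cartesianProduct (allFin n) (allFin n))) (∈-lookup e)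

  complete-unique : Unique (complete n)
  complete-unique = filter⁺ (uncurry Fin._<?_) (cartesianProduct⁺ (allFin⁺ n) (allFin⁺ n))

  joins-unique : ∀ {e f i j} → Joins (complete n) e i j → Joins (complete n) f i j → e ≡ f
  joins-unique (inj₁ p) (inj₁ q) = lookup-injective complete-unique (trans p (sym q))
  joins-unique (inj₂ p) (inj₂ q) = lookup-injective complete-unique (trans p (sym q))
  joins-unique {e} {f} (inj₁ p) (inj₂ q) = contradiction
    (subst (uncurry Fin._<_) q (start<finish f)) (Fin.<-asym (subst (uncurry Fin._<_) p (start<finish e)))
  joins-unique {e} {f} (inj₂ p) (inj₁ q) = contradiction
    (subst (uncurry Fin._<_) q (start<finish f)) (Fin.<-asym (subst (uncurry Fin._<_) p (start<finish e)))

  edge-< : ∀ {i j} → i Fin.< j → ∃[ e ] ends (complete n) e ≡ (i , j)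
  edge-< {i} {j} i<j = index ij∈ , sym (lookup-index ij∈)
    where
    ij∈ = ∈-filter⁺ (uncurry Fin._<?_) (∈-cartesianProduct⁺ (∈-allFin i) (∈-allFin j)) i<j

  edge : ∀ {i j} → i ≢ j → ∃[ e ] Joins (complete n) e i j
  edge {i} {j} i≢j with Fin.<-cmp i j
  ... | tri< i<j _ _ = let e , eq = edge-< i<j in e , inj₁ eq
  ... | tri≈ _ i≡j _ = contradiction i≡j i≢j
  ... | tri> _ _ j<i = let e , eq = edge-< j<i in e , inj₂ eq

module Shortcutting {a ℓ₁ ℓ₂} (K : OrderedField a ℓ₁ ℓ₂) where

  open OrderedField K
  open OrderedFieldProperties K
  open TotalProperties K
  open TSP K

  -- The complete graph is represented by three properties: it has no loops, no parallel edges, and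
  -- an edge between any two distinct vertices.
  module _ {n} (c : EdgeVector n) (isTSP : IsTSPInstance c) (c≥0 : ∀ i j → i ≢ j → 0# ≤ c i j)
    (Kₙ : Multigraph n) (no-loops : ∀ e → start Kₙ e ≢ finish Kₙ e)
    (joins-unique : ∀ {e f i j} → Joins Kₙ e i j → Joins Kₙ f i j → e ≡ f)
    (edge : ∀ {i j} → i ≢ j → ∃[ e ] Joins Kₙ e i j)
    where

    open IsTSPInstance isTSP

    private
      cost : EdgeSet Kₙ → Carrier
      cost = total Kₙ c

      cost≥0 : ∀ e → 0# ≤ uncurry c (ends Kₙ e)
      cost≥0 e = c≥0 _ _ (no-loops e)

    cost-joins : ∀ {e i j} → Joins Kₙ e i j → cost ⁅ e ⁆ ≈ c i j
    cost-joins {e} {i} {j} e-joins = ≈-trans (total-⁅⁆ Kₙ c e) (lemma e-joins)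
      where
      lemma : Joins Kₙ e i j → uncurry c (ends Kₙ e) ≈ c i j
      lemma (inj₁ eq) rewrite eq = ≈-refl
      lemma (inj₂ eq) rewrite eq = symmetric j i

    cost-remove : ∀ {F e} → e ∈ F → cost F ≈ cost ⁅ e ⁆ + cost (⁅ e ⁆ ⊕ F)
    cost-remove {F} {e} e∈F = ≈-trans (≈-reflexive (cong cost (sym (⊕-cancelˡ ⁅ e ⁆ F))))
      (total-disjoint Kₙ c ⁅ e ⁆ (⁅ e ⁆ ⊕ F) (⊕⁅⁆-disjoint e∈F))

    -- Edges from `v` to `u` and to `w` are replaced by the edge between `u` and `w`; these differ
    -- because there are no parallel edges. The new edge `g` is toggled rather than added: if it was
    -- already in `F` it disappears, which gives the same parities and a lower cost. Two edges go
    -- and at most one comes, so the size drops.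
    shortcut : ∀ F v → 2 ℕ.≤ degree Kₙ F v →
               ∃[ F′ ] (∀ w → odd-degree Kₙ F′ w ≡ odd-degree Kₙ F w) × cost F′ ≤ cost F × ∣ F′ ∣ ℕ.< ∣ F ∣
    shortcut F v 2≤ with two-members (F ∩ δ Kₙ ⁅ v ⁆) 2≤
    ... | e , f , f≢e , e∈ , f∈ with x∈p∩q⁻ F (δ Kₙ ⁅ v ⁆) e∈ | x∈p∩q⁻ F (δ Kₙ ⁅ v ⁆) f∈
    ... | e∈F , e∈δ | f∈F , f∈δ with other-end Kₙ e∈δ | other-end Kₙ f∈δ
    ... | u , v≢u , e-joins | w , v≢w , f-joins = ⁅ g ⁆ ⊕ R , same-parity , cheaper , smaller
      where
      u≢w : u ≢ w
      u≢w refl = f≢e (joins-unique f-joins e-joins)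

      g : Edge Kₙ
      g = proj₁ (edge u≢w)

      R : EdgeSet Kₙ
      R = ⁅ f ⁆ ⊕ (⁅ e ⁆ ⊕ F)

      f∈′ : f ∈ ⁅ e ⁆ ⊕ F
      f∈′ = ∈-⁅⁆⊕ f≢e f∈F

      same-parity : ∀ z → odd-degree Kₙ (⁅ g ⁆ ⊕ R) z ≡ odd-degree Kₙ F z
      same-parity z = begin
        odd-degree Kₙ (⁅ g ⁆ ⊕ R) z
          ≡⟨ odd-degree-⊕ Kₙ ⁅ g ⁆ R z ⟩
        odd-degree Kₙ ⁅ g ⁆ z xor odd-degree Kₙ R z
          ≡⟨ cong (odd-degree Kₙ ⁅ g ⁆ z xor_) (odd-degree-⊕ Kₙ ⁅ f ⁆ (⁅ e ⁆ ⊕ F) z) ⟩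
        odd-degree Kₙ ⁅ g ⁆ z xor (odd-degree Kₙ ⁅ f ⁆ z xor odd-degree Kₙ (⁅ e ⁆ ⊕ F) z)
          ≡⟨ cong (λ b → odd-degree Kₙ ⁅ g ⁆ z xor (odd-degree Kₙ ⁅ f ⁆ z xor b)) (odd-degree-⊕ Kₙ ⁅ e ⁆ F z) ⟩
        odd-degree Kₙ ⁅ g ⁆ z xor (odd-degree Kₙ ⁅ f ⁆ z xor (odd-degree Kₙ ⁅ e ⁆ z xor odd-degree Kₙ F z))
          ≡⟨ cong₂ _xor_ (odd-degree-⁅⁆ Kₙ (proj₂ (edge u≢w)) z)
               (cong₂ _xor_ (odd-degree-⁅⁆ Kₙ f-joins z) (cong (_xor odd-degree Kₙ F z) (odd-degree-⁅⁆ Kₙ e-joins z))) ⟩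
        (ιu xor ιw) xor ((ιv xor ιw) xor ((ιv xor ιu) xor odd-degree Kₙ F z))
          ≡⟨ triangle-even ιu ιv ιw _ ⟩
        odd-degree Kₙ F z ∎
        where
        open ≡-Reasoning
        ιu ιv ιw : Bool
        ιu = Vec.lookup ⁅ z ⁆ u
        ιv = Vec.lookup ⁅ z ⁆ v
        ιw = Vec.lookup ⁅ z ⁆ w
        triangle-even : ∀ a b c d → (a xor c) xor ((b xor c) xor ((b xor a) xor d)) ≡ d
        triangle-even true  true  true  _     = refl
        triangle-even true  true  false true  = refl
        triangle-even true  true  false false = refl
        triangle-even true  false true  true  = refl
        triangle-even true  false true  false = refl
        triangle-even true  false false true  = refl
        triangle-even true  false false false = refl
        triangle-even false true  true  true  = refl
        triangle-even false true  true  false = refl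
        triangle-even false true  false true  = refl
        triangle-even false true  false false = refl
        triangle-even false false true  true  = refl
        triangle-even false false true  false = refl
        triangle-even false false false _     = refl

      cheaper : cost (⁅ g ⁆ ⊕ R) ≤ cost F
      cheaper = begin
        cost (⁅ g ⁆ ⊕ R)                   ≤⟨ total-⊕ Kₙ c cost≥0 ⁅ g ⁆ R ⟩
        cost ⁅ g ⁆ + cost R                ≈⟨ +-congʳ (cost-joins (proj₂ (edge u≢w))) ⟩
        c u w + cost R                     ≤⟨ +-mono-≤ (triangle u w v u≢w (v≢u ∘ sym) v≢w) ≤-refl ⟩
        (c u v + c v w) + cost R           ≈⟨ +-congʳ (+-congʳ (symmetric u v)) ⟩
        (c v u + c v w) + cost R           ≈⟨ +-assoc _ _ _ ⟩
        c v u + (c v w + cost R)           ≈⟨ +-cong (cost-joins e-joins) (+-congʳ (cost-joins f-joins)) ⟨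
        cost ⁅ e ⁆ + (cost ⁅ f ⁆ + cost R) ≈⟨ +-congˡ (cost-remove f∈′) ⟨
        cost ⁅ e ⁆ + cost (⁅ e ⁆ ⊕ F)      ≈⟨ cost-remove e∈F ⟨
        cost F                             ∎
        where open ≤-Reasoning

      smaller : ∣ ⁅ g ⁆ ⊕ R ∣ ℕ.< ∣ F ∣
      smaller = ℕ.≤-trans (ℕ.s≤s (∣⁅⁆⊕∣≤ R g))
        (ℕ.≤-reflexive (sym (trans (∣⁅⁆⊕∣ e∈F) (cong ℕ.suc (∣⁅⁆⊕∣ f∈′)))))

    -- `k` bounds the number of remaining shortcuts, since each one lowers `∣ F ∣`. When none is
    -- possible, all degrees are at most one.
    reduce : ∀ k F → ∣ F ∣ ℕ.≤ k →
             ∃[ M ] (∀ v → odd-degree Kₙ M v ≡ odd-degree Kₙ F v) × cost M ≤ cost F × (∀ v → degree Kₙ M v ℕ.≤ 1)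
    reduce k F ∣F∣≤k with Fin.any? (λ v → 2 ℕ.≤? degree Kₙ F v)
    ... | no none = F , (λ _ → refl) , ≤-refl , λ v → ℕ.≤-pred (ℕ.≰⇒> (λ 2≤ → none (v , 2≤)))
    reduce ℕ.zero F ∣F∣≤0 | yes (v , 2≤) = contradiction
      (ℕ.≤-trans 2≤ (ℕ.≤-trans (∣p∩q∣≤∣p∣ F (δ Kₙ ⁅ v ⁆)) ∣F∣≤0)) λ ()
    reduce (ℕ.suc k) F ∣F∣≤k | yes (v , 2≤) with shortcut F v 2≤
    ... | F′ , parity′ , cost′ , smaller with reduce k F′ (ℕ.≤-pred (ℕ.≤-trans smaller ∣F∣≤k))
    ... | M , parityM , costM , matching =
      M , (λ w → trans (parityM w) (parity′ w)) , ≤-trans costM cost′ , matching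

    -- Edges of `X` are toggled one by one in the simple graph. Parallel copies cancel in pairs,
    -- which respects parities and can only lower the cost.
    simplify : ∀ (G : Multigraph n) → (∀ e → start G e ≢ finish G e) → ∀ X →
               ∃[ F ] (∀ v → odd-degree Kₙ F v ≡ odd-degree G X v) × cost F ≤ total G c X
    simplify []            _       []      = ⊥
      , (λ v → trans (cong odd (∩-zeroˡ (δ Kₙ ⁅ v ⁆))) (odd-⊥ (length Kₙ)))
      , ≤-reflexive (total-⊥ Kₙ c)
    simplify ((i , j) ∷ G) no-loop (false ∷ X) =
      let F , parityF , costF = simplify G (no-loop ∘ suc) X in
      F , parityF , ≤-respʳ-≈ (≈-sym (+-identityˡ _)) costF
    simplify ((i , j) ∷ G) no-loop (true ∷ X) =
      let F , parityF , costF = simplify G (no-loop ∘ suc) X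
          e , e-joins         = edge (no-loop zero)
      in ⁅ e ⁆ ⊕ F
       , (λ v → trans (odd-degree-⊕ Kₙ ⁅ e ⁆ F v) (cong₂ _xor_ (odd-degree-⁅⁆ Kₙ e-joins v) (parityF v)))
       , ≤-trans (total-⊕ Kₙ c cost≥0 ⁅ e ⁆ F) (+-mono-≤ (≤-reflexive (cost-joins e-joins)) costF)

    cheap-matching : ∀ (G : Multigraph n) → (∀ e → start G e ≢ finish G e) → ∀ J →
      ∃[ M ] (∀ v → odd-degree Kₙ M v ≡ odd-degree G J v) × cost M ≤ total G c J × (∀ v → degree Kₙ M v ℕ.≤ 1)
    cheap-matching G no-loop J =
      let F , parityF , costF            = simplify G no-loop J
          M , parityM , costM , matching = reduce ∣ F ∣ F ℕ.≤-refl
      in M , (λ v → trans (parityM v) (parityF v)) , ≤-trans costM costF , matching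

  -- Once shortcut to degrees at most one, the join `J` has degree one exactly at the odd vertices
  -- of `T`, so it competes with the minimum matching.
  min-matching-≤ : ∀ {n} (c : EdgeVector n) → IsTSPInstance c → (∀ i j → i ≢ j → 0# ≤ c i j) →
    ∀ (G : Multigraph n) → (∀ e → start G e ≢ finish G e) →
    ∀ {T J M} → IsMinCostPerfectMatching c (oddVertices G T) M →
    (∀ v → odd-degree G J v ≡ odd-degree G T v) → total (complete n) c M ≤ total G c J
  min-matching-≤ {n} c isTSP c≥0 G no-loop {T} {J} isMin J-join =
    let M′ , parityM , costM , matching =
          cheap-matching c isTSP c≥0 (complete n) (λ e → Fin.<⇒≢ (start<finish n e)) (joins-unique n) (edge n)
            G no-loop J
        parity-degree : ∀ v → parity (degree (complete n) M′ v) ≡ Vec.lookup (oddVertices G T) v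
        parity-degree v = trans (parity-∣∣ (M′ ∩ δ (complete n) ⁅ v ⁆)) (trans (parityM v)
          (trans (J-join v) (sym (lookup-oddVertices G T v))))
    in ≤-trans (IsMinCostPerfectMatching.minimal isMin M′ record
         { covered = λ v v∈ → odd∧≤1⇒≡1 (matching v) (trans (parity-degree v) (∈⇒lookup v∈))
         ; avoided = λ v v∉ → even∧≤1⇒≡0 (matching v) (trans (parity-degree v) (∉⇒lookup _ v∉)) })
         costM

-- The split graph

All-concatMap : ∀ {a p q} {A : Set a} {P : A → Set p} {B : Set a} {Q : B → Set q} {f : A → List B} →
                (∀ {y} → P y → All Q (f y)) → ∀ {ys} → All P ys → All Q (concatMap f ys)
All-concatMap h []         = []
All-concatMap h (py ∷ pys) = ++⁺ (h py) (All-concatMap h pys)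

module SplitProperties {a ℓ₁ ℓ₂} (K : OrderedField a ℓ₁ ℓ₂) where

  open OrderedField K
  open OrderedFieldProperties K
  open TotalProperties K
  open TSP K
  open Sum +-commutativeMonoid using (sum)

  -- `split` is built by `concatMap`, which is followed more easily through the entries of a list
  -- than through the positions that `total` sums over.
  sumList : ∀ {b} {A : Set b} → List A → (A → Carrier) → Carrier
  sumList xs f = List.foldr (λ y s → f y + s) 0# xs

  sumList-cong : ∀ {b p} {A : Set b} {P : A → Set p} {f g : A → Carrier} →
                 (∀ {y} → P y → f y ≈ g y) → ∀ {xs} → All P xs → sumList xs f ≈ sumList xs g
  sumList-cong f≈g []       = ≈-refl
  sumList-cong f≈g (p ∷ ps) = +-cong (f≈g p) (sumList-cong f≈g ps)

  sumList-+ : ∀ {b} {A : Set b} (xs : List A) f g →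
              sumList xs (λ y → f y + g y) ≈ sumList xs f + sumList xs g
  sumList-+ []       f g = ≈-sym (+-identityˡ 0#)
  sumList-+ (y ∷ xs) f g = ≈-trans (+-congˡ (sumList-+ xs f g))
    (solve 4 (λ a b c d → (a ⊞ b) ⊞ (c ⊞ d) ⊜ (a ⊞ c) ⊞ (b ⊞ d)) ≈-refl _ _ _ _)

  sumList-replicates : ∀ {b} {A : Set b} (k : A → ℕ) (f : A → Carrier) xs →
    sumList (concatMap (λ y → List.replicate (k y) y) xs) f ≈ sumList xs (λ y → k y · f y)
  sumList-replicates k f []       = ≈-refl
  sumList-replicates k f (y ∷ xs) = prefix (k y)
    where
    prefix : ∀ j → sumList (List.replicate j y List.++ concatMap (λ y → List.replicate (k y) y) xs) f
                   ≈ j · f y + sumList xs (λ y → k y · f y)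
    prefix ℕ.zero    = ≈-trans (sumList-replicates k f xs) (≈-sym (+-identityˡ _))
    prefix (ℕ.suc j) = ≈-trans (+-congˡ (prefix j)) (≈-sym (+-assoc _ _ _))

  module _ {n : ℕ} (w : EdgeVector n) where

    total-⊤ : ∀ (G : Multigraph n) → total G w ⊤ ≈ sumList G (uncurry w)
    total-⊤ []      = ≈-refl
    total-⊤ (_ ∷ G) = +-congˡ (total-⊤ G)

    total-δ : ∀ (G : Multigraph n) S → total G w (δ G S) ≈
              sumList G (λ (i , j) → if Vec.lookup S i xor Vec.lookup S j then w i j else 0#)
    total-δ []      S = ≈-refl
    total-δ (_ ∷ G) S = +-congˡ (total-δ G S)

  fromℕ-∣∣ : ∀ {m} (X : Subset m) → fromℕ ∣ X ∣ ≈ sum (λ e → if Vec.lookup X e then 1# else 0#)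
  fromℕ-∣∣ []          = ≈-refl
  fromℕ-∣∣ (true ∷ X)  = +-congˡ (fromℕ-∣∣ X)
  fromℕ-∣∣ (false ∷ X) = ≈-trans (fromℕ-∣∣ X) (≈-sym (+-identityˡ _))

  -- On half-integral values `copies y` is 2y. The default 0 of `copies` agrees with this only for
  -- `y ≈ 0#`, so half-integrality is consulted once both tests have failed.
  copies-· : ∀ {y} → y ≈ 0# ⊎ y ≈ ½ ⊎ y ≈ 1# → ∀ z → copies y · z ≈ y * z + y * z
  copies-· {y} half z with y ≟ 1# | y ≟ ½
  ... | yes y≈1 | _       = +-cong y*z≈z (≈-trans (+-identityʳ z) y*z≈z)
    where
    y*z≈z : z ≈ y * z
    y*z≈z = ≈-sym (≈-trans (*-congʳ y≈1) (*-identityˡ z))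
  ... | no _    | yes y≈½ = ≈-trans (+-identityʳ z) (≈-sym (≈-trans
    (+-cong (*-congʳ y≈½) (*-congʳ y≈½)) (½*-+-½* z)))
  ... | no y≉1  | no y≉½  with half
  ... | inj₁ y≈0        = ≈-sym (≈-trans (+-cong 0*z 0*z) (+-identityˡ 0#))
    where
    0*z : y * z ≈ 0#
    0*z = ≈-trans (*-congʳ y≈0) (zeroˡ z)
  ... | inj₂ (inj₁ y≈½) = contradiction y≈½ y≉½
  ... | inj₂ (inj₂ y≈1) = contradiction y≈1 y≉1

  complete-≢ : ∀ n → All (uncurry _≢_) (complete n)
  complete-≢ n = All.map Fin.<⇒≢ (all-filter (uncurry Fin._<?_) (cartesianProduct (allFin n) (allFin n)))

  module _ {n} {x : EdgeVector n} (half : ∀ i j → i ≢ j → x i j ≈ 0# ⊎ x i j ≈ ½ ⊎ x i j ≈ 1#) where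

    split-no-loops : ∀ e → start (split x) e ≢ finish (split x) e
    split-no-loops e = All.lookup (All-concatMap (replicate⁺ _) (complete-≢ n)) (∈-lookup e)

    sumList-split : ∀ f → sumList (split x) f ≈
                    sumList (complete n) (λ p → uncurry x p * f p) + sumList (complete n) (λ p → uncurry x p * f p)
    sumList-split f = ≈-trans (sumList-replicates (λ (i , j) → copies (x i j)) f (complete n))
      (≈-trans (sumList-cong (λ {p} i≢j → copies-· (half _ _ i≢j) (f p)) (complete-≢ n))
        (sumList-+ (complete n) _ _))

    total-split : ∀ c → total (split x) c ⊤ ≈ lpCost c x + lpCost c x
    total-split c = ≈-trans (total-⊤ c (split x)) (≈-trans (sumList-split (uncurry c)) (+-cong eq eq))
      where
      eq : sumList (complete n) (λ p → uncurry x p * uncurry c p) ≈ lpCost c x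
      eq = ≈-trans (sumList-cong (λ _ → *-comm _ _) (complete-≢ n))
        (≈-sym (total-⊤ (λ i j → c i j * x i j) (complete n)))

    -- The number of split edges in a cut is twice its LP value; the comparison with 4 takes place
    -- in the field and is then pulled back to the natural numbers.
    tight⇒∣δ∣≡4 : ∀ {S} → Tight x S → ∣ δ (split x) S ∣ ≡ 4
    tight⇒∣δ∣≡4 {S} tight = fromℕ-injective (begin
      fromℕ ∣ δ (split x) S ∣
        ≈⟨ fromℕ-∣∣ (δ (split x) S) ⟩
      total (split x) (λ _ _ → 1#) (δ (split x) S)
        ≈⟨ total-δ (λ _ _ → 1#) (split x) S ⟩
      sumList (split x) cut
        ≈⟨ sumList-split cut ⟩
      sumList (complete n) (λ p → uncurry x p * cut p) + sumList (complete n) (λ p → uncurry x p * cut p)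
        ≈⟨ +-cong eq eq ⟩
      cutValue x S + cutValue x S
        ≈⟨ +-cong tight tight ⟩
      fromℕ 2 + fromℕ 2
        ≈⟨ solve 1 (λ one → (one ⊞ (one ⊞ id)) ⊞ (one ⊞ (one ⊞ id)) ⊜ one ⊞ (one ⊞ (one ⊞ (one ⊞ id)))) ≈-refl 1# ⟩
      fromℕ 4 ∎)
      where
      open ≤-Reasoning hiding (begin_)
      open ≤-Reasoning using () renaming (begin-equality_ to begin_)
      cut : Fin n × Fin n → Carrier
      cut (i , j) = if Vec.lookup S i xor Vec.lookup S j then 1# else 0#

      if-* : ∀ b y → y * (if b then 1# else 0#) ≈ (if b then y else 0#)
      if-* true  y = *-identityʳ y
      if-* false y = zeroʳ y

      eq : sumList (complete n) (λ p → uncurry x p * cut p) ≈ cutValue x S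
      eq = ≈-trans (sumList-cong (λ { {i , j} _ → if-* (Vec.lookup S i xor Vec.lookup S j) (x i j) }) (complete-≢ n))
        (≈-sym (total-δ x (complete n) S))

-- Averaging over the hierarchy

parity-+ : ∀ j k → parity (j ℕ.+ k) ≡ parity j xor parity k
parity-+ ℕ.zero    k = refl
parity-+ (ℕ.suc j) k = trans (cong not (parity-+ j k)) (Bool.not-distribˡ-xor (parity j) (parity k))

parity-⟦⟧ : ∀ b → parity ⟦ b ⟧ ≡ b
parity-⟦⟧ true  = refl
parity-⟦⟧ false = refl

quadruple-odd : ∀ {n} {D : Subset n} {p q r s} → IsQuadruple D p q r s → ∀ X →
  odd (D ∩ X) ≡ Vec.lookup X p xor (Vec.lookup X q xor (Vec.lookup X r xor Vec.lookup X s))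
quadruple-odd {D = D} {p} {q} {r} {s} quad X = begin
  odd (D ∩ X)
    ≡⟨ parity-∣∣ (D ∩ X) ⟨
  parity ∣ D ∩ X ∣
    ≡⟨ cong parity (IsQuadruple.count quad X) ⟩
  parity ((X # p) ℕ.+ ((X # q) ℕ.+ ((X # r) ℕ.+ (X # s))))
    ≡⟨ step p (step q (step r (parity-⟦⟧ _))) ⟩
  Vec.lookup X p xor (Vec.lookup X q xor (Vec.lookup X r xor Vec.lookup X s)) ∎
  where
  open ≡-Reasoning
  step : ∀ i {k b} → parity k ≡ b → parity ((X # i) ℕ.+ k) ≡ Vec.lookup X i xor b
  step i eq = trans (parity-+ (X # i) _) (cong₂ _xor_ (parity-⟦⟧ (Vec.lookup X i)) eq)

-- α and β tell whether the second and the third edge differ from the first, whose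
-- bit is γ; evenness then determines the fourth.
record Pattern {m} (η : Subset m) (p q r s : Fin m) (α β γ : Bool) : Set where
  constructor agreeing
  field
    at₁ : Vec.lookup η p ≡ γ
    at₂ : Vec.lookup η q ≡ α xor γ
    at₃ : Vec.lookup η r ≡ β xor γ
    at₄ : Vec.lookup η s ≡ α xor (β xor γ)

module _ {m} {η : Subset m} where

  pattern-even : ∀ {D p q r s α β γ} → IsQuadruple D p q r s → Pattern η p q r s α β γ → odd (D ∩ η) ≡ false
  pattern-even {α = α} {β} {γ} quad (agreeing at₁ at₂ at₃ at₄) = trans (quadruple-odd quad η)
    (trans (cong₂ _xor_ at₁ (cong₂ _xor_ at₂ (cong₂ _xor_ at₃ at₄))) (lemma α β γ))
    where
    lemma : ∀ α β γ → γ xor ((α xor γ) xor ((β xor γ) xor (α xor (β xor γ)))) ≡ false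
    lemma true  true  true  = refl
    lemma true  true  false = refl
    lemma true  false true  = refl
    lemma true  false false = refl
    lemma false true  true  = refl
    lemma false true  false = refl
    lemma false false true  = refl
    lemma false false false = refl

  module _ {p q r s : Fin m} where

    -- The codes (`false`, `true`), (`true`, `false`) and (`true`, `true`) for (`α`, `β`) are the
    -- pairings 12|34, 13|24 and 14|23. Swapping two edges permutes these codes; a new first edge
    -- also moves the reference bit `γ`.
    pattern-swap₁₂ : ∀ α β γ → Pattern η q p r s α β γ → Pattern η p q r s α (α xor β) (α xor γ)
    pattern-swap₁₂ false β     γ     (agreeing at₁ at₂ at₃ at₄) = agreeing at₂ at₁ at₃ at₄
    pattern-swap₁₂ true  true  true  (agreeing at₁ at₂ at₃ at₄) = agreeing at₂ at₁ at₃ at₄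
    pattern-swap₁₂ true  true  false (agreeing at₁ at₂ at₃ at₄) = agreeing at₂ at₁ at₃ at₄
    pattern-swap₁₂ true  false true  (agreeing at₁ at₂ at₃ at₄) = agreeing at₂ at₁ at₃ at₄
    pattern-swap₁₂ true  false false (agreeing at₁ at₂ at₃ at₄) = agreeing at₂ at₁ at₃ at₄

    pattern-swap₂₃ : ∀ α β γ → Pattern η p r q s α β γ → Pattern η p q r s β α γ
    pattern-swap₂₃ false β     γ (agreeing at₁ at₂ at₃ at₄) = agreeing at₁ at₃ at₂ at₄
    pattern-swap₂₃ true  true  γ (agreeing at₁ at₂ at₃ at₄) = agreeing at₁ at₃ at₂ at₄
    pattern-swap₂₃ true  false γ (agreeing at₁ at₂ at₃ at₄) = agreeing at₁ at₃ at₂ at₄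

    pattern-swap₃₄ : ∀ α β γ → Pattern η p q s r α β γ → Pattern η p q r s α (α xor β) γ
    pattern-swap₃₄ false β     γ     (agreeing at₁ at₂ at₃ at₄) = agreeing at₁ at₂ at₄ at₃
    pattern-swap₃₄ true  true  true  (agreeing at₁ at₂ at₃ at₄) = agreeing at₁ at₂ at₄ at₃
    pattern-swap₃₄ true  true  false (agreeing at₁ at₂ at₃ at₄) = agreeing at₁ at₂ at₄ at₃
    pattern-swap₃₄ true  false true  (agreeing at₁ at₂ at₃ at₄) = agreeing at₁ at₂ at₄ at₃
    pattern-swap₃₄ true  false false (agreeing at₁ at₂ at₃ at₄) = agreeing at₁ at₂ at₄ at₃

+-exchange : ∀ i j k → i ℕ.+ (j ℕ.+ k) ≡ j ℕ.+ (i ℕ.+ k)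
+-exchange i j k = trans (sym (ℕ.+-assoc i j k)) (trans (cong (ℕ._+ k) (ℕ.+-comm i j)) (ℕ.+-assoc j i k))

module _ {m} {D : Subset m} {p q r s : Fin m} where

  quadruple-swap₁₂ : IsQuadruple D p q r s → IsQuadruple D q p r s
  quadruple-swap₁₂ (quadruple count) = quadruple λ X → trans (count X) (+-exchange (X # p) (X # q) _)

  quadruple-swap₂₃ : IsQuadruple D p q r s → IsQuadruple D p r q s
  quadruple-swap₂₃ (quadruple count) = quadruple λ X →
    trans (count X) (cong ((X # p) ℕ.+_) (+-exchange (X # q) (X # r) _))

  quadruple-swap₃₄ : IsQuadruple D p q r s → IsQuadruple D p q s r
  quadruple-swap₃₄ (quadruple count) = quadruple λ X →
    trans (count X) (cong (λ k → (X # p) ℕ.+ ((X # q) ℕ.+ k)) (ℕ.+-comm (X # r) (X # s)))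

module MaxEntropy {a ℓ₁ ℓ₂} (K : OrderedField a ℓ₁ ℓ₂) where

  open OrderedField K
  open TSP K
  open OrderedFieldProperties K
  open TotalProperties K
  open SplitProperties K

  module Instance {n} (c x : EdgeVector n)
    (half : ∀ i j → i ≢ j → x i j ≈ 0# ⊎ x i j ≈ ½ ⊎ x i j ≈ 1#)
    (cost≥0 : ∀ e → 0# ≤ uncurry c (ends (split x) e))
    where

    G : Multigraph n
    G = split x

    cost : EdgeSet G → Carrier
    cost = total G c

    -- F stands for the cost of a tree and its best join: if η ⊕ H is even then T and
    -- T ⊕ H have the same odd vertices.
    Dominated : Subset n → EdgeSet G → Carrier → (EdgeSet G → Carrier) → Set ℓ₂
    Dominated S η k F = ∀ T H → T ⊆ inner G S → H ⊆ inner G S →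
      (∀ v → v ∈ S → odd-degree G (η ⊕ H) v ≡ false) → F T ≤ k + (cost T + cost (T ⊕ H))

    -- `η` is the even set as fixed outside `S`, and `k` is the cost already incurred there.
    -- Quantifying over all `k` and `F` lets `F` itself be an expectation over the sibling's tree,
    -- so that estimates for two subtrees can be nested.
    record Bound {S} (t : Tree x S) (η : EdgeSet G) (u : Carrier) : Set (a ⊔ ℓ₂) where
      constructor bounded
      field
        estimate : ∀ k F → Dominated S η k F → 𝔼 (treeEdges x t) F ≤ k + u

    -- Up to complementation, an even pattern on δ S is constant (taken with
    -- probability 1/7) or one of three pairings (2/7 each).  The field weight says
    -- that on average the tree and the join inside S cost at most 5/7 of the edges.
    record Value {S} (t : Tree x S) (p q r s : Edge G) : Set (a ⊔ ℓ₂) where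
      field
        u      : Bool → Bool → Carrier
        weight : u false false + 2 · (u false true + (u true false + u true true)) ≤ 5 · cost (inner G S)
        bound  : ∀ {α β γ η} → η ∩ inner G S ≡ ⊥ → Pattern η p q r s α β γ → Bound t η (u α β)

    module _ {S} {t : Tree x S} {p q r s : Edge G} where

      -- The three pairings have equal weight, so `weight` survives any permutation of the edges.
      value-swap₁₂ : Value t p q r s → Value t q p r s
      value-swap₁₂ val = record
        { u      = λ α β → u α (α xor β)
        ; weight = ≤-respˡ-≈ (+-congˡ (·-congʳ 2 (+-congˡ (+-comm _ _)))) weight
        ; bound  = λ {α} {β} {γ} η∩ pat → bound η∩ (pattern-swap₁₂ α β γ pat)
        }
        where open Value val

      value-swap₂₃ : Value t p q r s → Value t p r q s
      value-swap₂₃ val = record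
        { u      = λ α β → u β α
        ; weight = ≤-respˡ-≈ (+-congˡ (·-congʳ 2
            (solve 3 (λ a b c → a ⊞ (b ⊞ c) ⊜ b ⊞ (a ⊞ c)) ≈-refl _ _ _))) weight
        ; bound  = λ {α} {β} {γ} η∩ pat → bound η∩ (pattern-swap₂₃ α β γ pat)
        }
        where open Value val

      value-swap₃₄ : Value t p q r s → Value t p q s r
      value-swap₃₄ val = record
        { u      = λ α β → u α (α xor β)
        ; weight = ≤-respˡ-≈ (+-congˡ (·-congʳ 2 (+-congˡ (+-comm _ _)))) weight
        ; bound  = λ {α} {β} {γ} η∩ pat → bound η∩ (pattern-swap₃₄ α β γ pat)
        }
        where open Value val

    -- Nothing remains to be chosen at a single vertex: the empty completion is even there because
    -- the pattern on its four edges is even.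
    leaf-value : ∀ {S} v (S≡ : S ≡ ⁅ v ⁆) {p q r s} → IsQuadruple (δ G S) p q r s → Value (leaf v S≡) p q r s
    leaf-value v refl {p} {q} {r} {s} quad = record
      { u      = λ _ _ → 0#
      ; weight = ≤-respˡ-≈ (solve 0 (id ⊜ id ⊞ ((id ⊞ (id ⊞ id)) ⊞ ((id ⊞ (id ⊞ id)) ⊞ id))) ≈-refl)
          (·-nonNeg 5 (total-nonNeg G c cost≥0 (inner G ⁅ v ⁆)))
      ; bound  = bound
      }
      where
      ·-nonNeg : ∀ k {y} → 0# ≤ y → 0# ≤ k · y
      ·-nonNeg ℕ.zero    _   = ≤-refl
      ·-nonNeg (ℕ.suc k) 0≤y = +-nonNeg 0≤y (·-nonNeg k 0≤y)

      bound : ∀ {α β γ η} → η ∩ inner G ⁅ v ⁆ ≡ ⊥ → Pattern η p q r s α β γ → Bound (leaf v refl) η 0#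
      bound {η = η} _ pat = bounded λ k F F≤ → begin
        𝔼 (return ⊥) F              ≈⟨ 𝔼-return ⊥ F ⟩
        F ⊥                         ≤⟨ F≤ ⊥ ⊥ ⊥⊆ ⊥⊆ even ⟩
        k + (cost ⊥ + cost (⊥ ⊕ ⊥))     ≈⟨ +-congˡ (+-cong (total-⊥ G c)
          (≈-trans (≈-reflexive (cong cost (⊕-self ⊥))) (total-⊥ G c))) ⟩
        k + (0# + 0#)                   ≈⟨ +-congˡ (+-identityˡ 0#) ⟩
        k + 0#                          ∎
        where
        open ≤-Reasoning
        even : ∀ w → w ∈ ⁅ v ⁆ → odd-degree G (η ⊕ ⊥) w ≡ false
        even w w∈ = trans (cong₂ (λ X w → odd (X ∩ δ G ⁅ w ⁆)) (⊕-identityʳ η) (x∈⁅y⁆⇒x≡y v w∈))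
          (trans (cong odd (∩-comm η (δ G ⁅ v ⁆))) (pattern-even {D = δ G ⁅ v ⁆} quad pat))

    ½*-shift : ∀ k y z → ½ * ((k + y) + (k + z)) ≈ k + ½ * (y + z)
    ½*-shift k y z = ≈-trans
      (*-congˡ (solve 3 (λ k y z → (k ⊞ y) ⊞ (k ⊞ z) ⊜ (k ⊞ k) ⊞ (y ⊞ z)) ≈-refl k y z))
      (≈-trans (distribˡ ½ (k + k) (y + z)) (+-congʳ (½*-double k)))

    bound-resp : ∀ {S} {t : Tree x S} {η y z} → y ≈ z → Bound t η y → Bound t η z
    bound-resp y≈z (bounded estimate) = bounded λ k F F≤ → ≤-respʳ-≈ (+-congˡ y≈z) (estimate k F F≤)

    -- This replaces a random choice of the even set: the expectation on the left is the same for
    -- either choice, so the two upper bounds may be averaged.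
    bound-average : ∀ {S} {t : Tree x S} {η y z} → Bound t η y → Bound t η z → Bound t η (½ * (y + z))
    bound-average {t = t} {y = y} {z} (bounded estimate₁) (bounded estimate₂) = bounded λ k F F≤ → begin
      𝔼 (treeEdges x t) F                               ≈⟨ ½*-double _ ⟨
      ½ * (𝔼 (treeEdges x t) F + 𝔼 (treeEdges x t) F) ≤⟨ ½*-mono (+-mono-≤ (estimate₁ k F F≤) (estimate₂ k F F≤)) ⟩
      ½ * ((k + y) + (k + z))                           ≈⟨ ½*-shift k y z ⟩
      k + ½ * (y + z)                                   ∎
      where open ≤-Reasoning

    -- On a child's cut the outer edges `p`, `q` carry the bits of `η` and the crossing edges `a`,
    -- `b` those of `h`. As `h` is balanced on `a`, `b` exactly when `η` is on `p`, `q`, the child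
    -- inherits `α`, and its new `β` tells whether `a` differs from `p`.
    child-pattern : ∀ {m} {η h : Subset m} {p q a b α γ} ε →
      Vec.lookup η p ≡ γ → Vec.lookup η q ≡ α xor γ → Vec.lookup η a ≡ false → Vec.lookup η b ≡ false →
      Vec.lookup h p ≡ false → Vec.lookup h q ≡ false → Vec.lookup h a ≡ ε → Vec.lookup h b ≡ α xor ε →
      Pattern (η ⊕ h) p q a b α (ε xor γ) γ
    child-pattern {η = η} {h} {p} {q} {a} {b} {α} {γ} ε ηp ηq ηa ηb hp hq ha hb = agreeing
      (trans (lookup-⊕ η h p) (trans (cong₂ _xor_ ηp hp) (Bool.xor-identityʳ γ)))
      (trans (lookup-⊕ η h q) (trans (cong₂ _xor_ ηq hq) (Bool.xor-identityʳ _)))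
      (trans (lookup-⊕ η h a) (trans (cong₂ _xor_ ηa ha) (sym (xor-cancelʳ ε γ))))
      (trans (lookup-⊕ η h b) (trans (cong₂ _xor_ ηb hb) (cong (α xor_) (sym (xor-cancelʳ ε γ)))))
      where
      xor-cancelʳ : ∀ ε γ → (ε xor γ) xor γ ≡ ε
      xor-cancelʳ ε γ = trans (Bool.xor-assoc ε γ γ) (trans (cong (ε xor_) (Bool.xor-same γ)) (Bool.xor-identityʳ ε))

    module _ {S} (sp : Split x S) (tˡ : Tree x (Split.A sp)) (tʳ : Tree x (Split.B sp))
      (∣δS∣≡4 : ∣ δ G S ∣ ≡ 4) where

      open Split sp
      open Partition G partition
      private
        module Swapped = Partition G (partition-sym G partition)

      D : EdgeSet G
      D = δ G A ∩ δ G B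

      -- The tree edge `e` is held fixed here, so the crossing part `h` of the even set may depend
      -- on it.
      branch : ∀ {η e h yˡ yʳ} → e ∈ D → h ⊆ D → Bound tˡ (η ⊕ h) yˡ → Bound tʳ (η ⊕ h) yʳ →
        ∀ k F → Dominated S η k F →
        𝔼 (treeEdges x tˡ) (λ Tˡ → 𝔼 (treeEdges x tʳ) (λ Tʳ → F (⁅ e ⁆ ∪ (Tˡ ∪ Tʳ))))
          ≤ k + ((cost ⁅ e ⁆ + cost (⁅ e ⁆ ⊕ h)) + (yˡ + yʳ))
      branch {η} {e} {h} {yˡ} {yʳ} e∈D h⊆D (bounded estimateˡ) (bounded estimateʳ) k F F≤ = ≤-respʳ-≈
        (solve 4 (λ k d yˡ yʳ → (((k ⊞ d) ⊞ yʳ) ⊞ yˡ) ⊜ k ⊞ (d ⊞ (yˡ ⊞ yʳ))) ≈-refl k d yˡ yʳ)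
        -- The left estimate is applied to the expectation over the right tree, with the right bound
        -- `yʳ` counted in the constant. Its premise is the right estimate for fixed `Tˡ` and `Hˡ`,
        -- whose costs are then part of the constant.
        (estimateˡ ((k + d) + yʳ) _ λ Tˡ Hˡ Tˡ⊆ Hˡ⊆ evenˡ → ≤-respʳ-≈
          (solve 3 (λ k j yʳ → (k ⊞ j) ⊞ yʳ ⊜ (k ⊞ yʳ) ⊞ j) ≈-refl (k + d) (cost Tˡ + cost (Tˡ ⊕ Hˡ)) yʳ)
          (estimateʳ ((k + d) + (cost Tˡ + cost (Tˡ ⊕ Hˡ))) _ λ Tʳ Hʳ Tʳ⊆ Hʳ⊆ evenʳ →
            combine Tˡ⊆ Hˡ⊆ evenˡ Tʳ⊆ Hʳ⊆ evenʳ))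
        where
        d : Carrier
        d = cost ⁅ e ⁆ + cost (⁅ e ⁆ ⊕ h)

        ⁅e⁆⊆D : ⁅ e ⁆ ⊆ D
        ⁅e⁆⊆D f∈ = subst (_∈ D) (sym (x∈⁅y⁆⇒x≡y e f∈)) e∈D

        module _ {Tˡ Hˡ Tʳ Hʳ : EdgeSet G}
          (Tˡ⊆ : Tˡ ⊆ inner G A) (Hˡ⊆ : Hˡ ⊆ inner G A)
          (evenˡ : ∀ v → v ∈ A → odd-degree G ((η ⊕ h) ⊕ Hˡ) v ≡ false)
          (Tʳ⊆ : Tʳ ⊆ inner G B) (Hʳ⊆ : Hʳ ⊆ inner G B)
          (evenʳ : ∀ v → v ∈ B → odd-degree G ((η ⊕ h) ⊕ Hʳ) v ≡ false) where

          T H : EdgeSet G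
          T = ⁅ e ⁆ ∪ (Tˡ ∪ Tʳ)
          H = h ⊕ (Hˡ ⊕ Hʳ)

          T≡ : T ≡ ⁅ e ⁆ ⊕ (Tˡ ⊕ Tʳ)
          T≡ = trans
            (cong (⁅ e ⁆ ∪_) (disjoint⇒∪≡⊕ Tˡ Tʳ (disjoint-⊆ Tˡ⊆ Tʳ⊆ inner-A∩inner-B)))
            (disjoint⇒∪≡⊕ ⁅ e ⁆ (Tˡ ⊕ Tʳ) (disjoint-⊆ ⁅e⁆⊆D Tˡ⊕Tʳ⊆ crossing-avoids-inners))
            where
            Tˡ⊕Tʳ⊆ : Tˡ ⊕ Tʳ ⊆ inner G A ⊕ inner G B
            Tˡ⊕Tʳ⊆ f∈ = subst (_ ∈_) (disjoint⇒∪≡⊕ (inner G A) (inner G B) inner-A∩inner-B)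
              (⊕-⊆ {p = Tˡ} (λ f∈ → p⊆p∪q (inner G B) (Tˡ⊆ f∈)) (λ f∈ → q⊆p∪q (inner G A) (inner G B) (Tʳ⊆ f∈)) f∈)

          T⊕H≡ : T ⊕ H ≡ (⁅ e ⁆ ⊕ h) ⊕ ((Tˡ ⊕ Hˡ) ⊕ (Tʳ ⊕ Hʳ))
          T⊕H≡ = trans (cong (_⊕ H) T≡)
            (⊕-solve 6 (λ e tl tr h hl hr → (e ⊠ (tl ⊠ tr)) ⊠ (h ⊠ (hl ⊠ hr)) ⊖ (e ⊠ h) ⊠ ((tl ⊠ hl) ⊠ (tr ⊠ hr)))
              refl ⁅ e ⁆ Tˡ Tʳ h Hˡ Hʳ)
            where open CMSolver (⊕-commutativeMonoid (length G)) using ()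
                    renaming (solve to ⊕-solve; _⊕_ to _⊠_; _⊜_ to _⊖_)

          even : ∀ v → v ∈ S → odd-degree G (η ⊕ H) v ≡ false
          even v v∈S with x∈p∪q⁻ A B (subst (v ∈_) (sym (_PartitionsInto_and_.covering partition)) v∈S)
          -- `Hʳ` lies inside `B` and has no edge at a vertex of `A`, so only the left evenness
          -- matters.
          ... | inj₁ v∈A = trans (cong (λ X → odd-degree G X v) reassoc)
            (trans (odd-degree-⊕ G ((η ⊕ h) ⊕ Hˡ) Hʳ v)
              (cong₂ _xor_ (evenˡ v v∈A) (odd-degree-inner G Hʳ⊆ (Swapped.A∌ v∈A))))
            where
            reassoc : η ⊕ H ≡ ((η ⊕ h) ⊕ Hˡ) ⊕ Hʳ
            reassoc = trans (sym (⊕-assoc η h (Hˡ ⊕ Hʳ))) (sym (⊕-assoc (η ⊕ h) Hˡ Hʳ))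
          ... | inj₂ v∈B = trans (cong (λ X → odd-degree G X v) reassoc)
            (trans (odd-degree-⊕ G ((η ⊕ h) ⊕ Hʳ) Hˡ v)
              (cong₂ _xor_ (evenʳ v v∈B) (odd-degree-inner G Hˡ⊆ (A∌ v∈B))))
            where
            reassoc : η ⊕ H ≡ ((η ⊕ h) ⊕ Hʳ) ⊕ Hˡ
            reassoc = trans (sym (⊕-assoc η h (Hˡ ⊕ Hʳ)))
              (trans (cong ((η ⊕ h) ⊕_) (⊕-comm Hˡ Hʳ)) (sym (⊕-assoc (η ⊕ h) Hʳ Hˡ)))

          cost-⊕ : ∀ X Y → cost (X ⊕ Y) ≤ cost X + cost Y
          cost-⊕ = total-⊕ G c cost≥0

          combine : F T ≤ ((k + d) + (cost Tˡ + cost (Tˡ ⊕ Hˡ))) + (cost Tʳ + cost (Tʳ ⊕ Hʳ))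
          combine = begin
            F T
              ≤⟨ F≤ T H
                   (∪-⊆ {p = ⁅ e ⁆} (crossing⊆inner ∘ ⁅e⁆⊆D) (∪-⊆ {p = Tˡ} (inner-A⊆ ∘ Tˡ⊆) (Swapped.inner-A⊆ ∘ Tʳ⊆)))
                   (⊕-⊆ {p = h} (crossing⊆inner ∘ h⊆D) (⊕-⊆ {p = Hˡ} (inner-A⊆ ∘ Hˡ⊆) (Swapped.inner-A⊆ ∘ Hʳ⊆)))
                   even ⟩
            k + (cost T + cost (T ⊕ H))
              ≈⟨ +-congˡ (+-cong (≈-reflexive (cong cost T≡)) (≈-reflexive (cong cost T⊕H≡))) ⟩
            k + (cost (⁅ e ⁆ ⊕ (Tˡ ⊕ Tʳ)) + cost ((⁅ e ⁆ ⊕ h) ⊕ ((Tˡ ⊕ Hˡ) ⊕ (Tʳ ⊕ Hʳ))))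
              ≤⟨ +-monoʳ-≤ k (+-mono-≤
                   (≤-trans (cost-⊕ ⁅ e ⁆ _) (+-monoʳ-≤ _ (cost-⊕ Tˡ Tʳ)))
                   (≤-trans (cost-⊕ (⁅ e ⁆ ⊕ h) _) (+-monoʳ-≤ _ (cost-⊕ (Tˡ ⊕ Hˡ) (Tʳ ⊕ Hʳ))))) ⟩
            k + ((cost ⁅ e ⁆ + (cost Tˡ + cost Tʳ)) + (cost (⁅ e ⁆ ⊕ h) + (cost (Tˡ ⊕ Hˡ) + cost (Tʳ ⊕ Hʳ))))
              ≈⟨ solve 7 (λ k e tl tr eh tlh trh → k ⊞ ((e ⊞ (tl ⊞ tr)) ⊞ (eh ⊞ (tlh ⊞ trh)))
                   ⊜ ((k ⊞ (e ⊞ eh)) ⊞ (tl ⊞ tlh)) ⊞ (tr ⊞ trh)) ≈-refl k _ _ _ _ _ _ ⟩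
            ((k + d) + (cost Tˡ + cost (Tˡ ⊕ Hˡ))) + (cost Tʳ + cost (Tʳ ⊕ Hʳ)) ∎
            where open ≤-Reasoning

      -- `hᵃ` and `hᵇ` are the crossing parts used when the tree edge is `a` and when it is `b`;
      -- allowing them to differ correlates the even set with the tree.
      node-bound : ∀ {η a b} → IsPair D a b → ∀ {hᵃ hᵇ yˡ yʳ zˡ zʳ} → hᵃ ⊆ D → hᵇ ⊆ D →
        Bound tˡ (η ⊕ hᵃ) yˡ → Bound tʳ (η ⊕ hᵃ) yʳ → Bound tˡ (η ⊕ hᵇ) zˡ → Bound tʳ (η ⊕ hᵇ) zʳ →
        Bound (node sp tˡ tʳ) η
          (½ * (((cost ⁅ a ⁆ + cost (⁅ a ⁆ ⊕ hᵃ)) + (yˡ + yʳ)) + ((cost ⁅ b ⁆ + cost (⁅ b ⁆ ⊕ hᵇ)) + (zˡ + zʳ))))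
      node-bound {η} {a} {b} isPair {hᵃ} {hᵇ} hᵃ⊆ hᵇ⊆ bndˡ bndʳ bndˡ′ bndʳ′ = bounded λ k F F≤ →
        let Φ = λ e → 𝔼 (treeEdges x tˡ) λ Tˡ → 𝔼 (treeEdges x tʳ) λ Tʳ → F (⁅ e ⁆ ∪ (Tˡ ∪ Tʳ)) in
        begin
        𝔼 (treeEdges x (node sp tˡ tʳ)) F
          ≈⟨ 𝔼->>= (uniform D) _ F ⟩
        𝔼 (uniform D) _
          ≈⟨ 𝔼-cong (uniform D) (λ e → ≈-trans (𝔼->>= (treeEdges x tˡ) _ F)
               (𝔼-cong (treeEdges x tˡ) λ Tˡ → ≈-trans (𝔼->>= (treeEdges x tʳ) (λ Tʳ → return (⁅ e ⁆ ∪ (Tˡ ∪ Tʳ))) F)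
                 (𝔼-cong (treeEdges x tʳ) λ Tʳ → 𝔼-return (⁅ e ⁆ ∪ (Tˡ ∪ Tʳ)) F))) ⟩
        𝔼 (uniform D) Φ
          ≈⟨ 𝔼-uniform-pair isPair Φ ⟩
        ½ * (Φ a + Φ b)
          ≤⟨ ½*-mono (+-mono-≤
               (branch (lookup⇒∈ D (proj₁ (pair-member isPair))) hᵃ⊆ bndˡ bndʳ k F F≤)
               (branch (lookup⇒∈ D (proj₂ (pair-member isPair))) hᵇ⊆ bndˡ′ bndʳ′ k F F≤)) ⟩
        ½ * ((k + _) + (k + _))
          ≈⟨ ½*-shift k _ _ ⟩
        k + ½ * (_ + _) ∎
        where
        open ≤-Reasoning

    cost-pair : ∀ {D a b} → IsPair D a b → cost D ≈ cost ⁅ a ⁆ + cost ⁅ b ⁆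
    cost-pair {D} {a} {b} isPair = ≈-trans (≈-reflexive (cong cost (IsPair.≡⁅⁆⊕⁅⁆ isPair)))
      (total-disjoint G c ⁅ a ⁆ ⁅ b ⁆ (Empty-unique λ (e , e∈) →
        let e∈a , e∈b = x∈p∩q⁻ ⁅ a ⁆ ⁅ b ⁆ e∈ in
        pair-≢ isPair (trans (sym (x∈⁅y⁆⇒x≡y a e∈a)) (x∈⁅y⁆⇒x≡y b e∈b))))

    module _ {S} (sp : Split x S) (tˡ : Tree x (Split.A sp)) (tʳ : Tree x (Split.B sp))
      (∣δS∣≡4 : ∣ δ G S ∣ ≡ 4)
      {p q r s a b : Edge G} (isPair : IsPair (D sp tˡ tʳ ∣δS∣≡4) a b)
      (valˡ : Value tˡ p q a b) (valʳ : Value tʳ r s a b)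
      (p∉ : Vec.lookup (D sp tˡ tʳ ∣δS∣≡4) p ≡ false) (q∉ : Vec.lookup (D sp tˡ tʳ ∣δS∣≡4) q ≡ false)
      (r∉ : Vec.lookup (D sp tˡ tʳ ∣δS∣≡4) r ≡ false) (s∉ : Vec.lookup (D sp tˡ tʳ ∣δS∣≡4) s ≡ false)
      where

      open Split sp
      open Partition G partition
      private
        module Swapped = Partition G (partition-sym G partition)
        module L = Value valˡ
        module R = Value valʳ

        D₀ : EdgeSet G
        D₀ = D sp tˡ tʳ ∣δS∣≡4

        t : Tree x S
        t = node sp tˡ tʳ

        C : Carrier
        C = cost ⁅ a ⁆ + cost ⁅ b ⁆

      module _ {η α β γ} (η∩ : η ∩ inner G S ≡ ⊥) (pat : Pattern η p q r s α β γ) where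

        open Pattern pat

        η-vanishes : ∀ {e} → e ∈ D₀ → Vec.lookup η e ≡ false
        η-vanishes {e} e∈D = ∉⇒lookup η λ e∈η →
          ∉⊥ (subst (e ∈_) η∩ (x∈p∩q⁺ (e∈η , crossing⊆inner e∈D)))

        outside-h : ∀ {h e} → h ⊆ D₀ → Vec.lookup D₀ e ≡ false → Vec.lookup h e ≡ false
        outside-h {h} h⊆D e∉D = ∉⇒lookup h λ e∈h → lookup⇒∉ {p = D₀} e∉D (h⊆D e∈h)

        child-vanishes : ∀ {h I J} → h ⊆ D₀ → D₀ ⊆ J → I ∩ J ≡ ⊥ → I ⊆ inner G S → (η ⊕ h) ∩ I ≡ ⊥
        child-vanishes {h} {I} {J} h⊆D D⊆J I∩J I⊆ = trans (∩-distribʳ-⊕ I η h) (trans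
          (cong₂ _⊕_ (disjoint-⊆ {p = η} ⊆-refl I⊆ η∩)
                     (disjoint-⊆ {p = h} (D⊆J ∘ h⊆D) ⊆-refl (trans (∩-comm J I) I∩J)))
          (⊕-self ⊥))

        -- The reference edge of the right child is `r`, with bit `β xor γ`; this is why `R.u` has a
        -- different second argument.
        child-bounds : ∀ {h ε} → h ⊆ D₀ → Vec.lookup h a ≡ ε → Vec.lookup h b ≡ α xor ε →
          Bound tˡ (η ⊕ h) (L.u α (ε xor γ)) × Bound tʳ (η ⊕ h) (R.u α (ε xor (β xor γ)))
        child-bounds {h} {ε} h⊆D ha hb =
            L.bound (child-vanishes h⊆D (p∩q⊆p (δ G A) (δ G B)) (inner-δ-disjoint G A) inner-A⊆)
              (child-pattern ε at₁ at₂ ηa ηb (outside-h h⊆D p∉) (outside-h h⊆D q∉) ha hb)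
          , R.bound (child-vanishes h⊆D (p∩q⊆q (δ G A) (δ G B)) (inner-δ-disjoint G B) Swapped.inner-A⊆)
              (child-pattern ε at₃ at₄ ηa ηb (outside-h h⊆D r∉) (outside-h h⊆D s∉) ha hb)
          where
          ηa = η-vanishes (lookup⇒∈ D₀ (proj₁ (pair-member isPair)))
          ηb = η-vanishes (lookup⇒∈ D₀ (proj₂ (pair-member isPair)))

      ⁅⁆⊕D : ⁅ a ⁆ ⊕ D₀ ≡ ⁅ b ⁆ × ⁅ b ⁆ ⊕ D₀ ≡ ⁅ a ⁆
      ⁅⁆⊕D = trans (cong (⁅ a ⁆ ⊕_) (IsPair.≡⁅⁆⊕⁅⁆ isPair)) (⊕-cancelˡ ⁅ a ⁆ ⁅ b ⁆)
           , trans (cong (⁅ b ⁆ ⊕_) (trans (IsPair.≡⁅⁆⊕⁅⁆ isPair) (⊕-comm ⁅ a ⁆ ⁅ b ⁆))) (⊕-cancelˡ ⁅ b ⁆ ⁅ a ⁆)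

      -- `ε` selects `∅` or all of `D₀`. The join then contains the tree edge or its partner, so
      -- over the two draws the tree and the join each pay for `a` once and for `b` once: 2`C`,
      -- halved to `C`.
      equal-bound : ∀ ε {η β γ} → η ∩ inner G S ≡ ⊥ → Pattern η p q r s false β γ →
        Bound t η (C + (L.u false (ε xor γ) + R.u false (ε xor (β xor γ))))
      equal-bound false {η} {β} {γ} η∩ pat =
        let bˡ , bʳ = child-bounds η∩ pat {⊥} ⊥⊆ (lookup-⊥ a) (lookup-⊥ b) in
        bound-resp (≈-trans (*-congˡ (≈-trans
            (+-cong (+-congʳ (+-congˡ (≈-reflexive (cong cost (⊕-identityʳ ⁅ a ⁆)))))
                    (+-congʳ (+-congˡ (≈-reflexive (cong cost (⊕-identityʳ ⁅ b ⁆))))))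
            (solve 3 (λ a b v → ((a ⊞ a) ⊞ v) ⊞ ((b ⊞ b) ⊞ v) ⊜ ((a ⊞ b) ⊞ v) ⊞ ((a ⊞ b) ⊞ v)) ≈-refl _ _ _)))
            (½*-double _))
          (node-bound sp tˡ tʳ ∣δS∣≡4 isPair ⊥⊆ ⊥⊆ bˡ bʳ bˡ bʳ)
      equal-bound true {η} {β} {γ} η∩ pat =
        let bˡ , bʳ = child-bounds η∩ pat {D₀} ⊆-refl (proj₁ (pair-member isPair)) (proj₂ (pair-member isPair)) in
        bound-resp (≈-trans (*-congˡ (+-cong
              (+-congʳ (+-congˡ (≈-reflexive (cong cost (proj₁ ⁅⁆⊕D)))))
              (+-congʳ (≈-trans (+-congˡ (≈-reflexive (cong cost (proj₂ ⁅⁆⊕D)))) (+-comm _ _)))))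
            (½*-double _))
          (node-bound sp tˡ tʳ ∣δS∣≡4 isPair ⊆-refl ⊆-refl bˡ bʳ bˡ bʳ)

      -- The crossing part is the tree edge itself, which cancels in the join, so the tree alone
      -- pays and the average is half of `C`. The two draws give opposite bits to `a`, so each child
      -- meets both of its unbalanced pairings.
      unequal-bound : ∀ {η β γ} → η ∩ inner G S ≡ ⊥ → Pattern η p q r s true β γ →
        Bound t η (½ * (C + ((L.u true (not γ) + L.u true γ) + (R.u true (not (β xor γ)) + R.u true (β xor γ)))))
      unequal-bound {η} {β} {γ} η∩ pat =
        let bˡ , bʳ   = child-bounds η∩ pat {⁅ a ⁆} (⁅⁆⊆ a∈D) (∈⇒lookup (x∈⁅x⁆ a)) (∉⇒lookup ⁅ a ⁆ (x≢y⇒x∉⁅y⁆ (a≢b ∘ sym)))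
            bˡ′ , bʳ′ = child-bounds η∩ pat {⁅ b ⁆} (⁅⁆⊆ b∈D) (∉⇒lookup ⁅ b ⁆ (x≢y⇒x∉⁅y⁆ a≢b)) (∈⇒lookup (x∈⁅x⁆ b))
        in bound-resp (*-congˡ (≈-trans
             (+-cong (+-congʳ (+-congˡ (cost-self a))) (+-congʳ (+-congˡ (cost-self b))))
             (solve 6 (λ a b l₁ r₁ l₂ r₂ → ((a ⊞ id) ⊞ (l₁ ⊞ r₁)) ⊞ ((b ⊞ id) ⊞ (l₂ ⊞ r₂))
               ⊜ (a ⊞ b) ⊞ ((l₁ ⊞ l₂) ⊞ (r₁ ⊞ r₂))) ≈-refl _ _ _ _ _ _)))
           (node-bound sp tˡ tʳ ∣δS∣≡4 isPair (⁅⁆⊆ a∈D) (⁅⁆⊆ b∈D) bˡ bʳ bˡ′ bʳ′)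
        where
        a∈D = lookup⇒∈ D₀ (proj₁ (pair-member isPair))
        b∈D = lookup⇒∈ D₀ (proj₂ (pair-member isPair))
        a≢b = pair-≢ isPair
        ⁅⁆⊆ : ∀ {e} → e ∈ D₀ → ⁅ e ⁆ ⊆ D₀
        ⁅⁆⊆ {e} e∈D f∈ = subst (_∈ D₀) (sym (x∈⁅y⁆⇒x≡y e f∈)) e∈D
        cost-self : ∀ e → cost (⁅ e ⁆ ⊕ ⁅ e ⁆) ≈ 0#
        cost-self e = ≈-trans (≈-reflexive (cong cost (⊕-self ⁅ e ⁆))) (total-⊥ G c)

      private
        both : Bool → (Bool → Bool → Carrier) → Carrier
        both α u = u α false + u α true

        both-not : ∀ α u γ → u α (not γ) + u α γ ≈ both α u
        both-not α u true  = ≈-refl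
        both-not α u false = +-comm _ _

        -- A constant pattern sends both children to the pairing (`false`, `true`), the pairing of
        -- siblings averages over both values of `ε`, and the two unbalanced pairings have the same
        -- bound.
        uˢ : Bool → Bool → Carrier
        uˢ false false = C + (L.u false true + R.u false true)
        uˢ false true  = C + ½ * (both false L.u + both false R.u)
        uˢ true  _     = ½ * (C + (both true L.u + both true R.u))

      node-value-bound : ∀ {α β γ η} → η ∩ inner G S ≡ ⊥ → Pattern η p q r s α β γ → Bound t η (uˢ α β)
      -- With constant outer bits `γ`, the value `ε = not γ` makes the crossing edges differ from
      -- them.
      node-value-bound {false} {false} {true}  η∩ pat = equal-bound false η∩ pat
      node-value-bound {false} {false} {false} η∩ pat = equal-bound true η∩ pat
      node-value-bound {false} {true}  {γ}     η∩ pat =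
        bound-resp (≈-trans (½*-shift C _ _) (+-congˡ (*-congˡ (≈-trans
            (solve 4 (λ l₁ r₁ l₂ r₂ → (l₁ ⊞ r₁) ⊞ (l₂ ⊞ r₂) ⊜ (l₁ ⊞ l₂) ⊞ (r₁ ⊞ r₂)) ≈-refl _ _ _ _)
            (+-cong (both-not false L.u γ) (both-not false R.u (not γ)))))))
          (bound-average (equal-bound true η∩ pat) (equal-bound false η∩ pat))
      node-value-bound {true}  {β}     {γ}     η∩ pat =
        bound-resp (*-congˡ (+-congˡ (+-cong (both-not true L.u γ) (both-not true R.u (β xor γ)))))
          (unequal-bound η∩ pat)

      cost-inner : cost (inner G S) ≈ C + (cost (inner G A) + cost (inner G B))
      cost-inner = ≈-trans (≈-reflexive (cong cost inner-partition)) (≈-trans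
        (total-disjoint G c D₀ _ crossing-avoids-inners)
        (+-cong (cost-pair isPair) (total-disjoint G c (inner G A) (inner G B) inner-A∩inner-B)))

      -- The weights 1, 2, 2, 2 reproduce themselves. For each child, `u false true` occurs once
      -- from the constant pattern and once from twice a half, `u false false` once from the latter,
      -- and each unbalanced value twice, from two patterns of weight 2 and factor `½`. `C` occurs 1
      -- + 2 + 4/2 = 5 times.
      node-weight : uˢ false false + 2 · (uˢ false true + (uˢ true false + uˢ true true)) ≤ 5 · cost (inner G S)
      node-weight = begin
        uˢ false false + 2 · (uˢ false true + (uˢ true false + uˢ true true))
          ≈⟨ solve 4 (λ o C y z → o ⊞ (((C ⊞ y) ⊞ (z ⊞ z)) ⊞ (((C ⊞ y) ⊞ (z ⊞ z)) ⊞ id))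
               ⊜ o ⊞ ((C ⊞ C) ⊞ ((y ⊞ y) ⊞ ((z ⊞ z) ⊞ (z ⊞ z))))) ≈-refl _ C _ _ ⟩
        uˢ false false + ((C + C) + ((½ * Y + ½ * Y) + ((½ * Z + ½ * Z) + (½ * Z + ½ * Z))))
          ≈⟨ +-congˡ (+-congˡ (+-cong (½*-+-½* Y) (+-cong (½*-+-½* Z) (½*-+-½* Z)))) ⟩
        uˢ false false + ((C + C) + (Y + (Z + Z)))
          ≈⟨ solve 9 (λ C a00 a01 a10 a11 b00 b01 b10 b11 →
               (C ⊞ (a01 ⊞ b01)) ⊞ ((C ⊞ C) ⊞ (((a00 ⊞ a01) ⊞ (b00 ⊞ b01)) ⊞
                 ((C ⊞ ((a10 ⊞ a11) ⊞ (b10 ⊞ b11))) ⊞ (C ⊞ ((a10 ⊞ a11) ⊞ (b10 ⊞ b11))))))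
               ⊜ (C ⊞ (C ⊞ (C ⊞ (C ⊞ (C ⊞ id))))) ⊞
                 ((a00 ⊞ ((a01 ⊞ (a10 ⊞ a11)) ⊞ ((a01 ⊞ (a10 ⊞ a11)) ⊞ id))) ⊞
                  (b00 ⊞ ((b01 ⊞ (b10 ⊞ b11)) ⊞ ((b01 ⊞ (b10 ⊞ b11)) ⊞ id))))) ≈-refl _ _ _ _ _ _ _ _ _ ⟩
        5 · C + ((L.u false false + 2 · (L.u false true + (L.u true false + L.u true true))) +
                 (R.u false false + 2 · (R.u false true + (R.u true false + R.u true true))))
          ≤⟨ +-monoʳ-≤ (5 · C) (+-mono-≤ L.weight R.weight) ⟩
        5 · C + (5 · cost (inner G A) + 5 · cost (inner G B))
          ≈⟨ solve 3 (λ c i j → (c ⊞ (c ⊞ (c ⊞ (c ⊞ (c ⊞ id))))) ⊞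
               ((i ⊞ (i ⊞ (i ⊞ (i ⊞ (i ⊞ id))))) ⊞ (j ⊞ (j ⊞ (j ⊞ (j ⊞ (j ⊞ id))))))
               ⊜ (c ⊞ (i ⊞ j)) ⊞ ((c ⊞ (i ⊞ j)) ⊞ ((c ⊞ (i ⊞ j)) ⊞ ((c ⊞ (i ⊞ j)) ⊞ ((c ⊞ (i ⊞ j)) ⊞ id)))))
               ≈-refl C _ _ ⟩
        5 · (C + (cost (inner G A) + cost (inner G B)))
          ≈⟨ ·-congʳ 5 cost-inner ⟨
        5 · cost (inner G S) ∎
        where
        open ≤-Reasoning
        Y Z : Carrier
        Y = both false L.u + both false R.u
        Z = C + (both true L.u + both true R.u)

      node-value : Value t p q r s
      node-value = record { u = uˢ ; weight = node-weight ; bound = node-value-bound }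

    module _ {S A B : Subset n} (part : S PartitionsInto A and B) (∣δA∣≡4 : ∣ δ G A ∣ ≡ 4) (∣δB∣≡4 : ∣ δ G B ∣ ≡ 4)
      (∣δS∣≡4 : ∣ δ G S ∣ ≡ 4) where

      ∣δA⊕δB∣≡4 : ∣ δ G A ⊕ δ G B ∣ ≡ 4
      ∣δA⊕δB∣≡4 = trans (cong ∣_∣ (sym (Partition.δ-partition G part))) ∣δS∣≡4

      ∣crossing∣≡2 : ∣ δ G A ∩ δ G B ∣ ≡ 2
      ∣crossing∣≡2 = ∣P∩Q∣≡2 (δ G A) (δ G B) ∣δA∣≡4 ∣δB∣≡4 ∣δA⊕δB∣≡4

      ∣δS∩δA∣≡2 : ∣ δ G S ∩ δ G A ∣ ≡ 2
      ∣δS∩δA∣≡2 = trans (cong (λ Z → ∣ Z ∩ δ G A ∣) (Partition.δ-partition G part))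
        (∣[P⊕Q]∩P∣≡2 (δ G A) (δ G B) ∣δA∣≡4 ∣δB∣≡4 ∣δA⊕δB∣≡4)

      other-side : ∀ {e b} → Vec.lookup (δ G S) e ≡ true → Vec.lookup (δ G A) e ≡ b → Vec.lookup (δ G B) e ≡ not b
      other-side {e} {b} e∈S eA = lemma b _ (trans (cong (_xor Vec.lookup (δ G B) e) (sym eA))
        (trans (sym (lookup-⊕ (δ G A) (δ G B) e))
          (trans (cong (λ Z → Vec.lookup Z e) (sym (Partition.δ-partition G part))) e∈S)))
        where
        lemma : ∀ a b → a xor b ≡ true → b ≡ not a
        lemma true  false _ = refl
        lemma false b     e = e

    -- Of the four edges leaving S, two leave each child; reordering brings those of
    -- the first child to the front.
    sort-quadruple : ∀ {S} (t : Tree x S) (P : EdgeSet G) → ∣ δ G S ∩ P ∣ ≡ 2 →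
      (∀ {p q r s} → IsQuadruple (δ G S) p q r s → Vec.lookup P p ≡ true → Vec.lookup P q ≡ true →
        Vec.lookup P r ≡ false → Vec.lookup P s ≡ false → Value t p q r s) →
      ∀ {p q r s} → IsQuadruple (δ G S) p q r s → Value t p q r s
    sort-quadruple {S} t P ∣δS∩P∣≡2 sorted {p} {q} {r} {s} quad =
      go (Vec.lookup P p) (Vec.lookup P q) (Vec.lookup P r) (Vec.lookup P s) refl refl refl refl
        (trans (sym (IsQuadruple.count quad P)) ∣δS∩P∣≡2)
      where
      go : ∀ b₁ b₂ b₃ b₄ → Vec.lookup P p ≡ b₁ → Vec.lookup P q ≡ b₂ → Vec.lookup P r ≡ b₃ → Vec.lookup P s ≡ b₄ →
           ⟦ b₁ ⟧ ℕ.+ (⟦ b₂ ⟧ ℕ.+ (⟦ b₃ ⟧ ℕ.+ ⟦ b₄ ⟧)) ≡ 2 → Value t p q r s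
      go true  true  false false p∈ q∈ r∉ s∉ _ = sorted quad p∈ q∈ r∉ s∉
      go true  false true  false p∈ q∉ r∈ s∉ _ = value-swap₂₃ (sorted (quadruple-swap₂₃ quad) p∈ r∈ q∉ s∉)
      go true  false false true  p∈ q∉ r∉ s∈ _ = value-swap₃₄ (value-swap₂₃
        (sorted (quadruple-swap₂₃ (quadruple-swap₃₄ quad)) p∈ s∈ q∉ r∉))
      go false true  true  false p∉ q∈ r∈ s∉ _ = value-swap₁₂ (value-swap₂₃
        (sorted (quadruple-swap₂₃ (quadruple-swap₁₂ quad)) q∈ r∈ p∉ s∉))
      go false true  false true  p∉ q∈ r∉ s∈ _ = value-swap₁₂ (value-swap₃₄ (value-swap₂₃
        (sorted (quadruple-swap₂₃ (quadruple-swap₃₄ (quadruple-swap₁₂ quad))) q∈ s∈ p∉ r∉)))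
      go false false true  true  p∉ q∉ r∈ s∈ _ = value-swap₂₃ (value-swap₁₂ (value-swap₃₄ (value-swap₂₃
        (sorted (quadruple-swap₂₃ (quadruple-swap₃₄ (quadruple-swap₁₂ (quadruple-swap₂₃ quad)))) r∈ s∈ p∉ q∉))))
      go true  true  true  true  _ _ _ _ ()
      go true  true  true  false _ _ _ _ ()
      go true  true  false true  _ _ _ _ ()
      go true  false true  true  _ _ _ _ ()
      go true  false false false _ _ _ _ ()
      go false true  true  true  _ _ _ _ ()
      go false true  false false _ _ _ _ ()
      go false false true  false _ _ _ _ ()
      go false false false true  _ _ _ _ ()
      go false false false false _ _ _ _ ()

    tree-value : ∀ {S} (t : Tree x S) → ∣ δ G S ∣ ≡ 4 → ∀ {p q r s} → IsQuadruple (δ G S) p q r s → Value t p q r s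
    tree-value (leaf v S≡) _ quad = leaf-value v S≡ quad
    tree-value {S} t@(node sp tˡ tʳ) ∣δS∣≡4 = sort-quadruple t (δ G A) (∣δS∩δA∣≡2 partition ∣δA∣≡4 ∣δB∣≡4 ∣δS∣≡4) sorted
      where
      open Split sp
      open Partition G partition

      ∣δA∣≡4 : ∣ δ G A ∣ ≡ 4
      ∣δA∣≡4 = tight⇒∣δ∣≡4 half {A} tightˡ

      ∣δB∣≡4 : ∣ δ G B ∣ ≡ 4
      ∣δB∣≡4 = tight⇒∣δ∣≡4 half {B} tightʳ

      sorted : ∀ {p q r s} → IsQuadruple (δ G S) p q r s →
        Vec.lookup (δ G A) p ≡ true → Vec.lookup (δ G A) q ≡ true →
        Vec.lookup (δ G A) r ≡ false → Vec.lookup (δ G A) s ≡ false → Value t p q r s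
      sorted {p} {q} {r} {s} quad p∈A q∈A r∉A s∉A =
        let a , b , isPair      = pair (δ G A ∩ δ G B) (∣crossing∣≡2 partition ∣δA∣≡4 ∣δB∣≡4 ∣δS∣≡4)
            p∈S , q∈S , r∈S , s∈S = quadruple-member quad ∣δS∣≡4
            side                = other-side partition ∣δA∣≡4 ∣δB∣≡4 ∣δS∣≡4
            ∣AB∣                = ∣δA⊕δB∣≡4 partition ∣δA∣≡4 ∣δB∣≡4 ∣δS∣≡4
            ∣BA∣                = trans (cong ∣_∣ (⊕-comm (δ G B) (δ G A))) ∣AB∣
            quadᴬ = P-quadruple (δ G A) (δ G B) ∣δA∣≡4 ∣δB∣≡4 ∣AB∣ (subst (λ Z → IsQuadruple Z p q r s) δ-partition quad) isPair
                      p∈A q∈A r∉A s∉A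
            -- This is the order `r`, `s`, `p`, `q`: for the second child the roles of the two outer
            -- pairs are exchanged.
            quad′ = quadruple-swap₂₃ (quadruple-swap₃₄ (quadruple-swap₁₂ (quadruple-swap₂₃ quad)))
            quadᴮ = P-quadruple (δ G B) (δ G A) ∣δB∣≡4 ∣δA∣≡4 ∣BA∣
                      (subst (λ Z → IsQuadruple Z r s p q) (trans δ-partition (⊕-comm (δ G A) (δ G B))) quad′)
                      (subst (λ Z → IsPair Z a b) (∩-comm (δ G A) (δ G B)) isPair)
                      (side r∈S r∉A) (side s∈S s∉A) (side p∈S p∈A) (side q∈S q∈A)
        in node-value sp tˡ tʳ ∣δS∣≡4 isPair (tree-value tˡ ∣δA∣≡4 quadᴬ) (tree-value tʳ ∣δB∣≡4 quadᴮ)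
             (not-crossing (Bool.∧-zeroʳ _) (side p∈S p∈A)) (not-crossing (Bool.∧-zeroʳ _) (side q∈S q∈A))
             (not-crossingˡ r∉A) (not-crossingˡ s∉A)
        where
        not-crossing : ∀ {e} → Vec.lookup (δ G A) e ∧ false ≡ false → Vec.lookup (δ G B) e ≡ false →
                       Vec.lookup (δ G A ∩ δ G B) e ≡ false
        not-crossing {e} eq e∉B = trans (lookup-∩ (δ G A) (δ G B) e) (trans (cong (Vec.lookup (δ G A) e ∧_) e∉B) eq)
        not-crossingˡ : ∀ {e} → Vec.lookup (δ G A) e ≡ false → Vec.lookup (δ G A ∩ δ G B) e ≡ false
        not-crossingˡ {e} e∉A = trans (lookup-∩ (δ G A) (δ G B) e) (cong (_∧ Vec.lookup (δ G B) e) e∉A)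

    -- The draws at the root and the final average

    module Root (r : Fin n) (tight : Tight x ⁅ r ⁆) (h : Hierarchy x r) where

      open Hierarchy h
      open Split top
      open Partition G partition

      private
        S : Subset n
        S = ∁ ⁅ r ⁆

      ∣δr∣≡4 : ∣ δ G ⁅ r ⁆ ∣ ≡ 4
      ∣δr∣≡4 = tight⇒∣δ∣≡4 half {⁅ r ⁆} tight

      δS≡δr : δ G S ≡ δ G ⁅ r ⁆
      δS≡δr = δ-∁ G ⁅ r ⁆

      ∣δS∣≡4 : ∣ δ G S ∣ ≡ 4
      ∣δS∣≡4 = trans (cong ∣_∣ δS≡δr) ∣δr∣≡4

      ∣δA∣≡4 : ∣ δ G A ∣ ≡ 4
      ∣δA∣≡4 = tight⇒∣δ∣≡4 half {A} tightˡ

      ∣δB∣≡4 : ∣ δ G B ∣ ≡ 4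
      ∣δB∣≡4 = tight⇒∣δ∣≡4 half {B} tightʳ

      ∣δr∩δA∣≡2 : ∣ δ G ⁅ r ⁆ ∩ δ G A ∣ ≡ 2
      ∣δr∩δA∣≡2 = subst (λ Z → ∣ Z ∩ δ G A ∣ ≡ 2) δS≡δr (∣δS∩δA∣≡2 partition ∣δA∣≡4 ∣δB∣≡4 ∣δS∣≡4)

      ∣δr∩δB∣≡2 : ∣ δ G ⁅ r ⁆ ∩ δ G B ∣ ≡ 2
      ∣δr∩δB∣≡2 = subst (λ Z → ∣ Z ∩ δ G B ∣ ≡ 2) δS≡δr
        (∣δS∩δA∣≡2 (partition-sym G partition) ∣δB∣≡4 ∣δA∣≡4 ∣δS∣≡4)

      module _ {p q s t : Edge G} (pairᴬ : IsPair (δ G ⁅ r ⁆ ∩ δ G A) p q) (pairᴮ : IsPair (δ G ⁅ r ⁆ ∩ δ G B) s t)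
        (F : EdgeSet G → Carrier)
        (F≤ : ∀ T H → (∀ v → odd-degree G H v ≡ false) → F T ≤ cost T + cost (T ⊕ H)) where

        private
          Dᴬ Dᴮ : EdgeSet G
          Dᴬ = δ G ⁅ r ⁆ ∩ δ G A
          Dᴮ = δ G ⁅ r ⁆ ∩ δ G B

        p∈ : p ∈ Dᴬ
        p∈ = lookup⇒∈ Dᴬ (proj₁ (pair-member pairᴬ))

        q∈ : q ∈ Dᴬ
        q∈ = lookup⇒∈ Dᴬ (proj₂ (pair-member pairᴬ))

        s∈ : s ∈ Dᴮ
        s∈ = lookup⇒∈ Dᴮ (proj₁ (pair-member pairᴮ))

        t∈ : t ∈ Dᴮ
        t∈ = lookup⇒∈ Dᴮ (proj₂ (pair-member pairᴮ))

        quad : IsQuadruple (δ G S) p q s t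
        quad = quadruple λ X → begin
          ∣ δ G S ∩ X ∣
            ≡⟨ ∣∣-split (δ G S) (δ G A) X ⟩
          ∣ (δ G S ⊕ δ G A) ∩ (δ G S ∩ X) ∣ ℕ.+ ∣ (δ G S ∩ δ G A) ∩ X ∣
            ≡⟨ cong₂ (λ Y Z → ∣ Y ∩ (Z ∩ X) ∣ ℕ.+ ∣ (Z ∩ δ G A) ∩ X ∣) other δS≡δr ⟩
          ∣ δ G B ∩ (δ G ⁅ r ⁆ ∩ X) ∣ ℕ.+ ∣ Dᴬ ∩ X ∣
            ≡⟨ cong (λ Z → ∣ Z ∣ ℕ.+ ∣ Dᴬ ∩ X ∣)
                 (trans (sym (∩-assoc (δ G B) (δ G ⁅ r ⁆) X)) (cong (_∩ X) (∩-comm (δ G B) (δ G ⁅ r ⁆)))) ⟩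
          ∣ Dᴮ ∩ X ∣ ℕ.+ ∣ Dᴬ ∩ X ∣
            ≡⟨ ℕ.+-comm ∣ Dᴮ ∩ X ∣ _ ⟩
          ∣ Dᴬ ∩ X ∣ ℕ.+ ∣ Dᴮ ∩ X ∣
            ≡⟨ cong₂ ℕ._+_ (IsPair.count pairᴬ X) (IsPair.count pairᴮ X) ⟩
          ((X # p) ℕ.+ (X # q)) ℕ.+ ((X # s) ℕ.+ (X # t))
            ≡⟨ ℕ.+-assoc (X # p) (X # q) _ ⟩
          (X # p) ℕ.+ ((X # q) ℕ.+ ((X # s) ℕ.+ (X # t))) ∎
          where
          open ≡-Reasoning
          other : δ G S ⊕ δ G A ≡ δ G B
          other = trans (cong (_⊕ δ G A) δ-partition) (trans (⊕-comm (δ G A ⊕ δ G B) (δ G A)) (⊕-cancelˡ (δ G A) (δ G B)))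

        open Value (tree-value tree ∣δS∣≡4 quad)

        Dᴮ-avoids-Dᴬ : ∀ {e} → e ∈ Dᴮ → Vec.lookup Dᴬ e ≡ false
        Dᴮ-avoids-Dᴬ {e} e∈ = ∉⇒lookup Dᴬ λ e∈A →
          lookup⇒∉ {p = δ G B}
            (other-side partition ∣δA∣≡4 ∣δB∣≡4 ∣δS∣≡4
              (∈⇒lookup (subst (e ∈_) (sym δS≡δr) (p∩q⊆p (δ G ⁅ r ⁆) (δ G B) e∈)))
              (∈⇒lookup (p∩q⊆q (δ G ⁅ r ⁆) (δ G A) e∈A)))
            (p∩q⊆q (δ G ⁅ r ⁆) (δ G B) e∈)

        Dᴬ≢Dᴮ : ∀ {e g} → e ∈ Dᴬ → g ∈ Dᴮ → e ≢ g
        Dᴬ≢Dᴮ e∈ g∈ refl = lookup⇒∉ {p = Dᴬ} (Dᴮ-avoids-Dᴬ g∈) e∈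

        inner-avoids-δr : inner G S ∩ δ G ⁅ r ⁆ ≡ ⊥
        inner-avoids-δr = trans (cong (inner G S ∩_) (sym δS≡δr)) (inner-δ-disjoint G S)

        ⁅⁆⊆δr : ∀ {e D} → e ∈ δ G ⁅ r ⁆ ∩ D → ⁅ e ⁆ ⊆ δ G ⁅ r ⁆
        ⁅⁆⊆δr {e} {D} e∈ f∈ = subst (_∈ δ G ⁅ r ⁆) (sym (x∈⁅y⁆⇒x≡y e f∈)) (p∩q⊆p (δ G ⁅ r ⁆) D e∈)

        Φ : Edge G → Edge G → Carrier
        Φ e g = 𝔼 (treeEdges x tree) λ T → F (⁅ e ⁆ ∪ (⁅ g ⁆ ∪ T))

        -- Here `η` is the even set on the edges at `r`, free to be chosen for given tree edges `e`
        -- and `g`. Besides the vertices of `S` there is only `r`, where evenness comes from the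
        -- pattern since `H` stays inside `S`.
        root-branch : ∀ {e g η α β γ} → e ∈ Dᴬ → g ∈ Dᴮ → η ⊆ δ G ⁅ r ⁆ → Pattern η p q s t α β γ →
          Φ e g ≤ ((cost ⁅ e ⁆ + cost ⁅ g ⁆) + cost ((⁅ e ⁆ ⊕ ⁅ g ⁆) ⊕ η)) + u α β
        root-branch {e} {g} {η} e∈ g∈ η⊆ pat =
          Bound.estimate (bound η∩ pat) ((cost ⁅ e ⁆ + cost ⁅ g ⁆) + cost ((⁅ e ⁆ ⊕ ⁅ g ⁆) ⊕ η)) _ dominated
          where
          η∩ : η ∩ inner G S ≡ ⊥
          η∩ = disjoint-⊆ {p = η} η⊆ ⊆-refl (trans (∩-comm (δ G ⁅ r ⁆) (inner G S)) inner-avoids-δr)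

          dominated : Dominated S η _ (λ T → F (⁅ e ⁆ ∪ (⁅ g ⁆ ∪ T)))
          dominated T H T⊆ H⊆ even = begin
            F T′
              ≤⟨ F≤ T′ (η ⊕ H) everywhere-even ⟩
            cost T′ + cost (T′ ⊕ (η ⊕ H))
              ≈⟨ +-cong (≈-reflexive (cong cost T′≡)) (≈-reflexive (cong cost T′⊕≡)) ⟩
            cost (⁅ e ⁆ ⊕ (⁅ g ⁆ ⊕ T)) + cost (((⁅ e ⁆ ⊕ ⁅ g ⁆) ⊕ η) ⊕ (T ⊕ H))
              ≤⟨ +-mono-≤ (≤-trans (cost-⊕ ⁅ e ⁆ _) (+-monoʳ-≤ _ (cost-⊕ ⁅ g ⁆ T))) (cost-⊕ ((⁅ e ⁆ ⊕ ⁅ g ⁆) ⊕ η) (T ⊕ H)) ⟩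
            (cost ⁅ e ⁆ + (cost ⁅ g ⁆ + cost T)) + (cost ((⁅ e ⁆ ⊕ ⁅ g ⁆) ⊕ η) + cost (T ⊕ H))
              ≈⟨ solve 5 (λ e g t d th → (e ⊞ (g ⊞ t)) ⊞ (d ⊞ th) ⊜ ((e ⊞ g) ⊞ d) ⊞ (t ⊞ th)) ≈-refl _ _ _ _ _ ⟩
            ((cost ⁅ e ⁆ + cost ⁅ g ⁆) + cost ((⁅ e ⁆ ⊕ ⁅ g ⁆) ⊕ η)) + (cost T + cost (T ⊕ H)) ∎
            where
            open ≤-Reasoning
            cost-⊕ = total-⊕ G c cost≥0

            T′ : EdgeSet G
            T′ = ⁅ e ⁆ ∪ (⁅ g ⁆ ∪ T)

            T′≡ : T′ ≡ ⁅ e ⁆ ⊕ (⁅ g ⁆ ⊕ T)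
            T′≡ = trans (cong (⁅ e ⁆ ∪_) g∪T≡) (disjoint⇒∪≡⊕ ⁅ e ⁆ _ (Empty-unique λ (f , f∈) →
              let f∈e , f∈gT = x∈p∩q⁻ ⁅ e ⁆ (⁅ g ⁆ ⊕ T) f∈ in
              e∉gT (subst (_∈ ⁅ g ⁆ ⊕ T) (x∈⁅y⁆⇒x≡y e f∈e) f∈gT)))
              where
              g∪T≡ : ⁅ g ⁆ ∪ T ≡ ⁅ g ⁆ ⊕ T
              g∪T≡ = disjoint⇒∪≡⊕ ⁅ g ⁆ T (disjoint-⊆ {p = ⁅ g ⁆} (⁅⁆⊆δr g∈) T⊆
                (trans (∩-comm (δ G ⁅ r ⁆) (inner G S)) inner-avoids-δr))
              e∉gT : e ∉ ⁅ g ⁆ ⊕ T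
              e∉gT e∈gT with x∈p∪q⁻ ⁅ g ⁆ T (subst (e ∈_) (sym g∪T≡) e∈gT)
              ... | inj₁ e∈g = Dᴬ≢Dᴮ e∈ g∈ (x∈⁅y⁆⇒x≡y g e∈g)
              ... | inj₂ e∈T = ∉⊥ (subst (e ∈_) inner-avoids-δr
                (x∈p∩q⁺ (T⊆ e∈T , p∩q⊆p (δ G ⁅ r ⁆) (δ G A) e∈)))

            T′⊕≡ : T′ ⊕ (η ⊕ H) ≡ ((⁅ e ⁆ ⊕ ⁅ g ⁆) ⊕ η) ⊕ (T ⊕ H)
            T′⊕≡ = trans (cong (_⊕ (η ⊕ H)) T′≡)
              (⊕-solve 5 (λ e g t η h → (e ⊠ (g ⊠ t)) ⊠ (η ⊠ h) ⊖ ((e ⊠ g) ⊠ η) ⊠ (t ⊠ h)) refl ⁅ e ⁆ ⁅ g ⁆ T η H)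
              where open CMSolver (⊕-commutativeMonoid (length G)) using ()
                      renaming (solve to ⊕-solve; _⊕_ to _⊠_; _⊜_ to _⊖_)

            everywhere-even : ∀ v → odd-degree G (η ⊕ H) v ≡ false
            everywhere-even v with v ∈? S
            ... | yes v∈S = even v v∈S
            ... | no  v∉S = trans (cong (odd-degree G (η ⊕ H)) (x∈⁅y⁆⇒x≡y r (x∉∁p⇒x∈p v∉S)))
              (trans (odd-degree-⊕ G η H r) (cong₂ _xor_
                (trans (cong odd (trans (∩-comm η (δ G ⁅ r ⁆)) (cong (_∩ η) (sym δS≡δr)))) (pattern-even {D = δ G S} quad pat))
                (odd-degree-inner G H⊆ (x∈p⇒x∉∁p (x∈⁅x⁆ r)))))

        E : Carrier
        E = ½ * (½ * (Φ p s + Φ p t) + ½ * (Φ q s + Φ q t))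

        -- The four outcomes at the root are equally likely; multiplying by 4 clears the nested
        -- halves.
        E-≤ : ∀ {b₁ b₂ b₃ b₄ y} → Φ p s ≤ b₁ → Φ p t ≤ b₂ → Φ q s ≤ b₃ → Φ q t ≤ b₄ →
              (b₁ + b₂) + (b₃ + b₄) ≈ 4 · y → E ≤ y
        E-≤ {y = y} le₁ le₂ le₃ le₄ eq = ≤-respʳ-≈ (⁻¹-*-cancel 3 y) (divide-≤ 3 (begin
          4 · E
            ≈⟨ solve 1 (λ e → e ⊞ (e ⊞ (e ⊞ (e ⊞ id))) ⊜ (e ⊞ e) ⊞ (e ⊞ e)) ≈-refl E ⟩
          (E + E) + (E + E)
            ≈⟨ +-cong (½*-+-½* _) (½*-+-½* _) ⟩
          (½ * (Φ p s + Φ p t) + ½ * (Φ q s + Φ q t)) + (½ * (Φ p s + Φ p t) + ½ * (Φ q s + Φ q t))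
            ≈⟨ solve 2 (λ y z → (y ⊞ z) ⊞ (y ⊞ z) ⊜ (y ⊞ y) ⊞ (z ⊞ z)) ≈-refl _ _ ⟩
          (½ * (Φ p s + Φ p t) + ½ * (Φ p s + Φ p t)) + (½ * (Φ q s + Φ q t) + ½ * (Φ q s + Φ q t))
            ≈⟨ +-cong (½*-+-½* _) (½*-+-½* _) ⟩
          (Φ p s + Φ p t) + (Φ q s + Φ q t)
            ≤⟨ +-mono-≤ (+-mono-≤ le₁ le₂) (+-mono-≤ le₃ le₄) ⟩
          _
            ≈⟨ eq ⟩
          4 · y ∎))
          where open ≤-Reasoning

        C : Carrier
        C = (cost ⁅ p ⁆ + cost ⁅ q ⁆) + (cost ⁅ s ⁆ + cost ⁅ t ⁆)

        -- The even set avoids `r`, so the join repeats both tree edges there.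
        E≤C+u₀₀ : E ≤ C + u false false
        E≤C+u₀₀ = E-≤ (bnd p∈ s∈) (bnd p∈ t∈) (bnd q∈ s∈) (bnd q∈ t∈)
          (solve 5 (λ p q s t u →
              ((((p ⊞ s) ⊞ (p ⊞ s)) ⊞ u) ⊞ (((p ⊞ t) ⊞ (p ⊞ t)) ⊞ u)) ⊞
              ((((q ⊞ s) ⊞ (q ⊞ s)) ⊞ u) ⊞ (((q ⊞ t) ⊞ (q ⊞ t)) ⊞ u))
            ⊜ (((p ⊞ q) ⊞ (s ⊞ t)) ⊞ u) ⊞ ((((p ⊞ q) ⊞ (s ⊞ t)) ⊞ u) ⊞ ((((p ⊞ q) ⊞ (s ⊞ t)) ⊞ u) ⊞
              ((((p ⊞ q) ⊞ (s ⊞ t)) ⊞ u) ⊞ id)))) ≈-refl _ _ _ _ _)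
          where
          bnd : ∀ {e g} → e ∈ Dᴬ → g ∈ Dᴮ →
            Φ e g ≤ ((cost ⁅ e ⁆ + cost ⁅ g ⁆) + (cost ⁅ e ⁆ + cost ⁅ g ⁆)) + u false false
          bnd {e} {g} e∈ g∈ = ≤-trans
            (root-branch {α = false} {false} {false} e∈ g∈ ⊥⊆ (agreeing (lookup-⊥ p) (lookup-⊥ q) (lookup-⊥ s) (lookup-⊥ t)))
            (+-mono-≤ (+-monoʳ-≤ _ (≤-trans (≤-reflexive (≈-reflexive (cong cost (⊕-identityʳ (⁅ e ⁆ ⊕ ⁅ g ⁆)))))
              (total-⊕ G c cost≥0 ⁅ e ⁆ ⁅ g ⁆))) ≤-refl)

        -- The even set is `Dᴬ` at `r`: the join keeps `g` and exchanges `e` for its partner, so in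
        -- total every edge at `r` is paid for as often as for the empty choice.
        E≤C+u₀₁ : E ≤ C + u false true
        E≤C+u₀₁ = E-≤ (bnd p∈ s∈ p⊕D) (bnd p∈ t∈ p⊕D) (bnd q∈ s∈ q⊕D) (bnd q∈ t∈ q⊕D)
          (solve 5 (λ p q s t u →
              ((((p ⊞ s) ⊞ (s ⊞ q)) ⊞ u) ⊞ (((p ⊞ t) ⊞ (t ⊞ q)) ⊞ u)) ⊞
              ((((q ⊞ s) ⊞ (s ⊞ p)) ⊞ u) ⊞ (((q ⊞ t) ⊞ (t ⊞ p)) ⊞ u))
            ⊜ (((p ⊞ q) ⊞ (s ⊞ t)) ⊞ u) ⊞ ((((p ⊞ q) ⊞ (s ⊞ t)) ⊞ u) ⊞ ((((p ⊞ q) ⊞ (s ⊞ t)) ⊞ u) ⊞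
              ((((p ⊞ q) ⊞ (s ⊞ t)) ⊞ u) ⊞ id)))) ≈-refl _ _ _ _ _)
          where
          p⊕D : ⁅ p ⁆ ⊕ Dᴬ ≡ ⁅ q ⁆
          p⊕D = trans (cong (⁅ p ⁆ ⊕_) (IsPair.≡⁅⁆⊕⁅⁆ pairᴬ)) (⊕-cancelˡ ⁅ p ⁆ ⁅ q ⁆)
          q⊕D : ⁅ q ⁆ ⊕ Dᴬ ≡ ⁅ p ⁆
          q⊕D = trans (cong (⁅ q ⁆ ⊕_) (trans (IsPair.≡⁅⁆⊕⁅⁆ pairᴬ) (⊕-comm ⁅ p ⁆ ⁅ q ⁆))) (⊕-cancelˡ ⁅ q ⁆ ⁅ p ⁆)

          bnd : ∀ {e e′ g} → e ∈ Dᴬ → g ∈ Dᴮ → ⁅ e ⁆ ⊕ Dᴬ ≡ ⁅ e′ ⁆ →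
            Φ e g ≤ ((cost ⁅ e ⁆ + cost ⁅ g ⁆) + (cost ⁅ g ⁆ + cost ⁅ e′ ⁆)) + u false true
          bnd {e} {e′} {g} e∈ g∈ eq = ≤-trans
            (root-branch {α = false} {true} {true} e∈ g∈ (p∩q⊆p (δ G ⁅ r ⁆) (δ G A))
              (agreeing (∈⇒lookup p∈) (∈⇒lookup q∈) (Dᴮ-avoids-Dᴬ s∈) (Dᴮ-avoids-Dᴬ t∈)))
            (+-mono-≤ (+-monoʳ-≤ _ (≤-trans (≤-reflexive (≈-reflexive (cong cost
                (trans (cong (_⊕ Dᴬ) (⊕-comm ⁅ e ⁆ ⁅ g ⁆)) (trans (⊕-assoc ⁅ g ⁆ ⁅ e ⁆ Dᴬ) (cong (⁅ g ⁆ ⊕_) eq))))))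
              (total-⊕ G c cost≥0 ⁅ g ⁆ ⁅ e′ ⁆))) ≤-refl)

        -- The even set at `r` consists of the two tree edges, so the join has no edge there. Which
        -- unbalanced pairing arises is dictated by the draw, and each arises in two of the four
        -- outcomes; only their mean is bounded.
        E≤½[C+u₁] : E ≤ ½ * (C + (u true false + u true true))
        E≤½[C+u₁] = E-≤
          (bnd false true  p∈ s∈ (on p∈ s∈ (self p) (differ p≢q) (self s) (differ s≢t)))
          (bnd true  true  p∈ t∈ (on p∈ t∈ (self p) (differ p≢q) (differ (s≢t ∘ sym)) (self t)))
          (bnd true  false q∈ s∈ (on q∈ s∈ (differ (p≢q ∘ sym)) (self q) (self s) (differ s≢t)))
          (bnd false false q∈ t∈ (on q∈ t∈ (differ (p≢q ∘ sym)) (self q) (differ (s≢t ∘ sym)) (self t)))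
          (≈-trans
            (solve 6 (λ p q s t u₀ u₁ →
                (((p ⊞ s) ⊞ u₀) ⊞ ((p ⊞ t) ⊞ u₁)) ⊞ (((q ⊞ s) ⊞ u₁) ⊞ ((q ⊞ t) ⊞ u₀))
              ⊜ (((p ⊞ q) ⊞ (s ⊞ t)) ⊞ (u₀ ⊞ u₁)) ⊞ (((p ⊞ q) ⊞ (s ⊞ t)) ⊞ (u₀ ⊞ u₁))) ≈-refl _ _ _ _ _ _)
            (≈-trans (≈-sym (+-cong (½*-+-½* _) (½*-+-½* _)))
              (solve 1 (λ z → (z ⊞ z) ⊞ (z ⊞ z) ⊜ z ⊞ (z ⊞ (z ⊞ (z ⊞ id)))) ≈-refl _)))
          where
          p≢q = pair-≢ pairᴬ
          s≢t = pair-≢ pairᴮ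

          self : ∀ (e : Edge G) → Vec.lookup ⁅ e ⁆ e ≡ true
          self e = ∈⇒lookup (x∈⁅x⁆ e)

          differ : ∀ {e f : Edge G} → e ≢ f → Vec.lookup ⁅ e ⁆ f ≡ false
          differ {e} e≢f = ∉⇒lookup ⁅ e ⁆ (x≢y⇒x∉⁅y⁆ (e≢f ∘ sym))

          on : ∀ {e g b₁ b₂ b₃ b₄} → e ∈ Dᴬ → g ∈ Dᴮ →
            Vec.lookup ⁅ e ⁆ p ≡ b₁ → Vec.lookup ⁅ e ⁆ q ≡ b₂ → Vec.lookup ⁅ g ⁆ s ≡ b₃ → Vec.lookup ⁅ g ⁆ t ≡ b₄ →
            Vec.lookup (⁅ e ⁆ ⊕ ⁅ g ⁆) p ≡ b₁ × Vec.lookup (⁅ e ⁆ ⊕ ⁅ g ⁆) q ≡ b₂ ×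
            Vec.lookup (⁅ e ⁆ ⊕ ⁅ g ⁆) s ≡ b₃ × Vec.lookup (⁅ e ⁆ ⊕ ⁅ g ⁆) t ≡ b₄
          on {e} {g} e∈ g∈ eq₁ eq₂ eq₃ eq₄ = left-of p∈ eq₁ , left-of q∈ eq₂ , right-of s∈ eq₃ , right-of t∈ eq₄
            where
            left-of : ∀ {f b} → f ∈ Dᴬ → Vec.lookup ⁅ e ⁆ f ≡ b → Vec.lookup (⁅ e ⁆ ⊕ ⁅ g ⁆) f ≡ b
            left-of {f} f∈ eq = trans (lookup-⊕ ⁅ e ⁆ ⁅ g ⁆ f)
              (trans (cong₂ _xor_ eq (differ (Dᴬ≢Dᴮ f∈ g∈ ∘ sym))) (Bool.xor-identityʳ _))
            right-of : ∀ {f b} → f ∈ Dᴮ → Vec.lookup ⁅ g ⁆ f ≡ b → Vec.lookup (⁅ e ⁆ ⊕ ⁅ g ⁆) f ≡ b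
            right-of {f} f∈ eq = trans (lookup-⊕ ⁅ e ⁆ ⁅ g ⁆ f) (cong₂ _xor_ (differ (Dᴬ≢Dᴮ e∈ f∈)) eq)

          bnd : ∀ β γ {e g} → e ∈ Dᴬ → g ∈ Dᴮ →
            (Vec.lookup (⁅ e ⁆ ⊕ ⁅ g ⁆) p ≡ γ × Vec.lookup (⁅ e ⁆ ⊕ ⁅ g ⁆) q ≡ not γ ×
             Vec.lookup (⁅ e ⁆ ⊕ ⁅ g ⁆) s ≡ β xor γ × Vec.lookup (⁅ e ⁆ ⊕ ⁅ g ⁆) t ≡ not (β xor γ)) →
            Φ e g ≤ (cost ⁅ e ⁆ + cost ⁅ g ⁆) + u true β
          bnd β γ {e} {g} e∈ g∈ (at-p , at-q , at-s , at-t) = ≤-trans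
            (root-branch {α = true} {β} {γ} e∈ g∈
              (⊕-⊆ {p = ⁅ e ⁆} (⁅⁆⊆δr {D = δ G A} e∈) (⁅⁆⊆δr {D = δ G B} g∈)) (agreeing at-p at-q at-s at-t))
            (≤-reflexive (+-congʳ (≈-trans (+-congˡ (≈-trans
              (≈-reflexive (cong cost (⊕-self (⁅ e ⁆ ⊕ ⁅ g ⁆)))) (total-⊥ G c))) (+-identityʳ _))))

        -- `maxEntropy` draws the inner tree before the edges at `r`, while `E` averages over the
        -- latter outermost; linearity of expectation exchanges the two.
        𝔼≈E : 𝔼 (maxEntropy x r h) F ≈ E
        𝔼≈E = begin-equality
          𝔼 (maxEntropy x r h) F
            ≈⟨ 𝔼->>= (treeEdges x tree) _ F ⟩
          𝔼 (treeEdges x tree) _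
            ≈⟨ 𝔼-cong (treeEdges x tree) (λ T → ≈-trans (𝔼->>= (uniform Dᴬ) _ F) (≈-trans
                 (𝔼-cong (uniform Dᴬ) λ e → ≈-trans
                   (𝔼->>= (uniform Dᴮ) (λ g → return (⁅ e ⁆ ∪ (⁅ g ⁆ ∪ T))) F)
                   (≈-trans (𝔼-cong (uniform Dᴮ) λ g → 𝔼-return (⁅ e ⁆ ∪ (⁅ g ⁆ ∪ T)) F)
                     (𝔼-uniform-pair pairᴮ λ g → F (⁅ e ⁆ ∪ (⁅ g ⁆ ∪ T)))))
                 (𝔼-uniform-pair pairᴬ λ e → ½ * (F (⁅ e ⁆ ∪ (⁅ s ⁆ ∪ T)) + F (⁅ e ⁆ ∪ (⁅ t ⁆ ∪ T)))))) ⟩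
          𝔼 (treeEdges x tree) (λ T → ½ * (½ * (f p s T + f p t T) + ½ * (f q s T + f q t T)))
            ≈⟨ average _ _ ⟩
          ½ * (𝔼 (treeEdges x tree) (λ T → ½ * (f p s T + f p t T)) + 𝔼 (treeEdges x tree) (λ T → ½ * (f q s T + f q t T)))
            ≈⟨ *-congˡ (+-cong (average _ _) (average _ _)) ⟩
          E ∎
          where
          open ≤-Reasoning
          f : Edge G → Edge G → EdgeSet G → Carrier
          f e g T = F (⁅ e ⁆ ∪ (⁅ g ⁆ ∪ T))

          average : ∀ f g → 𝔼 (treeEdges x tree) (λ T → ½ * (f T + g T)) ≈
                            ½ * (𝔼 (treeEdges x tree) f + 𝔼 (treeEdges x tree) g)
          average f g = ≈-trans (𝔼-* ½ (treeEdges x tree) _) (*-congˡ (𝔼-+ (treeEdges x tree) f g))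

        cost-δr : cost (δ G S) ≈ C
        cost-δr = ≈-trans (≈-reflexive (cong cost δS≡))
          (≈-trans (total-disjoint G c Dᴬ Dᴮ disjoint-D) (+-cong (cost-pair pairᴬ) (cost-pair pairᴮ)))
          where
          δS≡ : δ G S ≡ Dᴬ ⊕ Dᴮ
          δS≡ = begin
            δ G S                                           ≡⟨ ∩-idem (δ G S) ⟨
            δ G S ∩ δ G S                                   ≡⟨ cong (_∩ δ G S) δ-partition ⟩
            (δ G A ⊕ δ G B) ∩ δ G S                         ≡⟨ cong ((δ G A ⊕ δ G B) ∩_) δS≡δr ⟩
            (δ G A ⊕ δ G B) ∩ δ G ⁅ r ⁆                     ≡⟨ ∩-distribʳ-⊕ (δ G ⁅ r ⁆) (δ G A) (δ G B) ⟩
            (δ G A ∩ δ G ⁅ r ⁆) ⊕ (δ G B ∩ δ G ⁅ r ⁆)       ≡⟨ cong₂ _⊕_ (∩-comm (δ G A) _) (∩-comm (δ G B) _) ⟩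
            Dᴬ ⊕ Dᴮ                                         ∎
            where open ≡-Reasoning

          disjoint-D : Dᴬ ∩ Dᴮ ≡ ⊥
          disjoint-D = Empty-unique λ (e , e∈) →
            let e∈A , e∈B = x∈p∩q⁻ Dᴬ Dᴮ e∈ in lookup⇒∉ {p = Dᴬ} (Dᴮ-avoids-Dᴬ e∈B) e∈A

        -- The three bounds are taken with weights 1, 2 and 4, the last one serving both unbalanced
        -- pairings. The edges at `r` thus contribute 1 + 2 + 4/2 = 5 times `C`, matching the factor
        -- of `weight` inside `S`.
        7E≤5cost : 7 · 𝔼 (maxEntropy x r h) F ≤ 5 · cost ⊤
        7E≤5cost = begin
          7 · 𝔼 (maxEntropy x r h) F
            ≈⟨ ·-congʳ 7 𝔼≈E ⟩
          7 · E
            ≈⟨ solve 1 (λ e → e ⊞ (e ⊞ (e ⊞ (e ⊞ (e ⊞ (e ⊞ (e ⊞ id)))))) ⊜ e ⊞ ((e ⊞ e) ⊞ ((e ⊞ e) ⊞ (e ⊞ e)))) ≈-refl E ⟩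
          E + ((E + E) + ((E + E) + (E + E)))
            ≤⟨ +-mono-≤ E≤C+u₀₀ (+-mono-≤ (+-mono-≤ E≤C+u₀₁ E≤C+u₀₁) (+-mono-≤ E+E≤ E+E≤)) ⟩
          (C + u false false) + (((C + u false true) + (C + u false true)) +
            ((C + (u true false + u true true)) + (C + (u true false + u true true))))
            ≈⟨ solve 5 (λ c o i j k → (c ⊞ o) ⊞ (((c ⊞ i) ⊞ (c ⊞ i)) ⊞ ((c ⊞ (j ⊞ k)) ⊞ (c ⊞ (j ⊞ k))))
                 ⊜ (c ⊞ (c ⊞ (c ⊞ (c ⊞ (c ⊞ id))))) ⊞ (o ⊞ ((i ⊞ (j ⊞ k)) ⊞ ((i ⊞ (j ⊞ k)) ⊞ id)))) ≈-refl C _ _ _ _ ⟩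
          5 · C + (u false false + 2 · (u false true + (u true false + u true true)))
            ≤⟨ +-monoʳ-≤ (5 · C) weight ⟩
          5 · C + 5 · cost (inner G S)
            ≈⟨ solve 2 (λ c i → (c ⊞ (c ⊞ (c ⊞ (c ⊞ (c ⊞ id))))) ⊞ (i ⊞ (i ⊞ (i ⊞ (i ⊞ (i ⊞ id)))))
                 ⊜ (c ⊞ i) ⊞ ((c ⊞ i) ⊞ ((c ⊞ i) ⊞ ((c ⊞ i) ⊞ ((c ⊞ i) ⊞ id))))) ≈-refl C _ ⟩
          5 · (C + cost (inner G S))
            ≤⟨ ·-mono 5 C+inner≤ ⟩
          5 · cost ⊤ ∎
          where
          open ≤-Reasoning
          E+E≤ : E + E ≤ C + (u true false + u true true)
          E+E≤ = ≤-respʳ-≈ (½*-+-½* _) (+-mono-≤ E≤½[C+u₁] E≤½[C+u₁])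

          ·-mono : ∀ k {y z} → y ≤ z → k · y ≤ k · z
          ·-mono ℕ.zero    _   = ≤-refl
          ·-mono (ℕ.suc k) y≤z = +-mono-≤ y≤z (·-mono k y≤z)

          C+inner≤ : C + cost (inner G S) ≤ cost ⊤
          C+inner≤ = ≤-respˡ-≈
            (≈-trans (total-disjoint G c (δ G S) (inner G S) (trans (∩-comm (δ G S) _) (inner-δ-disjoint G S)))
              (+-congʳ cost-δr))
            (total≤⊤ G c cost≥0 (δ G S ⊕ inner G S))

-- Nonnegativity of the costs

third-vertex : ∀ {n} {a b c : Fin n} → a ≢ b → a ≢ c → b ≢ c → ∀ j k → ∃[ i ] i ≢ j × i ≢ k
third-vertex {a = a} {b} {c} a≢b a≢c b≢c j k with a Fin.≟ j | a Fin.≟ k | b Fin.≟ j | b Fin.≟ k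
... | no a≢j   | no a≢k   | _        | _        = a , a≢j , a≢k
... | _        | _        | no b≢j   | no b≢k   = b , b≢j , b≢k
... | yes refl | _        | yes refl | _        = contradiction refl a≢b
... | _        | yes refl | _        | yes refl = contradiction refl a≢b
... | yes refl | _        | _        | yes refl = c , (λ c≡a → a≢c (sym c≡a)) , (λ c≡b → b≢c (sym c≡b))
... | _        | yes refl | yes refl | _        = c , (λ c≡b → b≢c (sym c≡b)) , (λ c≡a → a≢c (sym c≡a))

module NonNegativity {a ℓ₁ ℓ₂} (K : OrderedField a ℓ₁ ℓ₂) where

  open OrderedField K
  open OrderedFieldProperties K
  open TSP K

  -- Adding the triangle inequalities c i j ≤ c i k + c k j and c i k ≤ c i j + c j k
  -- leaves 0 ≤ c k j + c j k.
  cost-nonNeg : ∀ {n} {c : EdgeVector n} → IsTSPInstance c →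
    (∀ j k → ∃[ i ] i ≢ j × i ≢ k) → ∀ j k → j ≢ k → 0# ≤ c j k
  cost-nonNeg {c = c} isTSP third j k j≢k =
    let i , i≢j , i≢k = third j k in half-nonNeg (+-cancelˡ-≤ (c i j + c i k) (begin
      (c i j + c i k) + 0#                      ≈⟨ +-identityʳ _ ⟩
      c i j + c i k                             ≤⟨ +-mono-≤ (triangle i j k i≢j i≢k (j≢k ∘ sym)) (triangle i k j i≢k i≢j j≢k) ⟩
      (c i k + c k j) + (c i j + c j k)         ≈⟨ +-congʳ (+-congˡ (symmetric k j)) ⟩
      (c i k + c j k) + (c i j + c j k)
        ≈⟨ solve 3 (λ ik jk ij → (ik ⊞ jk) ⊞ (ij ⊞ jk) ⊜ (ij ⊞ ik) ⊞ (jk ⊞ jk)) ≈-refl _ _ _ ⟩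
      (c i j + c i k) + (c j k + c j k)         ∎))
    where
    open IsTSPInstance isTSP
    open ≤-Reasoning

-- The approximation ratio

theorem1p2 : ∀ {a ℓ₁ ℓ₂} (K : OrderedField a ℓ₁ ℓ₂) →
    let open OrderedField K
        open TSP K
    in
    ∀ {n} (c x : EdgeVector n) → IsHalfIntegralCycleCut c x →
    ∀ (r : Fin n) (h : Hierarchy x r)
      (M : EdgeSet (split x) → EdgeSet (complete n)) →
    (∀ T → IsMinCostPerfectMatching c (oddVertices (split x) T) (M T)) →
    𝔼 (maxEntropy x r h) (λ T → total (split x) c T + total (complete n) c (M T))
      ≤ fromℕ 10 * fromℕ 7 ⁻¹ * lpCost c x
theorem1p2 K {n} c x inst r h M isMin =
  let p , q , pairᴬ = pair _ ∣δr∩δA∣≡2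
      s , t , pairᴮ = pair _ ∣δr∩δB∣≡2
  -- The bound 7 𝔼 ≤ 5 `total ⊤` is divided by 7; the split graph costs twice `lpCost c x`, so 5
  -- becomes 10.
  in ≤-respʳ-≈ (≈-trans (*-congˡ tenfold) (≈-trans (≈-sym (*-assoc _ _ _)) (*-congʳ (*-comm _ _))))
       (divide-≤ 6 (7E≤5cost pairᴬ pairᴮ _ dominated))
  where
  open OrderedField K
  open TSP K
  open OrderedFieldProperties K
  open SplitProperties K
  open MaxEntropy K
  open Shortcutting K
  open IsHalfIntegralCycleCut inst

  c≥0 : ∀ i j → i ≢ j → 0# ≤ c i j
  c≥0 = NonNegativity.cost-nonNeg K isTSPInstance
    -- The triangle inequality is given only for distinct vertices, so a third vertex is needed for
    -- each pair. Three distinct ones are at hand: one in each child of the top set, and `r`.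
    (third-vertex (λ { refl → A∌ (proj₂ nonemptyʳ) (proj₂ nonemptyˡ) }) (≢r A⊆S nonemptyˡ) (≢r B⊆S nonemptyʳ))
    where
    open Split (Hierarchy.top h)
    open _PartitionsInto_and_ partition
    open Partition (split x) partition
    ≢r : ∀ {Z} → Z ⊆ ∁ ⁅ r ⁆ → (nonempty : Nonempty Z) → proj₁ nonempty ≢ r
    ≢r Z⊆ (_ , v∈Z) refl = x∈∁p⇒x∉p (Z⊆ v∈Z) (x∈⁅x⁆ r)

  no-loops : ∀ e → start (split x) e ≢ finish (split x) e
  no-loops = split-no-loops halfIntegral

  open Instance c x halfIntegral (λ e → c≥0 _ _ (no-loops e))
  open Root r (IsSubtourFeasible.degree≈2 isFeasible r) h

  dominated : ∀ T H → (∀ v → odd-degree (split x) H v ≡ false) →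
    total (split x) c T + total (complete n) c (M T) ≤ total (split x) c T + total (split x) c (T ⊕ H)
  dominated T H even = +-monoʳ-≤ _ (min-matching-≤ c isTSPInstance c≥0 (split x) no-loops {T} {T ⊕ H} (isMin T) λ v →
    trans (odd-degree-⊕ (split x) T H v) (trans (cong (odd-degree (split x) T v xor_) (even v)) (Bool.xor-identityʳ _)))

  tenfold : 5 · total (split x) c ⊤ ≈ fromℕ 10 * lpCost c x
  tenfold = ≈-trans (·-congʳ 5 (total-split halfIntegral c)) (≈-trans
    (solve 1 (λ l → (l ⊞ l) ⊞ ((l ⊞ l) ⊞ ((l ⊞ l) ⊞ ((l ⊞ l) ⊞ ((l ⊞ l) ⊞ id))))
      ⊜ l ⊞ (l ⊞ (l ⊞ (l ⊞ (l ⊞ (l ⊞ (l ⊞ (l ⊞ (l ⊞ (l ⊞ id)))))))))) ≈-refl (lpCost c x))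
    (≈-sym (fromℕ-* 10 (lpCost c x))))
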